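{- Let X be a comparison-based sorting algorithm that, on average, needs at most $n\log n + cn + o(n)$ comparisons to sort an array of $n$ elements (for some constant $c$). Then QuickXsort with algorithm X, implemented with $\Theta(\sqrt{n})$ elements as sample for pivot selection, is a sorting algorithm that also needs at most $n\log n + cn + o(n)$ comparisons in the average case.
   Context: All logarithms $\log$ are to base 2. Sorting algorithms are comparison based; cost is measured by the number of element comparisons. "Average case" refers to the uniform distribution over all $n!$ input orderings of $n$ pairwise distinct elements. QuickXsort with algorithm X works as follows on an array of length $n$: choose a pivot as the median of a random sample of $\Theta(\sqrt{n})$ elements of the array; partition the array (with $n-1$ comparisons) so that all elements left of the pivot are smaller and all elements right of it are larger; sort one of the two parts with X (the other part, not currently being sorted, may be used as temporary storage for X by swapping elements); move the pivot to its final position; then sort the other part recursively with QuickXsort. Which of the two parts is sorted by X may be chosen by an arbitrary rule. The comparisons for pivot selection are counted.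
   Formalization: The formal theorem adds that the median of a sample of k elements is found with o(k²) comparisons on average (else false), that pivot selection moves no elements, and that the rule for X's part depends only on sample positions, pivot and partition outcomes. -}

module Defs where

open import Data.Bool using (Bool; true; false; if_then_else_)
open import Data.Fin using (Fin; zero; suc; toℕ; punchIn; _<?_)
open import Data.Fin.Permutation using (Permutation′; _⟨$⟩ʳ_; insert)
  renaming (id to idₚ)
open import Data.Fin.Subset using (Subset; ∁)
open import Data.Fin.Subset.Properties using (_∈?_)
open import Data.Integer using (+_; 1ℤ)
import Data.Integer as ℤ
import Data.Integer.Properties as ℤ
open import Data.List using (List; []; _∷_; _++_; length; map; filter; allFin; lookup)
open import Data.List.Properties using (length-filter; length-map; length-tabulate)
open import Data.List.Relation.Binary.Permutation.Propositional using (_↭_)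
open import Data.List.Relation.Unary.Linked using (Linked)
open import Data.Nat as ℕ
  using (ℕ; zero; suc; NonZero; ⌊_/2⌋; pred; _!; _^_; _≤_; _<_; z≤n; s≤s; s≤s⁻¹)
import Data.Nat.Properties as ℕ
open import Data.Nat.Induction using (<-wellFounded; <-rec)
open import Data.Nat.Logarithm
  using (⌊log₂_⌋; ⌊log₂⌋-mono-≤; ⌊log₂[2^n]⌋≡n; ⌊log₂⌊n/2⌋⌋≡⌊log₂n⌋∸1)
open import Data.Product using (∃-syntax; _×_; _,_)
open import Data.Rational as ℚ using (ℚ; 0ℚ; 1ℚ; ∣_∣)
import Data.Rational.Properties as ℚ
open import Data.Rational.Solver using (module +-*-Solver)
import Data.Rational.Unnormalised as ℚᵘ
import Data.Rational.Unnormalised.Properties as ℚᵘ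
open import Data.Vec as Vec using (Vec; []; _∷_)
open import Algebra.Properties.CommutativeMonoid.Sum ℚ.+-0-commutativeMonoid using (sum)
open import Function using (_∘_)
open import Induction.WellFounded using (Acc; acc)
open import Relation.Binary.PropositionalEquality
  using (_≡_; refl; sym; trans; cong; cong₂; subst; subst₂)
open import Relation.Nullary using (does; yes; no; contradiction)

------------------------------------------------------------------------
-- Real numbers

fromℕ : ℕ → ℚ
fromℕ n = + n ℚ./ 1

1/suc : ℕ → ℚ
1/suc n = 1ℤ ℚ./ suc n

-- Bishop's regular sequences. `regular` is stated for all m and n, so it
-- says ∣ seq m - seq n ∣ ≤ 1/(m+1) + 1/(n+1).

record ℝ : Set where
  field
    seq     : ℕ → ℚ
    regular : ∀ m n → seq m ℚ.≤ seq n ℚ.+ (1/suc m ℚ.+ 1/suc n)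

open ℝ public

infix 4 _≤ᵣ_

_≤ᵣ_ : ℝ → ℝ → Set
x ≤ᵣ y = ∀ n → seq x n ℚ.≤ seq y n ℚ.+ (1/suc n ℚ.+ 1/suc n)

private

  /-mono-≤ : ∀ a b c d → a ℕ.* suc d ≤ c ℕ.* suc b → + a ℚ./ suc b ℚ.≤ + c ℚ./ suc d
  /-mono-≤ a b c d h = ℚ.toℚᵘ-cancel-≤
    (ℚᵘ.≤-trans (ℚᵘ.≤-reflexive (ℚ.toℚᵘ-fromℚᵘ (ℚᵘ.mkℚᵘ (+ a) b)))
    (ℚᵘ.≤-trans (ℚᵘ.*≤* (subst₂ ℤ._≤_ (ℤ.pos-* a (suc d)) (ℤ.pos-* c (suc b)) (ℤ.+≤+ h)))
                (ℚᵘ.≤-reflexive (ℚᵘ.≃-sym (ℚ.toℚᵘ-fromℚᵘ (ℚᵘ.mkℚᵘ (+ c) d))))))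

  /-≡ : ∀ a b c d → a ℕ.* suc d ≡ c ℕ.* suc b → + a ℚ./ suc b ≡ + c ℚ./ suc d
  /-≡ a b c d h = ℚ.≤-antisym (/-mono-≤ a b c d (ℕ.≤-reflexive h))
                              (/-mono-≤ c d a b (ℕ.≤-reflexive (sym h)))

  /-+ : ∀ a c b → (+ a ℚ./ suc b) ℚ.+ (+ c ℚ./ suc b) ≡ + (a ℕ.+ c) ℚ./ suc b
  /-+ a c b = ℚ.toℚᵘ-injective
    (ℚᵘ.≃-trans (ℚ.toℚᵘ-homo-+ (+ a ℚ./ suc b) (+ c ℚ./ suc b))
    (ℚᵘ.≃-trans (ℚᵘ.+-cong (ℚ.toℚᵘ-fromℚᵘ (ℚᵘ.mkℚᵘ (+ a) b)) (ℚ.toℚᵘ-fromℚᵘ (ℚᵘ.mkℚᵘ (+ c) b)))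
    (ℚᵘ.≃-trans (ℚᵘ.*≡* eq) (ℚᵘ.≃-sym (ℚ.toℚᵘ-fromℚᵘ (ℚᵘ.mkℚᵘ (+ (a ℕ.+ c)) b))))))
    where
    s = + suc b
    eq : (+ a ℤ.* s ℤ.+ + c ℤ.* s) ℤ.* s ≡ + (a ℕ.+ c) ℤ.* (s ℤ.* s)
    eq = trans (cong (ℤ._* s) (sym (ℤ.*-distribʳ-+ s (+ a) (+ c))))
               (ℤ.*-assoc (+ (a ℕ.+ c)) s s)

  1/suc-double : ∀ n → 1/suc (n ℕ.+ suc n) ℚ.+ 1/suc (n ℕ.+ suc n) ≡ 1/suc n
  1/suc-double n = trans (/-+ 1 1 (n ℕ.+ suc n))
    (/-≡ 2 (n ℕ.+ suc n) 1 n
      (trans (cong (suc n ℕ.+_) (ℕ.+-identityʳ (suc n))) (sym (ℕ.+-identityʳ _))))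

  *-/ : ∀ n a b → fromℕ n ℚ.* (+ a ℚ./ suc b) ≡ + (n ℕ.* a) ℚ./ suc b
  *-/ n a b = ℚ.toℚᵘ-injective
    (ℚᵘ.≃-trans (ℚ.toℚᵘ-homo-* (fromℕ n) (+ a ℚ./ suc b))
    (ℚᵘ.≃-trans (ℚᵘ.*-cong (ℚ.toℚᵘ-fromℚᵘ (ℚᵘ.mkℚᵘ (+ n) 0)) (ℚ.toℚᵘ-fromℚᵘ (ℚᵘ.mkℚᵘ (+ a) b)))
    (ℚᵘ.≃-trans (ℚᵘ.*≡* eq) (ℚᵘ.≃-sym (ℚ.toℚᵘ-fromℚᵘ (ℚᵘ.mkℚᵘ (+ (n ℕ.* a)) b))))))
    where
    eq : (+ n ℤ.* + a) ℤ.* + suc b ≡ + (n ℕ.* a) ℤ.* (+ 1 ℤ.* + suc b)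
    eq = cong₂ ℤ._*_ (sym (ℤ.pos-* n a)) (sym (ℤ.*-identityˡ (+ suc b)))

  n/suc[n*suc] : ∀ n k → fromℕ n ℚ.* 1/suc (n ℕ.* suc k) ℚ.≤ 1/suc k
  n/suc[n*suc] n k rewrite *-/ n 1 (n ℕ.* suc k) | ℕ.*-identityʳ n =
    /-mono-≤ n (n ℕ.* suc k) 1 k
      (ℕ.≤-trans (ℕ.n≤1+n _) (ℕ.≤-reflexive (sym (ℕ.*-identityˡ (suc (n ℕ.* suc k))))))

toℝ : ℚ → ℝ
toℝ q .seq _ = q
toℝ q .regular m n = ℚ.≤-trans (ℚ.≤-reflexive (sym (ℚ.+-identityʳ q)))
  (ℚ.+-monoʳ-≤ q (ℚ.+-mono-≤ {0ℚ} {1/suc m} {0ℚ} {1/suc n} (0≤1/suc m) (0≤1/suc n)))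
  where
  0≤1/suc : ∀ k → 0ℚ ℚ.≤ 1/suc k
  0≤1/suc k = /-mono-≤ 0 0 1 k z≤n

infixl 6 _+ᵣ_

_+ᵣ_ : ℝ → ℝ → ℝ
(x +ᵣ y) .seq n = seq x (n ℕ.+ suc n) ℚ.+ seq y (n ℕ.+ suc n)
(x +ᵣ y) .regular m n =
  ℚ.≤-trans (ℚ.+-mono-≤ (regular x m′ n′) (regular y m′ n′))
  (ℚ.≤-reflexive (trans
    (solve 4 (λ a b u v → (a :+ (u :+ v)) :+ (b :+ (u :+ v))
                       := (a :+ b) :+ ((u :+ u) :+ (v :+ v))) refl
       (seq x n′) (seq y n′) (1/suc m′) (1/suc n′))
    (cong ((seq x n′ ℚ.+ seq y n′) ℚ.+_) (cong₂ ℚ._+_ (1/suc-double m) (1/suc-double n)))))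
  where
  open +-*-Solver
  m′ = m ℕ.+ suc m
  n′ = n ℕ.+ suc n

infixl 7 _·_

_·_ : ℕ → ℝ → ℝ
(a · x) .seq n = fromℕ a ℚ.* seq x (a ℕ.* suc n)
(a · x) .regular m n =
  ℚ.≤-trans (ℚ.*-monoˡ-≤-nonNeg (fromℕ a) {{ℚ.normalize-nonNeg a 1}} (regular x m′ n′))
  (ℚ.≤-trans (ℚ.≤-reflexive
    (solve 4 (λ a s u v → a :* (s :+ (u :+ v)) := a :* s :+ (a :* u :+ a :* v)) refl
       (fromℕ a) (seq x n′) (1/suc m′) (1/suc n′)))
    (ℚ.+-monoʳ-≤ (fromℕ a ℚ.* seq x n′) (ℚ.+-mono-≤ (n/suc[n*suc] a m) (n/suc[n*suc] a n))))
  where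
  open +-*-Solver
  m′ = a ℕ.* suc m
  n′ = a ℕ.* suc n

private

  2^⌊log₂⌋≤n : ∀ n → 1 ≤ n → 2 ^ ⌊log₂ n ⌋ ≤ n
  2^⌊log₂⌋≤n = <-rec (λ n → 1 ≤ n → 2 ^ ⌊log₂ n ⌋ ≤ n) step
    where
    step : ∀ n → (∀ {m} → m < n → 1 ≤ m → 2 ^ ⌊log₂ m ⌋ ≤ m) → 1 ≤ n → 2 ^ ⌊log₂ n ⌋ ≤ n
    step 1 _ _ = s≤s z≤n
    step n@(suc (suc k)) ih _ = begin
      2 ^ ⌊log₂ n ⌋                 ≡⟨ cong (2 ^_) (sym (ℕ.m+[n∸m]≡n 1≤log)) ⟩
      2 ℕ.* 2 ^ (⌊log₂ n ⌋ ℕ.∸ 1)   ≡⟨ cong (λ l → 2 ℕ.* 2 ^ l) (⌊log₂⌊n/2⌋⌋≡⌊log₂n⌋∸1 n) ⟨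
      2 ℕ.* 2 ^ ⌊log₂ ⌊ n /2⌋ ⌋     ≤⟨ ℕ.*-monoʳ-≤ 2 (ih (ℕ.⌊n/2⌋<n (suc k)) (s≤s z≤n)) ⟩
      2 ℕ.* ⌊ n /2⌋                 ≡⟨ cong (⌊ n /2⌋ ℕ.+_) (ℕ.+-identityʳ ⌊ n /2⌋) ⟩
      ⌊ n /2⌋ ℕ.+ ⌊ n /2⌋           ≤⟨ ℕ.+-monoʳ-≤ ⌊ n /2⌋ (ℕ.⌊n/2⌋≤⌈n/2⌉ n) ⟩
      ⌊ n /2⌋ ℕ.+ ℕ.⌈ n /2⌉         ≡⟨ ℕ.⌊n/2⌋+⌈n/2⌉≡n n ⟩
      n                             ∎
      where
      open ℕ.≤-Reasoning
      1≤log : 1 ≤ ⌊log₂ n ⌋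
      1≤log = ⌊log₂⌋-mono-≤ {2} {n} (s≤s (s≤s z≤n))

  n<2^suc⌊log₂⌋ : ∀ n → n < 2 ^ suc ⌊log₂ n ⌋
  n<2^suc⌊log₂⌋ n with n ℕ.<? 2 ^ suc ⌊log₂ n ⌋
  ... | yes p = p
  ... | no ¬p = contradiction
    (subst (_≤ ⌊log₂ n ⌋) (⌊log₂[2^n]⌋≡n (suc ⌊log₂ n ⌋)) (⌊log₂⌋-mono-≤ (ℕ.≮⇒≥ ¬p)))
    ℕ.1+n≰n

  log-cross : ∀ n .{{_ : NonZero n}} j k →
    ⌊log₂ (n ^ suc j) ⌋ ℕ.* suc k ≤ suc ⌊log₂ (n ^ suc k) ⌋ ℕ.* suc j
  log-cross n j k with ⌊log₂ (n ^ suc j) ⌋ ℕ.* suc k ℕ.≤? suc ⌊log₂ (n ^ suc k) ⌋ ℕ.* suc j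
  ... | yes p = p
  ... | no ¬p = contradiction (begin-strict
      2 ^ (a ℕ.* suc k)         ≡⟨ ℕ.^-*-assoc 2 a (suc k) ⟨
      (2 ^ a) ^ suc k           ≤⟨ ℕ.^-monoˡ-≤ (suc k) (2^⌊log₂⌋≤n _ (ℕ.m^n>0 n (suc j))) ⟩
      (n ^ suc j) ^ suc k       ≡⟨ ℕ.^-*-assoc n (suc j) (suc k) ⟩
      n ^ (suc j ℕ.* suc k)     ≡⟨ cong (n ^_) (ℕ.*-comm (suc j) (suc k)) ⟩
      n ^ (suc k ℕ.* suc j)     ≡⟨ ℕ.^-*-assoc n (suc k) (suc j) ⟨
      (n ^ suc k) ^ suc j       <⟨ ℕ.^-monoˡ-< (suc j) (n<2^suc⌊log₂⌋ (n ^ suc k)) ⟩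
      (2 ^ suc b) ^ suc j       ≡⟨ ℕ.^-*-assoc 2 (suc b) (suc j) ⟩
      2 ^ (suc b ℕ.* suc j)     ≤⟨ ℕ.^-monoʳ-≤ 2 (ℕ.≰⇒≥ ¬p) ⟩
      2 ^ (a ℕ.* suc k)         ∎)
      (ℕ.n≮n _)
    where
    open ℕ.≤-Reasoning
    a = ⌊log₂ (n ^ suc j) ⌋
    b = ⌊log₂ (n ^ suc k) ⌋

-- ⌊log₂ (nᵏ)⌋ / k is within 1/k of log₂ n.

log₂ : (n : ℕ) .{{_ : NonZero n}} → ℝ
log₂ n .seq k = + ⌊log₂ (n ^ suc k) ⌋ ℚ./ suc k
log₂ n .regular j k = begin
  + a ℚ./ suc j                                     ≤⟨ /-mono-≤ a j (suc b) k (log-cross n j k) ⟩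
  + suc b ℚ./ suc k                                 ≡⟨ cong (λ x → + x ℚ./ suc k) (ℕ.+-comm 1 b) ⟩
  + (b ℕ.+ 1) ℚ./ suc k                             ≡⟨ /-+ b 1 k ⟨
  + b ℚ./ suc k ℚ.+ 1/suc k                         ≡⟨ cong (+ b ℚ./ suc k ℚ.+_) (ℚ.+-identityˡ (1/suc k)) ⟨
  + b ℚ./ suc k ℚ.+ (0ℚ ℚ.+ 1/suc k)                ≤⟨ ℚ.+-monoʳ-≤ (+ b ℚ./ suc k)
                                                        (ℚ.+-monoˡ-≤ (1/suc k) (/-mono-≤ 0 0 1 j z≤n)) ⟩
  + b ℚ./ suc k ℚ.+ (1/suc j ℚ.+ 1/suc k)           ∎
  where
  open ℚ.≤-Reasoning
  a = ⌊log₂ (n ^ suc j) ⌋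
  b = ⌊log₂ (n ^ suc k) ⌋

------------------------------------------------------------------------
-- Asymptotics

IsLittleO[n] : (ℕ → ℚ) → Set
IsLittleO[n] r = ∀ ε → 0ℚ ℚ.< ε →
  ∃[ N ] ∀ n → N ≤ n → ∣ r n ∣ ℚ.≤ ε ℚ.* fromℕ n

-- f n ≤ n log n + c n + o(n). A real remainder can be rounded up to a
-- rational one at the cost of a bounded error, so r is rational-valued.

AtMost-nlog[n]+_n+o[n] : ℝ → (ℕ → ℚ) → Set
AtMost-nlog[n]+ c n+o[n] f = ∃[ r ] IsLittleO[n] r ×
  (∀ n .{{_ : NonZero n}} → toℝ (f n) ≤ᵣ n · log₂ n +ᵣ n · c +ᵣ toℝ (r n))

-- √n ≤ a · k n and k n ≤ b · √n for large n, squared.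

IsΘ[√n] : (ℕ → ℕ) → Set
IsΘ[√n] k = ∃[ a ] ∃[ b ] ∃[ N ] ∀ n → N ≤ n →
  (n ≤ (a ℕ.* k n) ^ 2) × (k n ^ 2 ≤ b ^ 2 ℕ.* n)

------------------------------------------------------------------------
-- Comparison-based algorithms

-- Randomised decision trees over elements E with result R: `compare x y`
-- branches on whether x is smaller than y, `random` on a uniformly
-- distributed element of Fin (suc k).

data Algorithm (E R : Set) : Set where
  return  : R → Algorithm E R
  compare : E → E → (Bool → Algorithm E R) → Algorithm E R
  random  : ∀ {k} → (Fin (suc k) → Algorithm E R) → Algorithm E R

infixl 1 _>>=_

_>>=_ : ∀ {E R S} → Algorithm E R → (R → Algorithm E S) → Algorithm E S
return x      >>= f = f x
compare x y t >>= f = compare x y λ b → t b >>= f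
random t      >>= f = random λ i → t i >>= f

on : ∀ {E F R} → (E → F) → Algorithm E R → Algorithm F R
on f (return x)      = return x
on f (compare x y t) = compare (f x) (f y) λ b → on f (t b)
on f (random t)      = random λ i → on f (t i)

-- An input order of n distinct elements, named by their positions
-- i : Fin n in the array, is a permutation σ: element i has rank σ i.

smaller? : ∀ {n} → Permutation′ n → Fin n → Fin n → Bool
smaller? σ i j = does (σ ⟨$⟩ʳ i <? σ ⟨$⟩ʳ j)

-- P holds of the result, whatever the outcomes of the random choices.

Surely : ∀ {n R} → Permutation′ n → (R → Set) → Algorithm (Fin n) R → Set
Surely σ P (return x)      = P x
Surely σ P (compare i j t) = Surely σ P (t (smaller? σ i j))
Surely σ P (random t)      = ∀ i → Surely σ P (t i)

expectedComparisons : ∀ {n R} → Permutation′ n → Algorithm (Fin n) R → ℚ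
expectedComparisons σ (return _)       = 0ℚ
expectedComparisons σ (compare i j t)  = 1ℚ ℚ.+ expectedComparisons σ (t (smaller? σ i j))
expectedComparisons σ (random {k} t)   = sum (λ i → expectedComparisons σ (t i)) ℚ.* 1/suc k

-- Every permutation of Fin (suc n) is, up to pointwise equality,
-- `insert zero j π` for exactly one j and one π.

sumOverPermutations : ∀ n → (Permutation′ n → ℚ) → ℚ
sumOverPermutations zero    f = f idₚ
sumOverPermutations (suc n) f =
  sum λ j → sumOverPermutations n λ π → f (insert zero j π)

averageComparisons : ∀ {n R} → Algorithm (Fin n) R → ℚ
averageComparisons {n} A =
  sumOverPermutations n (λ σ → expectedComparisons σ A) ℚ.* (1ℤ ℚ./ n !) {{n ℕ.!≢0}}

-- One tree for every array length; the result lists the positions of the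
-- input array in the order in which their elements are output.

SortingProcedure : Set
SortingProcedure = ∀ n → Algorithm (Fin n) (List (Fin n))

IsSortingAlgorithm : SortingProcedure → Set
IsSortingAlgorithm A = ∀ n (σ : Permutation′ n) →
  Surely σ (λ out → out ↭ allFin n × Linked (λ i j → σ ⟨$⟩ʳ i Data.Fin.< σ ⟨$⟩ʳ j) out) (A n)

------------------------------------------------------------------------
-- QuickXsort

SelectionProcedure : Set
SelectionProcedure = ∀ k .{{_ : NonZero k}} → Algorithm (Fin k) (Fin k)

-- For even k, the lower of the two middle elements.

SelectsMedian : SelectionProcedure → Set
SelectsMedian A = ∀ k .{{_ : NonZero k}} (σ : Permutation′ k) →
  Surely σ (λ i → toℕ (σ ⟨$⟩ʳ i) ≡ ⌊ pred k /2⌋) (A k)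

-- o(k²) comparisons on average, so that selecting from a sample of Θ(√n)
-- elements takes o(n). Linear-time selection and sorting the sample with
-- O(k log k) comparisons both qualify.

IsSubquadratic : SelectionProcedure → Set
IsSubquadratic A = ∀ ε → 0ℚ ℚ.< ε →
  ∃[ K ] ∀ k .{{_ : NonZero k}} → K ≤ k → averageComparisons (A k) ℚ.≤ ε ℚ.* fromℕ (k ^ 2)

-- What is known of an array of length suc m after partitioning it: which
-- positions were sampled, where the pivot was, and which of the m other
-- elements (position i of them being `punchIn pivot i` of the array) are
-- smaller than the pivot.

record Partitioned (m : ℕ) : Set where
  field
    sample  : List (Fin (suc m))
    pivot   : Fin (suc m)
    smaller : Subset m

  positions : Subset m → List (Fin (suc m))
  positions p = map (punchIn pivot) (filter (_∈? p) (allFin m))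

  left right : List (Fin (suc m))
  left  = positions smaller
  right = positions (∁ smaller)

  length-positions : ∀ p → length (positions p) < suc m
  length-positions p = s≤s (begin
    length (positions p)                ≡⟨ length-map (punchIn pivot) (filter (_∈? p) (allFin m)) ⟩
    length (filter (_∈? p) (allFin m))  ≤⟨ length-filter (_∈? p) (allFin m) ⟩
    length (allFin m)                   ≡⟨ length-tabulate {n = m} (λ i → i) ⟩
    m                                   ∎)
    where open ℕ.≤-Reasoning

open Partitioned public

-- The choices left open by the description of QuickXsort. Partitioning, and
-- the use of one part as temporary storage for X, may move elements around:
-- `arrange` is the order in which the part to be sorted by X is handed to X,
-- and `arrangeRest` the order in which the other part, of length r, stands
-- after partitioning and after the run of X, whose output is the list
-- argument. Determining the pivot moves no elements, so neither depends on
-- the comparisons made within the sample.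

record Implementation : Set where
  field
    sampleSize   : ℕ → ℕ
    sampleSize≢0 : ∀ n → .{{NonZero n}} → NonZero (sampleSize n)
    sampleSize≤n : ∀ n → sampleSize n ≤ n
    select       : SelectionProcedure
    XSortsLeft   : ∀ {m} → Partitioned m → Bool
    arrange      : ∀ {m} → Partitioned m → ∀ l → Permutation′ l
    arrangeRest  : ∀ {m} → Partitioned m → ∀ {l} → List (Fin l) → ∀ r → Permutation′ r

-- k draws without replacement.

draw : ∀ {E A : Set} {k n} → k ≤ n → Vec A n → Algorithm E (Vec A k)
draw z≤n       xs = return []
draw (s≤s k≤n) xs = random λ i →
  draw k≤n (Vec.removeAt xs i) >>= λ ys → return (Vec.lookup xs i ∷ ys)

compareAllWith : ∀ {E n} → E → Vec E n → Algorithm E (Vec Bool n)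
compareAllWith p []       = return []
compareAllWith p (x ∷ xs) = compare x p λ b →
  compareAllWith p xs >>= λ bs → return (b ∷ bs)

module _ (X : SortingProcedure) (I : Implementation) where

  open Implementation I

  quickXsort-acc : ∀ n → Acc _<_ n → Algorithm (Fin n) (List (Fin n))
  quickXsort-acc zero    _        = return []
  quickXsort-acc (suc m) (acc rs) = do
    s ← draw (sampleSize≤n (suc m)) (Vec.allFin (suc m))
    j ← on (Vec.lookup s) (select (sampleSize (suc m)) {{sampleSize≢0 (suc m)}})
    let p = Vec.lookup s j
    bs ← compareAllWith p (Vec.tabulate (punchIn p))
    let v = record { sample = Vec.toList s ; pivot = p ; smaller = bs }
    if XSortsLeft v
      then (do
        ys , zs ← sortParts v (left v) (right v) (length-positions v (∁ bs))
        return (ys ++ p ∷ zs))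
      else (do
        ys , zs ← sortParts v (right v) (left v) (length-positions v bs)
        return (zs ++ p ∷ ys))
    where
    sortParts : Partitioned m → (xs ws : List (Fin (suc m))) → length ws < suc m →
                Algorithm (Fin (suc m)) (List (Fin (suc m)) × List (Fin (suc m)))
    sortParts v xs ws ws< = do
      let f = lookup xs ∘ (arrange v (length xs) ⟨$⟩ʳ_)
      ys ← on f (X (length xs))
      let g = lookup ws ∘ (arrangeRest v ys (length ws) ⟨$⟩ʳ_)
      zs ← on g (quickXsort-acc (length ws) (rs ws<))
      return (map f ys , map g zs)

  quickXsort : SortingProcedure
  quickXsort n = quickXsort-acc n (<-wellFounded n)

{-# OPTIONS --safe #-}

-- For a fixed sample, the positions of the pivot and of the smaller elements
-- leave the order patterns of the two parts uniformly and independently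
-- distributed, so with n = 1 + l + r the expected cost is
--   T(n) = select + (n − 1) + 𝔼 [ X(l) + T(r) ].
-- Write X(l) ≤ l log l + c l + o(l). If both parts have length about n/2, then
-- l log l + r log r ≤ n log n − n + o(n), which cancels the n − 1 comparisons of
-- partitioning; in any case l log l + r log r ≤ n log n. By Chebyshev's inequality
-- the median of a sample of k elements is far from rank n/2 only with probability
-- O(1/k), so uneven splits contribute o(n). Hence
-- E(n) = T(n) − n log n − c n satisfies E(n) ≤ o(n) + 𝔼 E(r) with r ≤ 2n/3 almost
-- always, and E(n) = o(n) by induction.

module Submission where

open import Defs
open import Algebra.Bundles using (CommutativeRing)
open import Data.Bool using (Bool; true; false; if_then_else_; not)
open import Data.Bool.Properties using () renaming (_≟_ to _≟ᵇ_)
open import Data.Fin as Fin using (Fin; zero; suc; toℕ; punchIn; punchOut)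
open import Data.Fin.Permutation as Perm using (Permutation′; _⟨$⟩ʳ_; _⟨$⟩ˡ_; insert; remove; _≈_; _∘ₚ_; flip)
import Data.Fin.Permutation.Components as PC
import Data.Fin.Properties as Fin
open import Data.Fin.Subset using (Subset; ∁; _∈_; _∉_)
import Data.Fin.Subset.Properties as Subset
open import Data.Integer using (1ℤ)
import Data.Integer as ℤ
import Data.Integer.Properties as ℤ
open import Data.List as List using (List; []; _∷_; length; filter; _++_)
import Data.List.Membership.Propositional as List
import Data.List.Membership.Propositional.Properties as List
open import Data.List.Membership.Propositional.Properties.WithK using (unique∧set⇒bag)
import Data.List.Properties as List
open import Data.List.Relation.Binary.BagAndSetEquality using (∼bag⇒↭)
open import Data.List.Relation.Binary.Permutation.Propositional using (_↭_; ↭-refl; ↭-sym; ↭-trans)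
import Data.List.Relation.Binary.Permutation.Propositional.Properties as ↭
open import Data.List.Relation.Unary.All as All using (All; _∷_)
open import Data.List.Relation.Unary.AllPairs using (AllPairs; _∷_)
import Data.List.Relation.Unary.AllPairs.Properties as AllPairs
open import Data.List.Relation.Unary.Any using (here; there; index)
open import Data.List.Relation.Unary.Any.Properties using (lookup-index)
open import Data.List.Relation.Unary.Linked as Linked using (Linked; [])
import Data.List.Relation.Unary.Linked.Properties as Linked
open import Data.List.Relation.Unary.Unique.Propositional using (Unique)
import Data.List.Relation.Unary.Unique.Propositional.Properties as Unique
open import Data.Nat as ℕ using (ℕ; zero; suc; NonZero; _!; z≤n; s≤s)
open import Data.Nat.DivMod using (_/_; m/n*n≤m; m≡m%n+[m/n]*n; m%n<n; m<n*o⇒m/o<n)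
open import Data.Nat.Induction using (<-rec; <-wellFounded)
open import Data.Nat.Logarithm using (⌊log₂_⌋; ⌊log₂⌋-mono-≤; ⌊log₂[2^n]⌋≡n; ⌊log₂⌊n/2⌋⌋≡⌊log₂n⌋∸1)
import Data.Nat.Properties as ℕ
import Data.Nat.Solver
open import Data.Product using (∃-syntax; Σ-syntax; _×_; _,_; proj₁; proj₂)
open import Data.Rational as ℚ using (ℚ; 0ℚ; 1ℚ; _+_; _*_; _-_; -_; _≤_; _<_; ∣_∣)
import Data.Rational.Properties as ℚ
open import Data.Rational.Solver using (module +-*-Solver)
import Data.Rational.Unnormalised as ℚᵘ
import Data.Rational.Unnormalised.Properties as ℚᵘ
open import Data.Sum using (_⊎_; inj₁; inj₂)
open import Data.Unit using (tt)
open import Data.Vec as Vec using (Vec; []; _∷_)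
import Data.Vec.Properties as Vec
open import Function using (_∘_; id; mk⇔)
open import Induction.WellFounded using (Acc; acc)
open import Relation.Binary.PropositionalEquality
  using (_≡_; _≢_; refl; sym; trans; cong; cong₂; subst; subst₂; module ≡-Reasoning)
open import Relation.Nullary using (Dec; does; yes; no; ¬_; contradiction)
open import Relation.Nullary.Decidable using (dec-true; dec-false)

open import Algebra.Properties.Semiring.Sum (CommutativeRing.semiring ℚ.+-*-commutativeRing)
  using (sum; sum-cong-≗; sum-replicate-zero; sum-remove; sum-permute; ∑-distrib-+; *-distribˡ-sum; *-distribʳ-sum)

-- Linear arithmetic over ℚ: an inequality is derived from a combination of
-- known ones by a ring identity.

-- Two obstacles shape the proof. First, the pivot is found by comparisons inside the sample, which
-- could bias the parts. The remedy is to expand over the candidates `j`, weighted by the indicator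
-- that `j` is the median. Expressed as a count of sample elements below `s j`, this weight depends
-- only on comparisons with the pivot, so permuting positions inside one part changes neither it nor
-- the partition. Second, logarithms and `c` are real. Here n log n becomes the integer
-- `⌊nlog₂n⌋ n`, `c` becomes one rational approximation q, and o(n) becomes: for every M ≥ 18 and e
-- = 1/M, the cost is at most ⌊n log n⌋ + q n + 18 e n + D for some constant D. Inequalities between
-- logarithms turn into inequalities between powers of naturals. The 18 solves C = (2/3) C + 6: in
-- an even split the recursive part has length at most 2n/3 and returns (2/3) C e n; a further e n
-- is charged once for the entropy missing to a full bit per element, twice for X, and once each for
-- uneven splits, pivot selection and constants. D is inherited unchanged, since only one part is
-- sorted recursively.

≤-from : ∀ {x y a b} → x ≤ y → a + y ≡ b + x → a ≤ b
≤-from {x} {y} {a} {b} x≤y eq = begin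
  a              ≡⟨ solve 2 (λ a y → a := a :+ y :+ (:- y)) refl a y ⟩
  a + y + - y    ≡⟨ cong (_+ - y) eq ⟩
  b + x + - y    ≤⟨ ℚ.+-monoʳ-≤ (b + x) (ℚ.neg-antimono-≤ x≤y) ⟩
  b + x + - x    ≡⟨ solve 2 (λ b x → b :+ x :+ (:- x) := b) refl b x ⟩
  b              ∎
  where
  open ℚ.≤-Reasoning
  open +-*-Solver

*-mono-≤ : ∀ {a b} c → 0ℚ ≤ c → a ≤ b → c * a ≤ c * b
*-mono-≤ c 0≤c = ℚ.*-monoˡ-≤-nonNeg c {{ℚ.nonNegative 0≤c}}

*-nonNeg : ∀ {a b} → 0ℚ ≤ a → 0ℚ ≤ b → 0ℚ ≤ a * b
*-nonNeg {a} 0≤a 0≤b = subst (_≤ a * _) (ℚ.*-zeroʳ a) (*-mono-≤ a 0≤a 0≤b)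

+-nonNeg : ∀ {a b} → 0ℚ ≤ a → 0ℚ ≤ b → 0ℚ ≤ a + b
+-nonNeg = ℚ.+-mono-≤ {0ℚ} {_} {0ℚ}

0≤1 : 0ℚ ≤ 1ℚ
0≤1 = ℚ.nonNegative⁻¹ 1ℚ

square-nonNeg : ∀ a → 0ℚ ≤ a * a
square-nonNeg a with ℚ.≤-total 0ℚ a
... | inj₁ 0≤a = *-nonNeg 0≤a 0≤a
... | inj₂ a≤0 = subst (0ℚ ≤_) (solve 1 (λ a → (:- a) :* (:- a) := a :* a) refl a)
    (*-nonNeg (ℚ.neg-antimono-≤ a≤0) (ℚ.neg-antimono-≤ a≤0))
  where open +-*-Solver

-- Embedding of the naturals and the Archimedean property

fromℕ-≃ : ∀ n → ℚ.toℚᵘ (fromℕ n) ℚᵘ.≃ ℚᵘ.mkℚᵘ (ℤ.+ n) 0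
fromℕ-≃ n = ℚ.toℚᵘ-fromℚᵘ (ℚᵘ.mkℚᵘ (ℤ.+ n) 0)

fromℕ-+ : ∀ m n → fromℕ (m ℕ.+ n) ≡ fromℕ m + fromℕ n
fromℕ-+ m n = ℚ.toℚᵘ-injective
  (ℚᵘ.≃-trans (fromℕ-≃ (m ℕ.+ n))
  (ℚᵘ.≃-trans (ℚᵘ.*≡* (cong (ℤ._* 1ℤ) (trans (ℤ.pos-+ m n)
    (sym (cong₂ ℤ._+_ (ℤ.*-identityʳ (ℤ.+ m)) (ℤ.*-identityʳ (ℤ.+ n)))))))
  (ℚᵘ.≃-sym (ℚᵘ.≃-trans (ℚ.toℚᵘ-homo-+ (fromℕ m) (fromℕ n)) (ℚᵘ.+-cong (fromℕ-≃ m) (fromℕ-≃ n))))))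

fromℕ-* : ∀ m n → fromℕ (m ℕ.* n) ≡ fromℕ m * fromℕ n
fromℕ-* m n = ℚ.toℚᵘ-injective
  (ℚᵘ.≃-trans (fromℕ-≃ (m ℕ.* n))
  (ℚᵘ.≃-trans (ℚᵘ.*≡* (cong (ℤ._* 1ℤ) (ℤ.pos-* m n)))
  (ℚᵘ.≃-sym (ℚᵘ.≃-trans (ℚ.toℚᵘ-homo-* (fromℕ m) (fromℕ n)) (ℚᵘ.*-cong (fromℕ-≃ m) (fromℕ-≃ n))))))

fromℕ-mono-≤ : ∀ {m n} → m ℕ.≤ n → fromℕ m ≤ fromℕ n
fromℕ-mono-≤ {m} {n} m≤n = ℚ.toℚᵘ-cancel-≤
  (ℚᵘ.≤-trans (ℚᵘ.≤-reflexive (fromℕ-≃ m))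
  (ℚᵘ.≤-trans (ℚᵘ.*≤* (ℤ.*-monoʳ-≤-nonNeg 1ℤ (ℤ.+≤+ m≤n)))
              (ℚᵘ.≤-reflexive (ℚᵘ.≃-sym (fromℕ-≃ n)))))

0≤fromℕ : ∀ n → 0ℚ ≤ fromℕ n
0≤fromℕ n = fromℕ-mono-≤ (z≤n {n})

/-*-cancel : ∀ i n .{{_ : NonZero n}} → fromℕ n * (i ℚ./ n) ≡ i ℚ./ 1
/-*-cancel i n@(suc k) = ℚ.toℚᵘ-injective
  (ℚᵘ.≃-trans (ℚ.toℚᵘ-homo-* (fromℕ n) (i ℚ./ n))
  (ℚᵘ.≃-trans (ℚᵘ.*-cong (fromℕ-≃ n) (ℚ.toℚᵘ-fromℚᵘ (ℚᵘ.mkℚᵘ i k)))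
  (ℚᵘ.≃-trans (ℚᵘ.*≡* (trans (ℤ.*-identityʳ (ℤ.+ n ℤ.* i))
     (trans (ℤ.*-comm (ℤ.+ n) i) (cong (i ℤ.*_) (sym (ℤ.*-identityˡ (ℤ.+ n)))))))
  (ℚᵘ.≃-sym (ℚ.toℚᵘ-fromℚᵘ (ℚᵘ.mkℚᵘ i 0))))))

suc*1/suc : ∀ n → fromℕ (suc n) * 1/suc n ≡ 1ℚ
suc*1/suc n = /-*-cancel 1ℤ (suc n)

0≤1/suc : ∀ n → 0ℚ ≤ 1/suc n
0≤1/suc n = ℚ.nonNegative⁻¹ (1/suc n) {{ℚ.normalize-nonNeg 1 (suc n)}}

0<1/suc : ∀ n → 0ℚ < 1/suc n
0<1/suc n = ℚ.positive⁻¹ (1/suc n) {{ℚ.normalize-pos 1 (suc n)}}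

-- `q` is 1/p, given by its defining equation so that no division occurs.
/-below : ∀ {ε p q} → 0ℚ ≤ q → 1ℚ ≤ ε * p → q * p ≡ 1ℚ → q ≤ ε
/-below {ε} {p} {q} 0≤q 1≤εp qp≡1 = begin
  q             ≡⟨ ℚ.*-identityʳ q ⟨
  q * 1ℚ        ≤⟨ *-mono-≤ q 0≤q 1≤εp ⟩
  q * (ε * p)   ≡⟨ solve 3 (λ q ε p → q :* (ε :* p) := ε :* (q :* p)) refl q ε p ⟩
  ε * (q * p)   ≡⟨ cong (ε *_) qp≡1 ⟩
  ε * 1ℚ        ≡⟨ ℚ.*-identityʳ ε ⟩
  ε             ∎
  where
  open ℚ.≤-Reasoning
  open +-*-Solver

i≤∣i∣ : ∀ i → i ℤ.≤ ℤ.+ ℤ.∣ i ∣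
i≤∣i∣ (ℤ.+ n)      = ℤ.≤-refl
i≤∣i∣ ℤ.-[1+ n ] = ℤ.-≤+

archimedean : ∀ q → ∃[ N ] q ≤ fromℕ N
archimedean q = N , ℚ.toℚᵘ-cancel-≤ (ℚᵘ.≤-trans (ℚᵘ.*≤* le) (ℚᵘ.≤-reflexive (ℚᵘ.≃-sym (fromℕ-≃ N))))
  where
  qᵘ = ℚ.toℚᵘ q
  -- The denominator is at least 1, so the absolute value of the numerator already bounds `q`.
  N = ℤ.∣ ℚᵘ.↥ qᵘ ∣
  le : ℚᵘ.↥ qᵘ ℤ.* 1ℤ ℤ.≤ ℤ.+ N ℤ.* ℚᵘ.↧ qᵘ
  le = ℤ.≤-trans (ℤ.≤-reflexive (ℤ.*-identityʳ _)) (ℤ.≤-trans (i≤∣i∣ (ℚᵘ.↥ qᵘ))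
    (subst (ℤ.+ N ℤ.≤_) (ℤ.pos-* N (ℚᵘ.↧ₙ qᵘ)) (ℤ.+≤+ (ℕ.m≤m*n N (ℚᵘ.↧ₙ qᵘ)))))

archimedean-ε : ∀ ε → 0ℚ < ε → ∀ q → ∃[ N ] ∀ n → N ℕ.≤ n → q ≤ ε * fromℕ n
archimedean-ε ε 0<ε q = N , λ n N≤n → begin
  q                    ≡⟨ ℚ.*-identityˡ q ⟨
  1ℚ * q               ≡⟨ cong (_* q) (sym (ℚ.*-inverseʳ ε)) ⟩
  (ε * 1/ε) * q        ≡⟨ ℚ.*-assoc ε 1/ε q ⟩
  ε * (1/ε * q)        ≤⟨ *-mono-≤ ε (ℚ.<⇒≤ 0<ε) (ℚ.≤-trans le (fromℕ-mono-≤ N≤n)) ⟩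
  ε * fromℕ n          ∎
  where
  open ℚ.≤-Reasoning
  instance
    pos : ℚ.Positive ε
    pos = ℚ.positive 0<ε
    nz : ℚ.NonZero ε
    nz = ℚ.pos⇒nonZero ε
  1/ε = ℚ.1/ ε
  N = proj₁ (archimedean (1/ε * q))
  le = proj₂ (archimedean (1/ε * q))

eventually-small : ∀ ε → 0ℚ < ε → ∃[ N ] ∀ n → N ℕ.≤ n → 1/suc n ≤ ε
eventually-small ε 0<ε = proj₁ bound , λ n N≤n →
  /-below {ε} {fromℕ (suc n)} {1/suc n} (0≤1/suc n) (proj₂ bound (suc n) (ℕ.m≤n⇒m≤1+n N≤n))
    (trans (ℚ.*-comm (1/suc n) (fromℕ (suc n))) (suc*1/suc n))
  where bound = archimedean-ε ε 0<ε 1ℚ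

-- Indicators

ind : ∀ {P : Set} → Dec P → ℚ
ind d = if does d then 1ℚ else 0ℚ

ind-yes : ∀ {P : Set} (d : Dec P) → P → ind d ≡ 1ℚ
ind-yes d p rewrite dec-true d p = refl

ind-no : ∀ {P : Set} (d : Dec P) → ¬ P → ind d ≡ 0ℚ
ind-no d ¬p rewrite dec-false d ¬p = refl

ind-cong : ∀ {P Q : Set} (d : Dec P) (e : Dec Q) → (P → Q) → (Q → P) → ind d ≡ ind e
ind-cong (yes p) e f g = sym (ind-yes e (f p))
ind-cong (no ¬p) e f g = sym (ind-no e (¬p ∘ g))

0≤ind : ∀ {P : Set} (d : Dec P) → 0ℚ ≤ ind d
0≤ind (yes _) = 0≤1
0≤ind (no _)  = ℚ.≤-refl

ind-*-cong : ∀ {P : Set} (d : Dec P) {a b : ℚ} → (P → a ≡ b) → ind d * a ≡ ind d * b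
ind-*-cong (yes p) h = cong (1ℚ *_) (h p)
ind-*-cong (no _) {a} {b} h = trans (ℚ.*-zeroˡ a) (sym (ℚ.*-zeroˡ b))

ind-× : ∀ {P Q R : Set} (d : Dec R) (e : Dec P) (f : Dec Q) →
  (R → P × Q) → (P → Q → R) → ind d ≡ ind e * ind f
ind-× d (yes p) f g h = trans (ind-cong d f (proj₂ ∘ g) (h p)) (sym (ℚ.*-identityˡ (ind f)))
ind-× d (no ¬p) f g h = trans (ind-no d (¬p ∘ proj₁ ∘ g)) (sym (ℚ.*-zeroˡ (ind f)))

sum-mono-≤ : ∀ {n} {f g : Fin n → ℚ} → (∀ i → f i ≤ g i) → sum f ≤ sum g
sum-mono-≤ {zero}  h = ℚ.≤-refl
sum-mono-≤ {suc n} h = ℚ.+-mono-≤ (h zero) (sum-mono-≤ (h ∘ suc))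

sum-const : ∀ n c → sum {n} (λ _ → c) ≡ fromℕ n * c
sum-const zero    c = sym (ℚ.*-zeroˡ c)
sum-const (suc n) c = begin
  c + sum {n} (λ _ → c)         ≡⟨ cong (_+_ c) (sum-const n c) ⟩
  c + fromℕ n * c               ≡⟨ solve 2 (λ c n → c :+ n :* c := (con 1ℚ :+ n) :* c) refl c (fromℕ n) ⟩
  (1ℚ + fromℕ n) * c            ≡⟨ cong (_* c) (fromℕ-+ 1 n) ⟨
  fromℕ (suc n) * c             ∎
  where
  open ≡-Reasoning
  open +-*-Solver

sum-ind-≟ : ∀ {n} (k : Fin n) (f : Fin n → ℚ) → sum (λ i → ind (i Fin.≟ k) * f i) ≡ f k
sum-ind-≟ {suc n} zero f = begin
  1ℚ * f zero + sum (λ i → 0ℚ * f (suc i))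
    ≡⟨ cong₂ _+_ (ℚ.*-identityˡ (f zero)) (sum-cong-≗ (λ i → ℚ.*-zeroˡ (f (suc i)))) ⟩
  f zero + sum {n} (λ _ → 0ℚ)   ≡⟨ cong (_+_ (f zero)) (sum-replicate-zero n) ⟩
  f zero + 0ℚ                   ≡⟨ ℚ.+-identityʳ (f zero) ⟩
  f zero                        ∎
  where open ≡-Reasoning
sum-ind-≟ {suc n} (suc k) f = begin
  0ℚ * f zero + sum (λ i → ind (suc i Fin.≟ suc k) * f (suc i))
    ≡⟨ cong₂ _+_ (ℚ.*-zeroˡ (f zero))
       (sum-cong-≗ (λ i → cong (_* f (suc i)) (ind-cong (suc i Fin.≟ suc k) (i Fin.≟ k) Fin.suc-injective (cong suc)))) ⟩
  0ℚ + sum (λ i → ind (i Fin.≟ k) * f (suc i))   ≡⟨ ℚ.+-identityˡ _ ⟩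
  sum (λ i → ind (i Fin.≟ k) * f (suc i))        ≡⟨ sum-ind-≟ k (f ∘ suc) ⟩
  f (suc k)                                      ∎
  where open ≡-Reasoning

-- Means

-- A common interface for three averages: over a finite uniform choice, over all permutations, and
-- over the random choices of an algorithm. Linearity and monotonicity suffice to exchange any two
-- of them.
record IsMean {A : Set} (𝔼 : (A → ℚ) → ℚ) : Set where
  field
    +-homo : ∀ f g → 𝔼 (λ a → f a + g a) ≡ 𝔼 f + 𝔼 g
    *-homo : ∀ c f → 𝔼 (λ a → c * f a) ≡ c * 𝔼 f
    mono   : ∀ {f g} → (∀ a → f a ≤ g a) → 𝔼 f ≤ 𝔼 g
    unit   : 𝔼 (λ _ → 1ℚ) ≡ 1ℚ

  -- Monotonicity in both directions takes the place of function extensionality.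
  congᴱ : ∀ {f g} → (∀ a → f a ≡ g a) → 𝔼 f ≡ 𝔼 g
  congᴱ h = ℚ.≤-antisym (mono (ℚ.≤-reflexive ∘ h)) (mono (ℚ.≤-reflexive ∘ sym ∘ h))

  const : ∀ c → 𝔼 (λ _ → c) ≡ c
  const c = begin
    𝔼 (λ _ → c)        ≡⟨ congᴱ (λ _ → sym (ℚ.*-identityʳ c)) ⟩
    𝔼 (λ _ → c * 1ℚ)   ≡⟨ *-homo c (λ _ → 1ℚ) ⟩
    c * 𝔼 (λ _ → 1ℚ)   ≡⟨ cong (c *_) unit ⟩
    c * 1ℚ             ≡⟨ ℚ.*-identityʳ c ⟩
    c                  ∎
    where open ≡-Reasoning

  *-homoʳ : ∀ c f → 𝔼 (λ a → f a * c) ≡ 𝔼 f * c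
  *-homoʳ c f = trans (congᴱ (λ a → ℚ.*-comm (f a) c)) (trans (*-homo c f) (ℚ.*-comm c (𝔼 f)))

  bounded : ∀ {f c} → (∀ a → f a ≤ c) → 𝔼 f ≤ c
  bounded {f} {c} h = ℚ.≤-trans (mono h) (ℚ.≤-reflexive (const c))

  sum-homo : ∀ {n} (f : Fin n → A → ℚ) → 𝔼 (λ a → sum (λ i → f i a)) ≡ sum (λ i → 𝔼 (f i))
  sum-homo {zero}  f = const 0ℚ
  sum-homo {suc n} f = trans (+-homo (f zero) (λ a → sum (λ i → f (suc i) a)))
                             (cong (_+_ (𝔼 (f zero))) (sum-homo (f ∘ suc)))

mean : ∀ {k} → (Fin (suc k) → ℚ) → ℚ
mean {k} f = sum f * 1/suc k

mean-isMean : ∀ {k} → IsMean (mean {k})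
mean-isMean {k} = record
  { +-homo = λ f g → trans (cong (_* 1/suc k) (∑-distrib-+ f g)) (ℚ.*-distribʳ-+ (1/suc k) (sum f) (sum g))
  ; *-homo = λ c f → trans (cong (_* 1/suc k) (sym (*-distribˡ-sum c f))) (ℚ.*-assoc c (sum f) (1/suc k))
  ; mono   = λ h → ℚ.*-monoʳ-≤-nonNeg (1/suc k) {{ℚ.normalize-nonNeg 1 (suc k)}} (sum-mono-≤ h)
  ; unit   = trans (cong (_* 1/suc k) (trans (sum-const (suc k) 1ℚ) (ℚ.*-identityʳ (fromℕ (suc k))))) (suc*1/suc k)
  }

-- Normalised at each insertion instead of once by n!, so that it is an iterated `mean` and inherits
-- its properties by recursion.
meanₚ : ∀ n → (Permutation′ n → ℚ) → ℚ
meanₚ zero    f = f Perm.id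
meanₚ (suc n) f = mean λ j → meanₚ n λ π → f (insert zero j π)

meanₚ-isMean : ∀ n → IsMean (meanₚ n)
meanₚ-isMean zero = record
  { +-homo = λ f g → refl ; *-homo = λ c f → refl ; mono = λ h → h Perm.id ; unit = refl }
meanₚ-isMean (suc n) = record
  { +-homo = λ f g → trans (M.congᴱ (λ j → N.+-homo (F f j) (F g j))) (M.+-homo (meanₚ n ∘ F f) (meanₚ n ∘ F g))
  ; *-homo = λ c f → trans (M.congᴱ (λ j → N.*-homo c (F f j))) (M.*-homo c (meanₚ n ∘ F f))
  ; mono   = λ h → M.mono (λ j → N.mono (λ π → h (insert zero j π)))
  ; unit   = trans (M.congᴱ (λ j → N.unit)) M.unit
  }
  where
  module M = IsMean (mean-isMean {n})
  module N = IsMean (meanₚ-isMean n)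
  F : (Permutation′ (suc n) → ℚ) → Fin (suc n) → Permutation′ n → ℚ
  F f j π = f (insert zero j π)

mean-swap : ∀ {A : Set} {𝔼 : (A → ℚ) → ℚ} → IsMean 𝔼 → ∀ {k} (F : A → Fin (suc k) → ℚ) →
  𝔼 (λ a → mean (F a)) ≡ mean (λ i → 𝔼 (λ a → F a i))
mean-swap E {k} F = trans (*-homoʳ (1/suc k) (sum ∘ F)) (cong (_* 1/suc k) (sum-homo (λ i a → F a i)))
  where open IsMean E

-- A finite Fubini theorem, by recursion along the insertions that build a permutation.
meanₚ-swap : ∀ {A : Set} {𝔼 : (A → ℚ) → ℚ} → IsMean 𝔼 → ∀ n (F : A → Permutation′ n → ℚ) →
  𝔼 (λ a → meanₚ n (F a)) ≡ meanₚ n (λ σ → 𝔼 (λ a → F a σ))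
meanₚ-swap E zero    F = refl
meanₚ-swap E (suc n) F = trans (mean-swap E (λ a j → meanₚ n (λ π → F a (insert zero j π))))
  (IsMean.congᴱ mean-isMean (λ j → meanₚ-swap E n (λ a π → F a (insert zero j π))))

sumOverPermutations≡ : ∀ n (f : Permutation′ n → ℚ) →
  sumOverPermutations n f ≡ fromℕ (n !) * meanₚ n f
sumOverPermutations≡ zero    f = sym (ℚ.*-identityˡ (f Perm.id))
sumOverPermutations≡ (suc n) f = begin
  sum (λ j → sumOverPermutations n (F j))               ≡⟨ sum-cong-≗ (λ j → sumOverPermutations≡ n (F j)) ⟩
  sum (λ j → fromℕ (n !) * meanₚ n (F j))               ≡⟨ *-distribˡ-sum (fromℕ (n !)) (λ j → meanₚ n (F j)) ⟨
  fromℕ (n !) * S                                       ≡⟨ ℚ.*-identityˡ _ ⟨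
  1ℚ * (fromℕ (n !) * S)                                ≡⟨ cong (_* (fromℕ (n !) * S)) (suc*1/suc n) ⟨
  fromℕ (suc n) * 1/suc n * (fromℕ (n !) * S)
    ≡⟨ solve 4 (λ a b c d → a :* b :* (c :* d) := a :* c :* (d :* b)) refl (fromℕ (suc n)) (1/suc n) (fromℕ (n !)) S ⟩
  fromℕ (suc n) * fromℕ (n !) * (S * 1/suc n)           ≡⟨ cong (_* (S * 1/suc n)) (fromℕ-* (suc n) (n !)) ⟨
  fromℕ (suc n !) * (S * 1/suc n)                       ∎
  where
  open ≡-Reasoning
  open +-*-Solver
  F : Fin (suc n) → Permutation′ n → ℚ
  F j π = f (insert zero j π)
  S = sum (λ j → meanₚ n (F j))

averageComparisons≡ : ∀ {n R} (A : Algorithm (Fin n) R) →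
  averageComparisons A ≡ meanₚ n (λ σ → expectedComparisons σ A)
averageComparisons≡ {n} A = begin
  sumOverPermutations n f * 1/n!          ≡⟨ cong (_* 1/n!) (sumOverPermutations≡ n f) ⟩
  fromℕ (n !) * meanₚ n f * 1/n!
    ≡⟨ solve 3 (λ a b c → a :* b :* c := b :* (a :* c)) refl (fromℕ (n !)) (meanₚ n f) 1/n! ⟩
  meanₚ n f * (fromℕ (n !) * 1/n!)        ≡⟨ cong (meanₚ n f *_) (/-*-cancel 1ℤ (n !)) ⟩
  meanₚ n f * 1ℚ                          ≡⟨ ℚ.*-identityʳ _ ⟩
  meanₚ n f                               ∎
  where
  open ≡-Reasoning
  open +-*-Solver
  instance
    nz : NonZero (n !)
    nz = n ℕ.!≢0
  1/n! = 1ℤ ℚ./ (n !)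
  f : Permutation′ n → ℚ
  f σ = expectedComparisons σ A

-- Invariance of the mean over permutations

infix 4 _≈?_

_≈?_ : ∀ {n} (σ ρ : Permutation′ n) → Dec (σ ≈ ρ)
σ ≈? ρ = Fin.all? (λ i → (σ ⟨$⟩ʳ i) Fin.≟ (ρ ⟨$⟩ʳ i))

-- The probability of a single permutation, built by the recursion of `meanₚ` so that the two unfold
-- together.
1/! : ℕ → ℚ
1/! zero    = 1ℚ
1/! (suc n) = 1/! n * 1/suc n

0<1/! : ∀ n → 0ℚ < 1/! n
0<1/! zero    = ℚ.positive⁻¹ 1ℚ
0<1/! (suc n) = ℚ.positive⁻¹ _ {{ℚ.pos*pos⇒pos (1/! n) {{ℚ.positive (0<1/! n)}} (1/suc n) {{ℚ.normalize-pos 1 (suc n)}}}}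

⟨$⟩ʳ-injective : ∀ {n} (σ : Permutation′ n) {i j} → σ ⟨$⟩ʳ i ≡ σ ⟨$⟩ʳ j → i ≡ j
⟨$⟩ʳ-injective σ e = trans (sym (Perm.inverseˡ σ)) (trans (cong (σ ⟨$⟩ˡ_) e) (Perm.inverseˡ σ))

insert-≈⇒ : ∀ {n} j (π : Permutation′ n) ρ → insert zero j π ≈ ρ → j ≡ ρ ⟨$⟩ʳ zero × π ≈ remove zero ρ
insert-≈⇒ j π ρ h = h zero , λ i → Fin.punchIn-injective j (π ⟨$⟩ʳ i) (remove zero ρ ⟨$⟩ʳ i) (begin
  punchIn j (π ⟨$⟩ʳ i)                            ≡⟨ Perm.insert-punchIn zero j π i ⟨
  insert zero j π ⟨$⟩ʳ suc i                      ≡⟨ h (suc i) ⟩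
  ρ ⟨$⟩ʳ suc i                                    ≡⟨ Perm.punchIn-permute ρ zero i ⟩
  punchIn (ρ ⟨$⟩ʳ zero) (remove zero ρ ⟨$⟩ʳ i)    ≡⟨ cong (λ k → punchIn k (remove zero ρ ⟨$⟩ʳ i)) (h zero) ⟨
  punchIn j (remove zero ρ ⟨$⟩ʳ i)                ∎)
  where open ≡-Reasoning

insert-≈⇐ : ∀ {n} j (π : Permutation′ n) ρ → j ≡ ρ ⟨$⟩ʳ zero → π ≈ remove zero ρ → insert zero j π ≈ ρ
insert-≈⇐ j π ρ refl h zero    = refl
insert-≈⇐ j π ρ refl h (suc i) = begin
  insert zero j π ⟨$⟩ʳ suc i                      ≡⟨ Perm.insert-punchIn zero j π i ⟩
  punchIn j (π ⟨$⟩ʳ i)                            ≡⟨ cong (punchIn j) (h i) ⟩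
  punchIn j (remove zero ρ ⟨$⟩ʳ i)                ≡⟨ Perm.punchIn-permute ρ zero i ⟨
  ρ ⟨$⟩ʳ suc i                                    ∎
  where open ≡-Reasoning

-- Exactly one choice of `j`, namely the image of `zero` under `ρ`, and one class of `π`, that of
-- `remove zero ρ`, rebuild `ρ`. The indicator therefore factors, and each insertion contributes one
-- factor 1/(n+1).
meanₚ-ind-≈ : ∀ n (ρ : Permutation′ n) → meanₚ n (λ σ → ind (σ ≈? ρ)) ≡ 1/! n
meanₚ-ind-≈ zero    ρ = refl
meanₚ-ind-≈ (suc n) ρ = begin
  mean (λ j → meanₚ n (λ π → ind (insert zero j π ≈? ρ)))
    ≡⟨ M.congᴱ (λ j → N.congᴱ (λ π → split j π)) ⟩
  mean (λ j → meanₚ n (λ π → ind (j Fin.≟ j₀) * ind (π ≈? remove zero ρ)))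
    ≡⟨ M.congᴱ (λ j → trans (N.*-homo (ind (j Fin.≟ j₀)) _) (cong (ind (j Fin.≟ j₀) *_) (meanₚ-ind-≈ n (remove zero ρ)))) ⟩
  mean (λ j → ind (j Fin.≟ j₀) * 1/! n)
    ≡⟨ cong (_* 1/suc n) (sum-ind-≟ j₀ (λ _ → 1/! n)) ⟩
  1/! n * 1/suc n  ∎
  where
  open ≡-Reasoning
  module M = IsMean (mean-isMean {n})
  module N = IsMean (meanₚ-isMean n)
  j₀ = ρ ⟨$⟩ʳ zero
  split : ∀ j π → ind (insert zero j π ≈? ρ) ≡ ind (j Fin.≟ j₀) * ind (π ≈? remove zero ρ)
  split j π = ind-× (insert zero j π ≈? ρ) (j Fin.≟ j₀) (π ≈? remove zero ρ)
    (insert-≈⇒ j π ρ) (insert-≈⇐ j π ρ)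

-- A permutation carries its inverse and proofs, so pointwise equal permutations need not be
-- propositionally equal. Invariance of the mean is available only for functions that respect `≈`.
Extensional : ∀ {n} → (Permutation′ n → ℚ) → Set
Extensional f = ∀ σ ρ → σ ≈ ρ → f σ ≡ f ρ

-- Both sides are computed as the double mean of [σ ≈ Φ ρ] f σ.

meanₚ-bijection : ∀ {n} (Φ Ψ : Permutation′ n → Permutation′ n) →
  (∀ σ ρ → σ ≈ Φ ρ → ρ ≈ Ψ σ) → (∀ σ ρ → ρ ≈ Ψ σ → σ ≈ Φ ρ) →
  (f : Permutation′ n → ℚ) → Extensional f → meanₚ n (f ∘ Φ) ≡ meanₚ n f
meanₚ-bijection {n} Φ Ψ ΦΨ ΨΦ f ext = cancel (begin
  1/! n * meanₚ n (f ∘ Φ)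
    ≡⟨ *-homo (1/! n) (f ∘ Φ) ⟨
  meanₚ n (λ ρ → 1/! n * f (Φ ρ))
    ≡⟨ congᴱ (λ ρ → cong (_* f (Φ ρ)) (meanₚ-ind-≈ n (Φ ρ))) ⟨
  meanₚ n (λ ρ → meanₚ n (λ σ → ind (σ ≈? Φ ρ)) * f (Φ ρ))
    ≡⟨ congᴱ (λ ρ → *-homoʳ (f (Φ ρ)) _) ⟨
  meanₚ n (λ ρ → meanₚ n (λ σ → ind (σ ≈? Φ ρ) * f (Φ ρ)))
    ≡⟨ congᴱ (λ ρ → congᴱ (λ σ → trans
         (ind-*-cong (σ ≈? Φ ρ) (λ e → sym (ext σ (Φ ρ) e)))
         (cong (_* f σ) (ind-cong (σ ≈? Φ ρ) (ρ ≈? Ψ σ) (ΦΨ σ ρ) (ΨΦ σ ρ))))) ⟩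
  meanₚ n (λ ρ → meanₚ n (λ σ → ind (ρ ≈? Ψ σ) * f σ))
    ≡⟨ meanₚ-swap (meanₚ-isMean n) n (λ ρ σ → ind (ρ ≈? Ψ σ) * f σ) ⟩
  meanₚ n (λ σ → meanₚ n (λ ρ → ind (ρ ≈? Ψ σ) * f σ))
    ≡⟨ congᴱ (λ σ → trans (*-homoʳ (f σ) _) (cong (_* f σ) (meanₚ-ind-≈ n (Ψ σ)))) ⟩
  meanₚ n (λ σ → 1/! n * f σ)
    ≡⟨ *-homo (1/! n) f ⟩
  1/! n * meanₚ n f  ∎)
  where
  open ≡-Reasoning
  open IsMean (meanₚ-isMean n)
  cancel : ∀ {a b} → 1/! n * a ≡ 1/! n * b → a ≡ b
  cancel eq = ℚ.≤-antisym (le eq) (le (sym eq))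
    where
    le : ∀ {a b} → 1/! n * a ≡ 1/! n * b → a ≤ b
    le e = ℚ.*-cancelˡ-≤-pos (1/! n) {{ℚ.positive (0<1/! n)}} (ℚ.≤-reflexive e)

meanₚ-∘ˡ : ∀ {n} (τ : Permutation′ n) f → Extensional f → meanₚ n (λ σ → f (τ ∘ₚ σ)) ≡ meanₚ n f
meanₚ-∘ˡ τ = meanₚ-bijection (τ ∘ₚ_) (flip τ ∘ₚ_)
  (λ σ ρ h i → sym (trans (h (τ ⟨$⟩ˡ i)) (cong (ρ ⟨$⟩ʳ_) (Perm.inverseʳ τ))))
  (λ σ ρ h i → sym (trans (h (τ ⟨$⟩ʳ i)) (cong (σ ⟨$⟩ʳ_) (Perm.inverseˡ τ))))

meanₚ-∘ʳ : ∀ {n} (τ : Permutation′ n) f → Extensional f → meanₚ n (λ σ → f (σ ∘ₚ τ)) ≡ meanₚ n f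
meanₚ-∘ʳ τ = meanₚ-bijection (_∘ₚ τ) (_∘ₚ flip τ)
  (λ σ ρ h i → sym (trans (cong (τ ⟨$⟩ˡ_) (h i)) (Perm.inverseˡ τ)))
  (λ σ ρ h i → sym (trans (cong (τ ⟨$⟩ʳ_) (h i)) (Perm.inverseʳ τ)))

-- Running algorithms under an abstract comparison

Comparison : Set → Set
Comparison E = E → E → Bool

infixl 8 _⟪_⟫

-- Running an algorithm on a part of the array through `on f` amounts to this precomposition. A
-- permutation describing the part is constructed only when its order pattern is averaged or a
-- sorting or selection guarantee is invoked.
_⟪_⟫ : ∀ {E F : Set} → Comparison F → (E → F) → Comparison E
(lt ⟪ f ⟫) x y = lt (f x) (f y)

infix 4 _≐_

_≐_ : ∀ {E : Set} → Comparison E → Comparison E → Set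
lt ≐ lt′ = ∀ x y → lt x y ≡ lt′ x y

outcome : ∀ {E R : Set} → Comparison E → Algorithm E R → (R → ℚ) → ℚ
outcome lt (return r)      φ = φ r
outcome lt (compare x y t) φ = outcome lt (t (lt x y)) φ
outcome lt (random t)      φ = mean λ i → outcome lt (t i) φ

cost : ∀ {E R : Set} → Comparison E → Algorithm E R → ℚ
cost lt (return r)      = 0ℚ
cost lt (compare x y t) = 1ℚ + cost lt (t (lt x y))
cost lt (random t)      = mean λ i → cost lt (t i)

Always : ∀ {E R : Set} → Comparison E → (R → Set) → Algorithm E R → Set
Always lt P (return r)      = P r
Always lt P (compare x y t) = Always lt P (t (lt x y))
Always lt P (random t)      = ∀ i → Always lt P (t i)

mean-cong : ∀ {k} {f g : Fin (suc k) → ℚ} → (∀ i → f i ≡ g i) → mean f ≡ mean g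
mean-cong {k} h = cong (_* 1/suc k) (sum-cong-≗ h)

-- Allows the average over the random choices of X to be exchanged with the average over the order
-- pattern of the other part.
outcome-isMean : ∀ {E R : Set} (lt : Comparison E) (A : Algorithm E R) → IsMean (outcome lt A)
outcome-isMean lt (return r) = record
  { +-homo = λ f g → refl ; *-homo = λ c f → refl ; mono = λ h → h r ; unit = refl }
outcome-isMean lt (compare x y t) = outcome-isMean lt (t (lt x y))
outcome-isMean lt (random {k} t) = record
  { +-homo = λ f g → trans (mean-cong (λ i → T.+-homo i f g)) (M.+-homo (F f) (F g))
  ; *-homo = λ c f → trans (mean-cong (λ i → T.*-homo i c f)) (M.*-homo c (F f))
  ; mono   = λ h → M.mono (λ i → T.mono i h)
  ; unit   = trans (mean-cong (λ i → T.unit i)) M.unit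
  }
  where
  module M = IsMean (mean-isMean {k})
  module T (i : Fin (suc k)) = IsMean (outcome-isMean lt (t i))
  F : (_ → ℚ) → Fin (suc k) → ℚ
  F f i = outcome lt (t i) f

expectedComparisons≡cost : ∀ {n R} (σ : Permutation′ n) (A : Algorithm (Fin n) R) →
  expectedComparisons σ A ≡ cost (smaller? σ) A
expectedComparisons≡cost σ (return r)      = refl
expectedComparisons≡cost σ (compare x y t) = cong (_+_ 1ℚ) (expectedComparisons≡cost σ (t (smaller? σ x y)))
expectedComparisons≡cost σ (random t)      = mean-cong (λ i → expectedComparisons≡cost σ (t i))

Surely⇒Always : ∀ {n R} (σ : Permutation′ n) {P : R → Set} (A : Algorithm (Fin n) R) →
  Surely σ P A → Always (smaller? σ) P A
Surely⇒Always σ (return r)      h = h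
Surely⇒Always σ (compare x y t) h = Surely⇒Always σ (t (smaller? σ x y)) h
Surely⇒Always σ (random t)      h i = Surely⇒Always σ (t i) (h i)

Always⇒Surely : ∀ {n R} (σ : Permutation′ n) {P : R → Set} (A : Algorithm (Fin n) R) →
  Always (smaller? σ) P A → Surely σ P A
Always⇒Surely σ (return r)      h = h
Always⇒Surely σ (compare x y t) h = Always⇒Surely σ (t (smaller? σ x y)) h
Always⇒Surely σ (random t)      h i = Always⇒Surely σ (t i) (h i)

cost->>= : ∀ {E R S : Set} (lt : Comparison E) (A : Algorithm E R) (f : R → Algorithm E S) →
  cost lt (A >>= f) ≡ cost lt A + outcome lt A (λ r → cost lt (f r))
cost->>= lt (return r)      f = sym (ℚ.+-identityˡ (cost lt (f r)))
cost->>= lt (compare x y t) f = trans (cong (_+_ 1ℚ) (cost->>= lt (t (lt x y)) f))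
  (sym (ℚ.+-assoc 1ℚ (cost lt (t (lt x y))) _))
cost->>= lt (random {k} t)  f = trans (mean-cong (λ i → cost->>= lt (t i) f))
  (IsMean.+-homo (mean-isMean {k}) (λ i → cost lt (t i)) (λ i → outcome lt (t i) (λ r → cost lt (f r))))

outcome->>= : ∀ {E R S : Set} (lt : Comparison E) (A : Algorithm E R) (f : R → Algorithm E S) φ →
  outcome lt (A >>= f) φ ≡ outcome lt A (λ r → outcome lt (f r) φ)
outcome->>= lt (return r)      f φ = refl
outcome->>= lt (compare x y t) f φ = outcome->>= lt (t (lt x y)) f φ
outcome->>= lt (random t)      f φ = mean-cong (λ i → outcome->>= lt (t i) f φ)

Always->>= : ∀ {E R S : Set} (lt : Comparison E) {P : R → Set} {Q : S → Set}
  (A : Algorithm E R) (f : R → Algorithm E S) →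
  Always lt P A → (∀ r → P r → Always lt Q (f r)) → Always lt Q (A >>= f)
Always->>= lt (return r)      f h k = k r h
Always->>= lt (compare x y t) f h k = Always->>= lt (t (lt x y)) f h k
Always->>= lt (random t)      f h k = λ i → Always->>= lt (t i) f (h i) k

Always-map : ∀ {E R : Set} (lt : Comparison E) {P Q : R → Set} (A : Algorithm E R) →
  (∀ r → P r → Q r) → Always lt P A → Always lt Q A
Always-map lt (return r)      k h = k r h
Always-map lt (compare x y t) k h = Always-map lt (t (lt x y)) k h
Always-map lt (random t)      k h = λ i → Always-map lt (t i) k (h i)

cost-on : ∀ {E F R : Set} (lt : Comparison F) (f : E → F) (A : Algorithm E R) →
  cost lt (on f A) ≡ cost (lt ⟪ f ⟫) A
cost-on lt f (return r)      = refl
cost-on lt f (compare x y t) = cong (_+_ 1ℚ) (cost-on lt f (t (lt (f x) (f y))))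
cost-on lt f (random t)      = mean-cong (λ i → cost-on lt f (t i))

outcome-on : ∀ {E F R : Set} (lt : Comparison F) (f : E → F) (A : Algorithm E R) φ →
  outcome lt (on f A) φ ≡ outcome (lt ⟪ f ⟫) A φ
outcome-on lt f (return r)      φ = refl
outcome-on lt f (compare x y t) φ = outcome-on lt f (t (lt (f x) (f y))) φ
outcome-on lt f (random t)      φ = mean-cong (λ i → outcome-on lt f (t i) φ)

Always-on : ∀ {E F R : Set} (lt : Comparison F) {P : R → Set} (f : E → F) (A : Algorithm E R) →
  Always (lt ⟪ f ⟫) P A → Always lt P (on f A)
Always-on lt f (return r)      h = h
Always-on lt f (compare x y t) h = Always-on lt f (t (lt (f x) (f y))) h
Always-on lt f (random t)      h = λ i → Always-on lt f (t i) (h i)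

cost-cong : ∀ {E R : Set} {lt lt′ : Comparison E} → lt ≐ lt′ → (A : Algorithm E R) →
  cost lt A ≡ cost lt′ A
cost-cong h (return r) = refl
cost-cong {lt = lt} h (compare x y t) rewrite sym (h x y) = cong (_+_ 1ℚ) (cost-cong h (t (lt x y)))
cost-cong h (random t) = mean-cong (λ i → cost-cong h (t i))

outcome-cong : ∀ {E R : Set} {lt lt′ : Comparison E} → lt ≐ lt′ → (A : Algorithm E R) → ∀ φ →
  outcome lt A φ ≡ outcome lt′ A φ
outcome-cong h (return r) φ = refl
outcome-cong {lt = lt} h (compare x y t) φ rewrite sym (h x y) = outcome-cong h (t (lt x y)) φ
outcome-cong h (random t) φ = mean-cong (λ i → outcome-cong h (t i) φ)

Always-cong : ∀ {E R : Set} {lt lt′ : Comparison E} {P : R → Set} → lt ≐ lt′ → (A : Algorithm E R) →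
  Always lt P A → Always lt′ P A
Always-cong h (return r) a = a
Always-cong {lt = lt} h (compare x y t) a rewrite sym (h x y) = Always-cong h (t (lt x y)) a
Always-cong h (random t) a = λ i → Always-cong h (t i) (a i)

outcome-always : ∀ {E R : Set} (lt : Comparison E) {φ : R → ℚ} {c} (A : Algorithm E R) →
  Always lt (λ r → φ r ≡ c) A → outcome lt A φ ≡ c
outcome-always lt (return r)      h = h
outcome-always lt (compare x y t) h = outcome-always lt (t (lt x y)) h
outcome-always lt {c = c} (random {k} t) h =
  trans (mean-cong (λ i → outcome-always lt (t i) (h i))) (IsMean.const (mean-isMean {k}) c)

compareAllWith-cost : ∀ {E : Set} (lt : Comparison E) p {n} (xs : Vec E n) →
  cost lt (compareAllWith p xs) ≡ fromℕ n
compareAllWith-cost lt p []       = refl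
compareAllWith-cost lt p {suc n} (x ∷ xs) = begin
  1ℚ + cost lt (compareAllWith p xs >>= λ bs → return (lt x p ∷ bs))
    ≡⟨ cong (_+_ 1ℚ) (cost->>= lt (compareAllWith p xs) (λ bs → return (lt x p ∷ bs))) ⟩
  1ℚ + (cost lt (compareAllWith p xs) + outcome lt (compareAllWith p xs) (λ _ → 0ℚ))
    ≡⟨ cong₂ (λ a b → 1ℚ + (a + b)) (compareAllWith-cost lt p xs)
         (IsMean.const (outcome-isMean lt (compareAllWith p xs)) 0ℚ) ⟩
  1ℚ + (fromℕ n + 0ℚ)   ≡⟨ cong (_+_ 1ℚ) (ℚ.+-identityʳ (fromℕ n)) ⟩
  1ℚ + fromℕ n          ≡⟨ fromℕ-+ 1 n ⟨
  fromℕ (suc n)         ∎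
  where open ≡-Reasoning

compareAllWith-always : ∀ {E : Set} (lt : Comparison E) p {n} (xs : Vec E n) →
  Always lt (_≡ Vec.map (λ x → lt x p) xs) (compareAllWith p xs)
compareAllWith-always lt p []       = refl
compareAllWith-always lt p (x ∷ xs) = Always->>= lt (compareAllWith p xs) (λ bs → return (lt x p ∷ bs))
  (compareAllWith-always lt p xs) (λ bs → cong (lt x p ∷_))

compareAllWith-outcome : ∀ {E : Set} (lt : Comparison E) p {n} (xs : Vec E n) φ →
  outcome lt (compareAllWith p xs) φ ≡ φ (Vec.map (λ x → lt x p) xs)
compareAllWith-outcome lt p xs φ = outcome-always lt (compareAllWith p xs)
  (Always-map lt (compareAllWith p xs) (λ _ → cong φ) (compareAllWith-always lt p xs))

-- Average cost over the input orders

averageCost : ∀ {n R} → Algorithm (Fin n) R → ℚ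
averageCost {n} A = meanₚ n λ σ → cost (smaller? σ) A

averageComparisons≡averageCost : ∀ {n R} (A : Algorithm (Fin n) R) → averageComparisons A ≡ averageCost A
averageComparisons≡averageCost {n} A = trans (averageComparisons≡ A)
  (IsMean.congᴱ (meanₚ-isMean n) (λ σ → expectedComparisons≡cost σ A))

smaller?-cong : ∀ {n} {σ ρ : Permutation′ n} → σ ≈ ρ → smaller? σ ≐ smaller? ρ
smaller?-cong h x y = cong₂ (λ i j → does (i Fin.<? j)) (h x) (h y)

cost-extensional : ∀ {l n R} (f : Fin l → Fin n) (A : Algorithm (Fin l) R) →
  Extensional (λ σ → cost (smaller? σ ⟪ f ⟫) A)
cost-extensional f A σ ρ h = cost-cong (λ x y → smaller?-cong {σ = σ} {ρ} h (f x) (f y)) A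

-- Reading the input in a fixed order `τ` only permutes the set of input orders.
averageCost-rearranged : ∀ {n R} (τ : Permutation′ n) (A : Algorithm (Fin n) R) →
  meanₚ n (λ σ → cost (smaller? σ ⟪ τ ⟨$⟩ʳ_ ⟫) A) ≡ averageCost A
averageCost-rearranged τ A = meanₚ-∘ˡ τ (λ σ → cost (smaller? σ) A) (cost-extensional id A)

-- Order patterns

-- A downward closed set is an initial segment, and `j` is its length. In `orderPattern` it is the
-- rank at which a new element is inserted.
cut : ∀ {l} (D : Fin l → Bool) → (∀ x y → x Fin.< y → D y ≡ true → D x ≡ true) →
  Σ[ j ∈ Fin (suc l) ] ∀ x → does (toℕ x ℕ.<? toℕ j) ≡ D x
cut {zero}  D closed = zero , λ ()
cut {suc l} D closed with D zero in eq
... | false = zero , λ x → sym (below x)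
  where
  below : ∀ x → D x ≡ false
  below zero    = eq
  below (suc x) with D (suc x) in eqs
  ... | false = refl
  ... | true  = trans (sym (closed zero (suc x) (s≤s z≤n) eqs)) eq
... | true with j , h ← cut (D ∘ suc) (λ x y x<y → closed (suc x) (suc y) (s≤s x<y)) =
  suc j , λ { zero → sym eq ; (suc x) → trans (lift x j) (h x) }
  where
  lift : ∀ {l} (x : Fin l) (j : Fin (suc l)) → does (suc (toℕ x) ℕ.<? suc (toℕ j)) ≡ does (toℕ x ℕ.<? toℕ j)
  lift x j = refl

punchIn-below : ∀ {l} (j : Fin (suc l)) x → does (punchIn j x Fin.<? j) ≡ does (toℕ x ℕ.<? toℕ j)
punchIn-below zero    x       = refl
punchIn-below (suc j) zero    = refl
punchIn-below (suc j) (suc x) = punchIn-below j x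

punchIn-above : ∀ {l} (j : Fin (suc l)) x → does (j Fin.<? punchIn j x) ≡ Data.Bool.not (does (toℕ x ℕ.<? toℕ j))
punchIn-above zero    x       = refl
punchIn-above (suc j) zero    = refl
punchIn-above (suc j) (suc x) = punchIn-above j x

punchIn-<? : ∀ {l} (j : Fin (suc l)) x y → does (punchIn j x Fin.<? punchIn j y) ≡ does (x Fin.<? y)
punchIn-<? zero    x       y       = refl
punchIn-<? (suc j) zero    zero    = refl
punchIn-<? (suc j) zero    (suc y) = refl
punchIn-<? (suc j) (suc x) zero    = refl
punchIn-<? (suc j) (suc x) (suc y) = punchIn-<? j x y

<?-irrefl : ∀ {n} (x : Fin n) → does (x Fin.<? x) ≡ false
<?-irrefl x = dec-false (x Fin.<? x) (ℕ.<-irrefl refl)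

<?-asym : ∀ {n} {x y : Fin n} → x ≢ y → does (x Fin.<? y) ≡ Data.Bool.not (does (y Fin.<? x))
<?-asym {x = zero}  {zero}  x≢y = contradiction refl x≢y
<?-asym {x = zero}  {suc y} x≢y = refl
<?-asym {x = suc x} {zero}  x≢y = refl
<?-asym {x = suc x} {suc y} x≢y = <?-asym (x≢y ∘ cong suc)

does⇒ : ∀ {P : Set} (d : Dec P) → does d ≡ true → P
does⇒ (yes p) refl = p

<?⇒< : ∀ {n} (x y : Fin n) → does (x Fin.<? y) ≡ true → x Fin.< y
<?⇒< x y = does⇒ (x Fin.<? y)

<⇒<? : ∀ {n} (x y : Fin n) → x Fin.< y → does (x Fin.<? y) ≡ true
<⇒<? x y = dec-true (x Fin.<? y)

-- Insertion, as in the recursion for the mean over permutations: the tail has a pattern `ρ`, and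
-- the head receives as its rank the number of tail elements below it. Injectivity excludes ties.
orderPattern : ∀ {l n} (g : Fin l → Fin n) → (∀ {i j} → g i ≡ g j → i ≡ j) →
  Σ[ ρ ∈ Permutation′ l ] ∀ i j → smaller? ρ i j ≡ does (g i Fin.<? g j)
orderPattern {zero}  g inj = Perm.id , λ ()
orderPattern {suc l} g inj = insert zero j ρ , order
  where
  tail = orderPattern (g ∘ suc) (Fin.suc-injective ∘ inj)
  ρ = proj₁ tail
  D : Fin l → Bool
  -- The rank `x` is translated back to a tail position; the ranks of tail elements below the head
  -- form an initial segment.
  D x = does (g (suc (ρ ⟨$⟩ˡ x)) Fin.<? g zero)
  closed : ∀ x y → x Fin.< y → D y ≡ true → D x ≡ true
  closed x y x<y Dy = <⇒<? _ (g zero) (ℕ.<-trans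
    (<?⇒< (g (suc (ρ ⟨$⟩ˡ x))) (g (suc (ρ ⟨$⟩ˡ y))) (begin
      does (g (suc (ρ ⟨$⟩ˡ x)) Fin.<? g (suc (ρ ⟨$⟩ˡ y)))           ≡⟨ proj₂ tail (ρ ⟨$⟩ˡ x) (ρ ⟨$⟩ˡ y) ⟨
      does ((ρ ⟨$⟩ʳ (ρ ⟨$⟩ˡ x)) Fin.<? (ρ ⟨$⟩ʳ (ρ ⟨$⟩ˡ y)))
        ≡⟨ cong₂ (λ a b → does (a Fin.<? b)) (Perm.inverseʳ ρ) (Perm.inverseʳ ρ) ⟩
      does (x Fin.<? y)                                             ≡⟨ <⇒<? x y x<y ⟩
      true                                                          ∎))
    (<?⇒< (g (suc (ρ ⟨$⟩ˡ y))) (g zero) Dy))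
    where open ≡-Reasoning
  j = proj₁ (cut D closed)
  j-cut : ∀ i → does (toℕ (ρ ⟨$⟩ʳ i) ℕ.<? toℕ j) ≡ does (g (suc i) Fin.<? g zero)
  j-cut i = trans (proj₂ (cut D closed) (ρ ⟨$⟩ʳ i))
    (cong (λ k → does (g (suc k) Fin.<? g zero)) (Perm.inverseˡ ρ))
  order : ∀ a b → smaller? (insert zero j ρ) a b ≡ does (g a Fin.<? g b)
  order zero    zero    = trans (<?-irrefl j) (sym (<?-irrefl (g zero)))
  order (suc a) zero    = trans (cong (λ x → does (x Fin.<? j)) (Perm.insert-punchIn zero j ρ a))
    (trans (punchIn-below j (ρ ⟨$⟩ʳ a)) (j-cut a))
  order zero    (suc b) = trans (cong (λ x → does (j Fin.<? x)) (Perm.insert-punchIn zero j ρ b))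
    (trans (punchIn-above j (ρ ⟨$⟩ʳ b)) (trans (cong Data.Bool.not (j-cut b))
      (sym (<?-asym (λ e → Fin.0≢1+n (inj e))))))
  order (suc a) (suc b) = trans (cong₂ (λ x y → does (x Fin.<? y))
      (Perm.insert-punchIn zero j ρ a) (Perm.insert-punchIn zero j ρ b))
    (trans (punchIn-<? j (ρ ⟨$⟩ʳ a) (ρ ⟨$⟩ʳ b)) (proj₂ tail a b))

-- Permuting the image of an injection

extend : ∀ {l n} → (Fin l → Fin n) → (Fin l → Fin l) → Fin n → Fin n
extend f h x with Fin.any? (λ i → f i Fin.≟ x)
... | yes (i , _) = f (h i)
... | no _        = x

module _ {l n} (f : Fin l → Fin n) (f-inj : ∀ {i j} → f i ≡ f j → i ≡ j) where

  extend-image : ∀ h i → extend f h (f i) ≡ f (h i)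
  extend-image h i with Fin.any? (λ j → f j Fin.≟ f i)
  ... | yes (j , e) = cong (f ∘ h) (f-inj e)
  ... | no ¬e       = contradiction (i , refl) ¬e

  extend-outside : ∀ h x → (∀ i → f i ≢ x) → extend f h x ≡ x
  extend-outside h x x∉f with Fin.any? (λ j → f j Fin.≟ x)
  ... | yes (j , e) = contradiction e (x∉f j)
  ... | no _        = refl

  extend-∘ : ∀ h k → (∀ i → h (k i) ≡ i) → ∀ x → extend f h (extend f k x) ≡ x
  extend-∘ h k hk x with Fin.any? (λ j → f j Fin.≟ x)
  ... | yes (j , refl) = trans (extend-image h (k j)) (cong f (hk j))
  ... | no ¬e          = extend-outside h x (λ i e → ¬e (i , e))

  extendₚ : Permutation′ l → Permutation′ n
  extendₚ κ = Perm.permutation (extend f (κ ⟨$⟩ʳ_)) (extend f (κ ⟨$⟩ˡ_))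
    (extend-∘ (κ ⟨$⟩ʳ_) (κ ⟨$⟩ˡ_) (λ _ → Perm.inverseʳ κ))
    (extend-∘ (κ ⟨$⟩ˡ_) (κ ⟨$⟩ʳ_) (λ _ → Perm.inverseˡ κ))

  -- The order pattern of σ on the image of f is uniformly distributed, also
  -- conditionally on everything that permuting this image does not affect.

  meanₚ-pattern : (F : Permutation′ n → Comparison (Fin l) → ℚ) →
    (∀ c → Extensional (λ σ → F σ c)) →
    (∀ σ {c d} → c ≐ d → F σ c ≡ F σ d) →
    (∀ κ σ c → F (extendₚ κ ∘ₚ σ) c ≡ F σ c) →
    meanₚ n (λ σ → F σ (smaller? σ ⟪ f ⟫)) ≡ meanₚ n (λ σ → meanₚ l (λ κ → F σ (smaller? κ)))
  meanₚ-pattern F ext cmp-ext inv = begin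
    meanₚ n G
      -- An idle average over `κ` is introduced. Translating `σ` by `extendₚ κ` leaves `F` unchanged
      -- in its first argument and turns the pattern `ρ σ` into `κ ∘ₚ ρ σ`; for uniform `κ` the
      -- latter is again uniform.
      ≡⟨ L.const (meanₚ n G) ⟨
    meanₚ l (λ κ → meanₚ n G)
      ≡⟨ L.congᴱ (λ κ → meanₚ-∘ˡ (extendₚ κ) G G-ext) ⟨
    meanₚ l (λ κ → meanₚ n (λ σ → G (extendₚ κ ∘ₚ σ)))
      ≡⟨ L.congᴱ (λ κ → N.congᴱ (λ σ → permuted κ σ)) ⟩
    meanₚ l (λ κ → meanₚ n (λ σ → F σ (smaller? (κ ∘ₚ ρ σ))))
      ≡⟨ meanₚ-swap (meanₚ-isMean l) n (λ κ σ → F σ (smaller? (κ ∘ₚ ρ σ))) ⟩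
    meanₚ n (λ σ → meanₚ l (λ κ → F σ (smaller? (κ ∘ₚ ρ σ))))
      ≡⟨ N.congᴱ (λ σ → meanₚ-∘ʳ (ρ σ) (λ κ → F σ (smaller? κ))
           (λ κ κ′ e → cmp-ext σ (smaller?-cong {σ = κ} {κ′} e))) ⟩
    meanₚ n (λ σ → meanₚ l (λ κ → F σ (smaller? κ)))  ∎
    where
    open ≡-Reasoning
    module L = IsMean (meanₚ-isMean l)
    module N = IsMean (meanₚ-isMean n)
    G : Permutation′ n → ℚ
    G σ = F σ (smaller? σ ⟪ f ⟫)
    G-ext : Extensional G
    G-ext σ σ′ e = trans (ext (smaller? σ ⟪ f ⟫) σ σ′ e)
      (cmp-ext σ′ (λ x y → smaller?-cong {σ = σ} {σ′} e (f x) (f y)))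
    pat : ∀ σ → Σ[ ρ ∈ Permutation′ l ] ∀ i j → smaller? ρ i j ≡ smaller? σ (f i) (f j)
    pat σ = orderPattern (λ i → σ ⟨$⟩ʳ f i) (λ e → f-inj (⟨$⟩ʳ-injective σ e))
    ρ : Permutation′ n → Permutation′ l
    ρ σ = proj₁ (pat σ)
    permuted : ∀ κ σ → G (extendₚ κ ∘ₚ σ) ≡ F σ (smaller? (κ ∘ₚ ρ σ))
    permuted κ σ = trans (inv κ σ _) (cmp-ext σ (λ x y →
      trans (cong₂ (smaller? σ) (extend-image (κ ⟨$⟩ʳ_) x) (extend-image (κ ⟨$⟩ʳ_) y))
            (sym (proj₂ (pat σ) (κ ⟨$⟩ʳ x) (κ ⟨$⟩ʳ y)))))

ind-mono : ∀ {P Q : Set} (d : Dec P) (e : Dec Q) → (P → Q) → ind d ≤ ind e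
ind-mono (yes p) e f = ℚ.≤-reflexive (sym (ind-yes e (f p)))
ind-mono (no _)  e f = 0≤ind e

ind-disjoint : ∀ {P Q R : Set} (d : Dec P) (e : Dec Q) (f : Dec R) →
  (P → R) → (Q → R) → (P → ¬ Q) → ind d + ind e ≤ ind f
ind-disjoint (yes p) e f g h dis = ℚ.≤-reflexive
  (trans (cong (_+_ 1ℚ) (ind-no e (dis p))) (sym (ind-yes f (g p))))
ind-disjoint (no _)  e f g h dis = ℚ.≤-trans (ℚ.≤-reflexive (ℚ.+-identityˡ (ind e))) (ind-mono e f h)

-- Rank statistics

sum-ind-toℕ< : ∀ n t → t ℕ.≤ n → sum {n} (λ x → ind (toℕ x ℕ.<? t)) ≡ fromℕ t
sum-ind-toℕ< n       zero    _         = trans (sum-cong-≗ {n} {λ x → ind (toℕ x ℕ.<? 0)} {λ _ → 0ℚ}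
  (λ x → ind-no (toℕ x ℕ.<? 0) λ ())) (sum-replicate-zero n)
sum-ind-toℕ< (suc n) (suc t) (s≤s t≤n) = begin
  1ℚ + sum {n} (λ x → ind (suc (toℕ x) ℕ.<? suc t))
    ≡⟨ cong (_+_ 1ℚ) (sum-cong-≗ {n} (λ x → ind-cong (suc (toℕ x) ℕ.<? suc t) (toℕ x ℕ.<? t) ℕ.s<s⁻¹ s≤s)) ⟩
  1ℚ + sum {n} (λ x → ind (toℕ x ℕ.<? t))   ≡⟨ cong (_+_ 1ℚ) (sum-ind-toℕ< n t t≤n) ⟩
  1ℚ + fromℕ t                              ≡⟨ fromℕ-+ 1 t ⟨
  fromℕ (suc t)                             ∎
  where open ≡-Reasoning

sum-ind-rank : ∀ {n} (σ : Permutation′ n) y →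
  sum (λ x → ind ((σ ⟨$⟩ʳ x) Fin.<? (σ ⟨$⟩ʳ y))) ≡ fromℕ (toℕ (σ ⟨$⟩ʳ y))
sum-ind-rank {n} σ y = trans
  (sym (sum-permute (λ x → ind (toℕ x ℕ.<? toℕ (σ ⟨$⟩ʳ y))) σ))
  (sum-ind-toℕ< n (toℕ (σ ⟨$⟩ʳ y)) (ℕ.<⇒≤ (Fin.toℕ<n (σ ⟨$⟩ʳ y))))

-- Variance of a sample

transpose-first : ∀ {n} (i j : Fin n) → PC.transpose i j i ≡ j
transpose-first i j rewrite dec-true (i Fin.≟ i) refl = refl

transpose-other : ∀ {n} (i j k : Fin n) → k ≢ i → k ≢ j → PC.transpose i j k ≡ k
transpose-other i j k k≢i k≢j rewrite dec-false (k Fin.≟ i) k≢i | dec-false (k Fin.≟ j) k≢j = refl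

square : ℚ → ℚ
square x = x * x

sampleSum : ∀ {k n} → (Fin n → ℚ) → (Fin k → Fin n) → Permutation′ n → ℚ
sampleSum w s σ = sum λ i → w (σ ⟨$⟩ʳ s i)

square-sum : ∀ {k} (a : Fin k → ℚ) → square (sum a) ≡ sum (λ i → sum (λ j → a i * a j))
square-sum a = trans (*-distribʳ-sum (sum a) a) (sum-cong-≗ (λ i → *-distribˡ-sum (a i) a))

module _ {n} (w : Fin n → ℚ) (sum-w : sum w ≡ 0ℚ) where

  private
    open IsMean (meanₚ-isMean n)

    product : Fin n → Fin n → Permutation′ n → ℚ
    product x y σ = w (σ ⟨$⟩ʳ x) * w (σ ⟨$⟩ʳ y)

    product-extensional : ∀ x y → Extensional (product x y)
    product-extensional x y σ ρ e = cong₂ (λ a b → w a * w b) (e x) (e y)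

  -- The covariances of w (σ x) with the other w (σ z) are equal by symmetry,
  -- and together with the variance they add up to 0.

  covariance-nonPos : ∀ {x y} → x ≢ y → meanₚ n (product x y) ≤ 0ℚ
  covariance-nonPos {x} {y} x≢y = nonPos n refl
    where
    A = meanₚ n (product x x)
    B = meanₚ n (product x y)

    0≤A : 0ℚ ≤ A
    0≤A = subst (_≤ A) (const 0ℚ) (mono (λ σ → square-nonNeg (w (σ ⟨$⟩ʳ x))))

    same : ∀ z → x ≢ z → meanₚ n (product x z) ≡ B
    same z x≢z = trans (congᴱ (λ σ → cong₂ (λ a b → w (σ ⟨$⟩ʳ a) * w (σ ⟨$⟩ʳ b))
        (sym (transpose-other y z x x≢y x≢z)) (sym (transpose-first y z))))
      (meanₚ-∘ˡ (Perm.transpose y z) (product x y) (product-extensional x y))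

    split : ∀ z → meanₚ n (product x z) ≡ ind (z Fin.≟ x) * (A - B) + B
    split z with z Fin.≟ x
    ... | yes refl = solve 2 (λ a b → a := con 1ℚ :* (a :+ (:- b)) :+ b) refl A B
      where open +-*-Solver
    ... | no z≢x   = trans (same z (z≢x ∘ sym)) (solve 2 (λ a b → b := con 0ℚ :* (a :+ (:- b)) :+ b) refl A B)
      where open +-*-Solver

    total : sum (λ z → meanₚ n (product x z)) ≡ 0ℚ
    total = begin
      sum (λ z → meanₚ n (product x z))                          ≡⟨ sum-homo (λ z → product x z) ⟨
      meanₚ n (λ σ → sum (λ z → product x z σ))
        ≡⟨ congᴱ (λ σ → *-distribˡ-sum (w (σ ⟨$⟩ʳ x)) (λ z → w (σ ⟨$⟩ʳ z))) ⟨
      meanₚ n (λ σ → w (σ ⟨$⟩ʳ x) * sum (λ z → w (σ ⟨$⟩ʳ z)))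
        ≡⟨ congᴱ (λ σ → trans (cong (w (σ ⟨$⟩ʳ x) *_) (trans (sym (sum-permute w σ)) sum-w)) (ℚ.*-zeroʳ (w (σ ⟨$⟩ʳ x)))) ⟩
      meanₚ n (λ σ → 0ℚ)                                         ≡⟨ const 0ℚ ⟩
      0ℚ                                                         ∎
      where open ≡-Reasoning

    relation : A - B + fromℕ n * B ≡ 0ℚ
    relation = begin
      A - B + fromℕ n * B
        ≡⟨ cong₂ _+_ (sum-ind-≟ x (λ _ → A - B)) (sum-const n B) ⟨
      sum (λ z → ind (z Fin.≟ x) * (A - B)) + sum {n} (λ _ → B)
        ≡⟨ ∑-distrib-+ (λ z → ind (z Fin.≟ x) * (A - B)) (λ _ → B) ⟨
      sum (λ z → ind (z Fin.≟ x) * (A - B) + B)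
        ≡⟨ sum-cong-≗ {n} split ⟨
      sum (λ z → meanₚ n (product x z))
        ≡⟨ total ⟩
      0ℚ  ∎
      where open ≡-Reasoning

    -- The relation reads A + (n - 1) B = 0. Cancelling n - 1 requires n ≥ 2, and smaller n leave no
    -- room for `x ≢ y`.
    nonPos : ∀ m → n ≡ m → B ≤ 0ℚ
    nonPos 0 refl = contradiction x Fin.¬Fin0
    nonPos 1 refl = contradiction (one x y) x≢y
      where
      one : ∀ (a b : Fin 1) → a ≡ b
      one zero zero = refl
    nonPos (suc (suc m)) n≡ = ℚ.*-cancelˡ-≤-pos c {{ℚ.normalize-pos (suc m) 1}} (begin
      c * B                                   ≡⟨ solve 3 (λ a b c → c :* b := a :+ (:- b) :+ (con 1ℚ :+ c) :* b :+ (:- a)) refl A B c ⟩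
      A - B + (1ℚ + c) * B + - A              ≡⟨ cong (λ z → A - B + z * B + - A) (fromℕ-+ 1 (suc m)) ⟨
      A - B + fromℕ (suc (suc m)) * B + - A   ≡⟨ cong (λ z → A - B + fromℕ z * B + - A) n≡ ⟨
      A - B + fromℕ n * B + - A               ≡⟨ cong (_+ - A) relation ⟩
      0ℚ + - A                                ≡⟨ ℚ.+-identityˡ (- A) ⟩
      - A                                     ≤⟨ ℚ.neg-antimono-≤ 0≤A ⟩
      0ℚ                                      ≡⟨ ℚ.*-zeroʳ c ⟨
      c * 0ℚ                                  ∎)
      where
      open ℚ.≤-Reasoning
      open +-*-Solver
      c = fromℕ (suc m)

  -- In the expanded square the off-diagonal terms are covariances of a sample without replacement,
  -- hence at most 0. Only the k diagonal terms remain, each at most `c`.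
  variance-sampleSum : ∀ {k} (s : Fin k → Fin n) → (∀ {i j} → s i ≡ s j → i ≡ j) →
    ∀ {c} → (∀ x → square (w x) ≤ c) → meanₚ n (square ∘ sampleSum w s) ≤ fromℕ k * c
  variance-sampleSum {k} s s-inj {c} w²≤c = begin
    meanₚ n (square ∘ sampleSum w s)
      ≡⟨ congᴱ (λ σ → square-sum (λ i → w (σ ⟨$⟩ʳ s i))) ⟩
    meanₚ n (λ σ → sum (λ i → sum (λ j → product (s i) (s j) σ)))
      ≡⟨ sum-homo (λ i σ → sum (λ j → product (s i) (s j) σ)) ⟩
    sum (λ i → meanₚ n (λ σ → sum (λ j → product (s i) (s j) σ)))
      ≡⟨ sum-cong-≗ {k} (λ i → sum-homo (λ j → product (s i) (s j))) ⟩
    sum (λ i → sum (λ j → meanₚ n (product (s i) (s j))))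
      ≤⟨ sum-mono-≤ {k} (λ i → sum-mono-≤ {k} (λ j → entry i j)) ⟩
    sum {k} (λ i → sum {k} (λ j → ind (j Fin.≟ i) * c))
      ≡⟨ sum-cong-≗ {k} (λ i → sum-ind-≟ i (λ _ → c)) ⟩
    sum {k} (λ _ → c)
      ≡⟨ sum-const k c ⟩
    fromℕ k * c  ∎
    where
    open ℚ.≤-Reasoning
    entry : ∀ i j → meanₚ n (product (s i) (s j)) ≤ ind (j Fin.≟ i) * c
    entry i j with j Fin.≟ i
    ... | yes refl = ℚ.≤-trans (bounded (λ σ → w²≤c (σ ⟨$⟩ʳ s i))) (ℚ.≤-reflexive (sym (ℚ.*-identityˡ c)))
    ... | no j≢i   = ℚ.≤-trans (covariance-nonPos (λ e → j≢i (sym (s-inj e)))) (ℚ.≤-reflexive (sym (ℚ.*-zeroˡ c)))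

-- The rank of the median of a sample

-- The centred indicator of a rank below t, multiplied by n to avoid the fraction t/n.
belowWeight : ∀ n → ℕ → Fin n → ℚ
belowWeight n t x = fromℕ n * ind (toℕ x ℕ.<? t) - fromℕ t

sum-belowWeight : ∀ n t → t ℕ.≤ n → sum (belowWeight n t) ≡ 0ℚ
sum-belowWeight n t t≤n = begin
  sum {n} (λ x → fromℕ n * ind (toℕ x ℕ.<? t) + - fromℕ t)
    ≡⟨ ∑-distrib-+ {n} (λ x → fromℕ n * ind (toℕ x ℕ.<? t)) (λ _ → - fromℕ t) ⟩
  sum {n} (λ x → fromℕ n * ind (toℕ x ℕ.<? t)) + sum {n} (λ _ → - fromℕ t)
    ≡⟨ cong₂ _+_ (*-distribˡ-sum {n} (fromℕ n) (λ x → ind (toℕ x ℕ.<? t))) (sym (sum-const n (- fromℕ t))) ⟨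
  fromℕ n * sum {n} (λ x → ind (toℕ x ℕ.<? t)) + fromℕ n * - fromℕ t
    ≡⟨ cong (λ z → fromℕ n * z + fromℕ n * - fromℕ t) (sum-ind-toℕ< n t t≤n) ⟩
  fromℕ n * fromℕ t + fromℕ n * - fromℕ t
    ≡⟨ solve 2 (λ n t → n :* t :+ n :* (:- t) := con 0ℚ) refl (fromℕ n) (fromℕ t) ⟩
  0ℚ  ∎
  where
  open ≡-Reasoning
  open +-*-Solver

square-mono : ∀ {a b} → 0ℚ ≤ a → a ≤ b → square a ≤ square b
square-mono {a} {b} 0≤a a≤b = ℚ.≤-trans (*-mono-≤ a 0≤a a≤b)
  (subst₂ _≤_ (ℚ.*-comm b a) refl (*-mono-≤ b (ℚ.≤-trans 0≤a a≤b) a≤b))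

-- The value squared is a - b or -b, and both have absolute value at most a.
square-shifted-ind : ∀ {P : Set} (d : Dec P) {a b} → 0ℚ ≤ b → b ≤ a → square (a * ind d - b) ≤ square a
square-shifted-ind (yes _) {a} {b} 0≤b b≤a = subst (_≤ square a)
    (cong square (solve 2 (λ a b → a :+ (:- b) := a :* con 1ℚ :+ (:- b)) refl a b))
    (square-mono {a - b} {a}
      (≤-from {b} {a} b≤a (solve 2 (λ a b → con 0ℚ :+ a := a :+ (:- b) :+ b) refl a b))
      (≤-from {0ℚ} {b} 0≤b (solve 2 (λ a b → a :+ (:- b) :+ b := a :+ con 0ℚ) refl a b)))
  where open +-*-Solver
square-shifted-ind (no _) {a} {b} 0≤b b≤a = subst (_≤ square a)
    (solve 2 (λ a b → b :* b := (a :* con 0ℚ :+ (:- b)) :* (a :* con 0ℚ :+ (:- b))) refl a b)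
    (square-mono {b} {a} 0≤b b≤a)
  where open +-*-Solver

square-belowWeight : ∀ n t → t ℕ.≤ n → ∀ x → square (belowWeight n t x) ≤ square (fromℕ n)
square-belowWeight n t t≤n x = square-shifted-ind (toℕ x ℕ.<? t) (0≤fromℕ t) (fromℕ-mono-≤ t≤n)

-- As a count of sample elements below `s j`, the condition sees `σ` only through comparisons with
-- `s j`. This locality is what makes conditioning on the median harmless to the order inside the
-- parts.
IsMedian : ∀ {k n} → (Fin k → Fin n) → Permutation′ n → Fin k → Set
IsMedian {k} s σ j = sum (λ i → ind ((σ ⟨$⟩ʳ s i) Fin.<? (σ ⟨$⟩ʳ s j))) ≡ fromℕ ℕ.⌊ ℕ.pred k /2⌋

double-half≤ : ∀ n → 2 ℕ.* ℕ.⌊ n /2⌋ ℕ.≤ n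
double-half≤ n = begin
  2 ℕ.* ℕ.⌊ n /2⌋            ≡⟨ cong (ℕ.⌊ n /2⌋ ℕ.+_) (ℕ.+-identityʳ ℕ.⌊ n /2⌋) ⟩
  ℕ.⌊ n /2⌋ ℕ.+ ℕ.⌊ n /2⌋    ≤⟨ ℕ.+-monoʳ-≤ ℕ.⌊ n /2⌋ (ℕ.⌊n/2⌋≤⌈n/2⌉ n) ⟩
  ℕ.⌊ n /2⌋ ℕ.+ ℕ.⌈ n /2⌉    ≡⟨ ℕ.⌊n/2⌋+⌈n/2⌉≡n n ⟩
  n                          ∎
  where open ℕ.≤-Reasoning

≤double-half : ∀ n → suc n ℕ.≤ 2 ℕ.* suc ℕ.⌊ n /2⌋
≤double-half zero          = s≤s z≤n
≤double-half (suc zero)    = ℕ.≤-refl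
≤double-half (suc (suc n)) = ℕ.≤-trans (s≤s (s≤s (≤double-half n)))
  (ℕ.≤-reflexive (sym (ℕ.*-suc 2 (suc ℕ.⌊ n /2⌋))))

module _ {k n} (s : Fin (suc k) → Fin n) (σ : Permutation′ n) (j : Fin (suc k)) (median : IsMedian s σ j) where

  private
    rank : Fin (suc k) → ℕ
    rank i = toℕ (σ ⟨$⟩ʳ s i)
    K = fromℕ (suc k)
    h = ℕ.⌊ k /2⌋
    C : ℕ → ℚ
    C t = sum (λ i → ind (rank i ℕ.<? t))

    sampleSum≡ : ∀ t → sampleSum (belowWeight n t) s σ ≡ fromℕ n * C t - K * fromℕ t
    sampleSum≡ t = begin
      sum (λ i → fromℕ n * ind (rank i ℕ.<? t) + - fromℕ t)
        ≡⟨ ∑-distrib-+ (λ i → fromℕ n * ind (rank i ℕ.<? t)) (λ _ → - fromℕ t) ⟩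
      sum (λ i → fromℕ n * ind (rank i ℕ.<? t)) + sum {suc k} (λ _ → - fromℕ t)
        ≡⟨ cong₂ _+_ (sym (*-distribˡ-sum (fromℕ n) (λ i → ind (rank i ℕ.<? t)))) (sum-const (suc k) (- fromℕ t)) ⟩
      fromℕ n * C t + K * - fromℕ t
        ≡⟨ cong (_+_ (fromℕ n * C t)) (ℚ.neg-distribʳ-* K (fromℕ t)) ⟨
      fromℕ n * C t - K * fromℕ t  ∎
      where open ≡-Reasoning

  -- Every sample element of rank below t lies below the median, so there are at most `h` of them,
  -- which is at most half the sample.
  sampleSum-above : ∀ {t} → t ℕ.≤ rank j →
    fromℕ 2 * sampleSum (belowWeight n t) s σ ≤ K * (fromℕ n - fromℕ 2 * fromℕ t)
  sampleSum-above {t} t≤ = ≤-from {fromℕ n * (fromℕ 2 * C t)} {fromℕ n * K}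
    (*-mono-≤ (fromℕ n) (0≤fromℕ n) (begin
      fromℕ 2 * C t        ≤⟨ *-mono-≤ (fromℕ 2) (0≤fromℕ 2) (ℚ.≤-trans (sum-mono-≤ {suc k} below) (ℚ.≤-reflexive median)) ⟩
      fromℕ 2 * fromℕ h    ≡⟨ fromℕ-* 2 h ⟨
      fromℕ (2 ℕ.* h)      ≤⟨ fromℕ-mono-≤ (ℕ.≤-trans (double-half≤ k) (ℕ.n≤1+n k)) ⟩
      K                    ∎))
    (trans (cong (λ z → fromℕ 2 * z + fromℕ n * K) (sampleSum≡ t))
      (solve 5 (λ two n C K t → two :* (n :* C :+ (:- (K :* t))) :+ n :* K := K :* (n :+ (:- (two :* t))) :+ n :* (two :* C))
        refl (fromℕ 2) (fromℕ n) (C t) K (fromℕ t)))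
    where
    open ℚ.≤-Reasoning
    open +-*-Solver
    below : ∀ i → ind (rank i ℕ.<? t) ≤ ind ((σ ⟨$⟩ʳ s i) Fin.<? (σ ⟨$⟩ʳ s j))
    below i = ind-mono (rank i ℕ.<? t) ((σ ⟨$⟩ʳ s i) Fin.<? (σ ⟨$⟩ʳ s j)) (λ r<t → ℕ.<-≤-trans r<t t≤)

  -- The median itself is counted along with the `h` elements below it, and `h` + 1 is at least half
  -- the sample.
  sampleSum-below : ∀ {t} → rank j ℕ.< t →
    K * (fromℕ n - fromℕ 2 * fromℕ t) ≤ fromℕ 2 * sampleSum (belowWeight n t) s σ
  sampleSum-below {t} <t = ≤-from {fromℕ n * K} {fromℕ n * (fromℕ 2 * C t)}
    (*-mono-≤ (fromℕ n) (0≤fromℕ n) (begin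
      K                        ≤⟨ fromℕ-mono-≤ (≤double-half k) ⟩
      fromℕ (2 ℕ.* suc h)      ≡⟨ fromℕ-* 2 (suc h) ⟩
      fromℕ 2 * fromℕ (suc h)  ≤⟨ *-mono-≤ (fromℕ 2) (0≤fromℕ 2) half ⟩
      fromℕ 2 * C t            ∎))
    (trans (solve 5 (λ two n C K t → K :* (n :+ (:- (two :* t))) :+ n :* (two :* C) := two :* (n :* C :+ (:- (K :* t))) :+ n :* K)
        refl (fromℕ 2) (fromℕ n) (C t) K (fromℕ t))
      (cong (λ z → fromℕ 2 * z + fromℕ n * K) (sym (sampleSum≡ t))))
    where
    open ℚ.≤-Reasoning
    open +-*-Solver
    lt? : ∀ i → Dec ((σ ⟨$⟩ʳ s i) Fin.< (σ ⟨$⟩ʳ s j))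
    lt? i = (σ ⟨$⟩ʳ s i) Fin.<? (σ ⟨$⟩ʳ s j)
    below : ∀ i → ind (i Fin.≟ j) * 1ℚ + ind (lt? i) ≤ ind (rank i ℕ.<? t)
    below i = ℚ.≤-trans (ℚ.≤-reflexive (cong (_+ ind (lt? i)) (ℚ.*-identityʳ (ind (i Fin.≟ j)))))
      (ind-disjoint (i Fin.≟ j) (lt? i) (rank i ℕ.<? t)
        (λ { refl → <t }) (λ l → ℕ.<-trans l <t) (λ { refl → ℕ.<-irrefl refl }))
    half : fromℕ (suc h) ≤ C t
    half = begin
      fromℕ (suc h)                                          ≡⟨ fromℕ-+ 1 h ⟩
      1ℚ + fromℕ h                                           ≡⟨ cong₂ _+_ (sum-ind-≟ j (λ _ → 1ℚ)) median ⟨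
      sum (λ i → ind (i Fin.≟ j) * 1ℚ) + sum (ind ∘ lt?)     ≡⟨ ∑-distrib-+ (λ i → ind (i Fin.≟ j) * 1ℚ) (ind ∘ lt?) ⟨
      sum (λ i → ind (i Fin.≟ j) * 1ℚ + ind (lt? i))         ≤⟨ sum-mono-≤ {suc k} below ⟩
      C t                                                    ∎

-- If the pivot is unbalanced, one of the two sample sums is large, which
-- is unlikely by Chebyshev.

deviation : ∀ {k n} → (Fin k → Fin n) → ℕ → Permutation′ n → ℚ
deviation {n = n} s t σ = square (sampleSum (belowWeight n t) s σ) + square (sampleSum (belowWeight n (n ℕ.∸ t)) s σ)

0≤deviation : ∀ {k n} (s : Fin k → Fin n) t σ → 0ℚ ≤ deviation s t σ
0≤deviation {n = n} s t σ = +-nonNeg (square-nonNeg (sampleSum (belowWeight n t) s σ))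
  (square-nonNeg (sampleSum (belowWeight n (n ℕ.∸ t)) s σ))

mean-deviation : ∀ {k n} (s : Fin k → Fin n) → (∀ {i j} → s i ≡ s j → i ≡ j) → ∀ {t} → t ℕ.≤ n →
  meanₚ n (deviation s t) ≤ fromℕ k * square (fromℕ n) + fromℕ k * square (fromℕ n)
mean-deviation {n = n} s s-inj {t} t≤n = ℚ.≤-trans
  (ℚ.≤-reflexive (IsMean.+-homo (meanₚ-isMean n) (square ∘ sampleSum (belowWeight n t) s)
    (square ∘ sampleSum (belowWeight n (n ℕ.∸ t)) s)))
  (ℚ.+-mono-≤
    (variance-sampleSum (belowWeight n t) (sum-belowWeight n t t≤n) s s-inj (square-belowWeight n t t≤n))
    (variance-sampleSum (belowWeight n (n ℕ.∸ t)) (sum-belowWeight n (n ℕ.∸ t) (ℕ.m∸n≤m n t)) s s-inj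
      (square-belowWeight n (n ℕ.∸ t) (ℕ.m∸n≤m n t))))

module _ {k n} (s : Fin (suc k) → Fin n) (σ : Permutation′ n) (j : Fin (suc k)) (median : IsMedian s σ j)
         (a t : ℕ) (t≤n : t ℕ.≤ n) (gap : n ℕ.+ a ℕ.* n ℕ.≤ a ℕ.* (2 ℕ.* t)) where

  private
    K = fromℕ (suc k)
    a′ = fromℕ a
    n′ = fromℕ n
    t′ = fromℕ t
    d = fromℕ 2 * t′ - n′

    -- For a > 0, `gap` says that t exceeds n/2 by at least n/(2a).
    gap′ : n′ ≤ a′ * d
    gap′ = ≤-from {n′ + a′ * n′} {a′ * (fromℕ 2 * t′)}
      (subst₂ _≤_ (trans (fromℕ-+ n (a ℕ.* n)) (cong (_+_ n′) (fromℕ-* a n)))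
        (trans (fromℕ-* a (2 ℕ.* t)) (cong (a′ *_) (fromℕ-* 2 t))) (fromℕ-mono-≤ gap))
      (solve 4 (λ n a t two → n :+ a :* (two :* t) := a :* (two :* t :+ (:- n)) :+ (n :+ a :* n)) refl n′ a′ t′ (fromℕ 2))
      where open +-*-Solver

    K*n≤ : ∀ {W} → K * d ≤ W → square (K * n′) ≤ square a′ * square W
    K*n≤ {W} Kd≤W = begin
      square (K * n′)     ≤⟨ square-mono (*-nonNeg (0≤fromℕ (suc k)) (0≤fromℕ n)) (begin
        K * n′              ≤⟨ *-mono-≤ K (0≤fromℕ (suc k)) gap′ ⟩
        K * (a′ * d)        ≡⟨ solve 3 (λ K a d → K :* (a :* d) := a :* (K :* d)) refl K a′ d ⟩
        a′ * (K * d)        ≤⟨ *-mono-≤ a′ (0≤fromℕ a) Kd≤W ⟩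
        a′ * W              ∎) ⟩
      square (a′ * W)     ≡⟨ solve 2 (λ a W → a :* W :* (a :* W) := a :* a :* (W :* W)) refl a′ W ⟩
      square a′ * square W ∎
      where
      open ℚ.≤-Reasoning
      open +-*-Solver

    W₁ = sampleSum (belowWeight n t) s σ
    W₂ = sampleSum (belowWeight n (n ℕ.∸ t)) s σ

    u≡ : fromℕ (n ℕ.∸ t) ≡ n′ - t′
    u≡ = begin
      fromℕ (n ℕ.∸ t)               ≡⟨ solve 2 (λ u t → u := u :+ t :+ (:- t)) refl (fromℕ (n ℕ.∸ t)) t′ ⟩
      fromℕ (n ℕ.∸ t) + t′ - t′     ≡⟨ cong (_- t′) (fromℕ-+ (n ℕ.∸ t) t) ⟨
      fromℕ (n ℕ.∸ t ℕ.+ t) - t′    ≡⟨ cong (λ z → fromℕ z - t′) (ℕ.m∸n+n≡m t≤n) ⟩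
      n′ - t′                       ∎
      where
      open ≡-Reasoning
      open +-*-Solver

  -- A high median forces 2 `W₁` ≤ - K d, a low one forces 2 `W₂` ≥ K d. With n ≤ a d, squaring
  -- either gives K² n² ≤ 4 a² W², and squares lose the sign that distinguishes the cases.
  deviation-unbalanced : (t ℕ.≤ toℕ (σ ⟨$⟩ʳ s j)) ⊎ (toℕ (σ ⟨$⟩ʳ s j) ℕ.< n ℕ.∸ t) →
    square (K * n′) ≤ square a′ * fromℕ 4 * deviation s t σ
  deviation-unbalanced (inj₁ high) = begin
    square (K * n′)                            ≤⟨ K*n≤ { - (fromℕ 2 * W₁)} (≤-from {fromℕ 2 * W₁} {K * (n′ - fromℕ 2 * t′)}
      (sampleSum-above s σ j median high)
      (solve 5 (λ K two t n W → K :* (two :* t :+ (:- n)) :+ K :* (n :+ (:- (two :* t))) := (:- (two :* W)) :+ two :* W) refl K (fromℕ 2) t′ n′ W₁)) ⟩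
    square a′ * square (- (fromℕ 2 * W₁))
      ≡⟨ solve 2 (λ a W → a :* a :* ((:- (con (fromℕ 2) :* W)) :* (:- (con (fromℕ 2) :* W))) := a :* a :* con (fromℕ 4) :* (W :* W)) refl a′ W₁ ⟩
    square a′ * fromℕ 4 * square W₁            ≤⟨ *-mono-≤ (square a′ * fromℕ 4) (*-nonNeg (square-nonNeg a′) (0≤fromℕ 4))
      (≤-from {0ℚ} {square W₂} (square-nonNeg W₂) (sym (ℚ.+-identityʳ (square W₁ + square W₂)))) ⟩
    square a′ * fromℕ 4 * deviation s t σ      ∎
    where
    open ℚ.≤-Reasoning
    open +-*-Solver
  deviation-unbalanced (inj₂ low) = begin
    square (K * n′)                            ≤⟨ K*n≤ {fromℕ 2 * W₂} (subst (_≤ fromℕ 2 * W₂)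
      (trans (cong (λ u → K * (n′ - fromℕ 2 * u)) u≡)
        (solve 3 (λ K t n → K :* (n :+ (:- (con (fromℕ 2) :* (n :+ (:- t))))) := K :* (con (fromℕ 2) :* t :+ (:- n))) refl K t′ n′))
      (sampleSum-below s σ j median low)) ⟩
    square a′ * square (fromℕ 2 * W₂)
      ≡⟨ solve 2 (λ a W → a :* a :* (con (fromℕ 2) :* W :* (con (fromℕ 2) :* W)) := a :* a :* con (fromℕ 4) :* (W :* W)) refl a′ W₂ ⟩
    square a′ * fromℕ 4 * square W₂            ≤⟨ *-mono-≤ (square a′ * fromℕ 4) (*-nonNeg (square-nonNeg a′) (0≤fromℕ 4))
      (≤-from {0ℚ} {square W₁} (square-nonNeg W₁) (trans (ℚ.+-comm (square W₂) (square W₁)) (sym (ℚ.+-identityʳ (square W₁ + square W₂))))) ⟩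
    square a′ * fromℕ 4 * deviation s t σ      ∎
    where
    open ℚ.≤-Reasoning
    open +-*-Solver

fromℕ-injective : ∀ {m n} → fromℕ m ≡ fromℕ n → m ≡ n
fromℕ-injective {m} {n} e = ℕ.≤-antisym (le m n e) (le n m (sym e))
  where
  le : ∀ m n → fromℕ m ≡ fromℕ n → m ℕ.≤ n
  le m n e with m ℕ.≤? n
  ... | yes m≤n = m≤n
  ... | no m≰n = contradiction (ℚ.≤-trans
      (subst (_≤ fromℕ m) (fromℕ-+ 1 n) (fromℕ-mono-≤ (ℕ.≰⇒> m≰n))) (ℚ.≤-reflexive e))
    (λ h → ℚ.<-irrefl refl (ℚ.<-≤-trans
      (subst (_< 1ℚ + fromℕ n) (ℚ.+-identityˡ (fromℕ n)) (ℚ.+-monoˡ-< (fromℕ n) (ℚ.positive⁻¹ 1ℚ))) h))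

outcome-always-≤ : ∀ {E R : Set} (lt : Comparison E) {φ : R → ℚ} {c} (A : Algorithm E R) →
  Always lt (λ r → φ r ≤ c) A → outcome lt A φ ≤ c
outcome-always-≤ lt (return r)      h = h
outcome-always-≤ lt (compare x y t) h = outcome-always-≤ lt (t (lt x y)) h
outcome-always-≤ lt {φ} {c} (random {k} t) h =
  IsMean.bounded (mean-isMean {k}) {λ i → outcome lt (t i) φ} {c} (λ i → outcome-always-≤ lt (t i) (h i))

-- Sampling

lookup-removeAt : ∀ {A : Set} {n} (xs : Vec A (suc n)) i a →
  Vec.lookup (Vec.removeAt xs i) a ≡ Vec.lookup xs (punchIn i a)
lookup-removeAt (x ∷ xs)     zero    a       = refl
lookup-removeAt (x ∷ y ∷ xs) (suc i) zero    = refl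
lookup-removeAt (x ∷ y ∷ xs) (suc i) (suc a) = lookup-removeAt (y ∷ xs) i a

draw-cost : ∀ {E A : Set} {k n} (k≤n : k ℕ.≤ n) (xs : Vec A n) (lt : Comparison E) →
  cost lt (draw k≤n xs) ≡ 0ℚ
draw-cost z≤n       xs lt = refl
draw-cost {k = suc k} {suc n} (s≤s k≤n) xs lt = trans (mean-cong {n} (λ i → begin
    cost lt (rest i >>= λ ys → return (Vec.lookup xs i ∷ ys))
      ≡⟨ cost->>= lt (rest i) (λ ys → return (Vec.lookup xs i ∷ ys)) ⟩
    cost lt (rest i) + outcome lt (rest i) (λ _ → 0ℚ)
      ≡⟨ cong₂ _+_ (draw-cost k≤n (Vec.removeAt xs i) lt) (IsMean.const (outcome-isMean lt (rest i)) 0ℚ) ⟩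
    0ℚ  ∎))
  (IsMean.const (mean-isMean {n}) 0ℚ)
  where
  open ≡-Reasoning
  rest : Fin (suc n) → Algorithm _ (Vec _ k)
  rest i = draw k≤n (Vec.removeAt xs i)

-- The injection `e` names the drawn positions; it records that drawing is without replacement.
SubVector : ∀ {A : Set} {k n} → Vec A n → Vec A k → Set
SubVector {k = k} {n} xs s = Σ[ e ∈ (Fin k → Fin n) ]
  (∀ {i j} → e i ≡ e j → i ≡ j) × (∀ i → Vec.lookup s i ≡ Vec.lookup xs (e i))

-- The mean `𝔼` commutes with each draw, so a bound valid for every fixed sample passes through the
-- random one. From then on the sample is fixed and only the input order is random.
draw-mean-≤ : ∀ {Ω : Set} {𝔼 : (Ω → ℚ) → ℚ} → IsMean 𝔼 → ∀ {E A : Set} {k n} (k≤n : k ℕ.≤ n) (xs : Vec A n)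
  (lt : Ω → Comparison E) (F : Ω → Vec A k → ℚ) {B} → (∀ s → SubVector xs s → 𝔼 (λ ω → F ω s) ≤ B) →
  𝔼 (λ ω → outcome (lt ω) (draw k≤n xs) (F ω)) ≤ B
draw-mean-≤ E z≤n xs lt F h = h [] ((λ ()) , (λ { {()} }) , λ ())
draw-mean-≤ {Ω} {𝔼} E {A = A} {suc k} {suc n} (s≤s k≤n) xs lt F {B} h = begin
  𝔼 (λ ω → mean (λ i → outcome (lt ω) (step i) (F ω)))
    ≡⟨ mean-swap E (λ ω i → outcome (lt ω) (step i) (F ω)) ⟩
  mean (λ i → 𝔼 (λ ω → outcome (lt ω) (step i) (F ω)))
    ≤⟨ IsMean.bounded (mean-isMean {n}) {c = B} (λ i → subst (_≤ B)
         (IsMean.congᴱ E (λ ω → sym (outcome->>= (lt ω) (draw k≤n (Vec.removeAt xs i)) (cons i) (F ω))))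
         (draw-mean-≤ E k≤n (Vec.removeAt xs i) lt (λ ω ys → F ω (Vec.lookup xs i ∷ ys)) (λ ys sub → h _ (extended i ys sub)))) ⟩
  B  ∎
  where
  open ℚ.≤-Reasoning
  cons : Fin (suc n) → Vec A k → Algorithm _ (Vec A (suc k))
  cons i ys = return (Vec.lookup xs i ∷ ys)
  step : Fin (suc n) → Algorithm _ (Vec A (suc k))
  step i = draw k≤n (Vec.removeAt xs i) >>= cons i
  extended : ∀ i ys → SubVector (Vec.removeAt xs i) ys → SubVector xs (Vec.lookup xs i ∷ ys)
  extended i ys (e , e-inj , ys≡) = e′ , e′-inj , λ
    { zero → refl ; (suc a) → trans (ys≡ a) (lookup-removeAt xs i (e a)) }
    where
    e′ : Fin (suc k) → Fin (suc n)
    e′ zero    = i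
    e′ (suc a) = punchIn i (e a)
    e′-inj : ∀ {a b} → e′ a ≡ e′ b → a ≡ b
    e′-inj {zero}  {zero}  _ = refl
    e′-inj {zero}  {suc b} q = contradiction (sym q) (Fin.punchInᵢ≢i i (e b))
    e′-inj {suc a} {zero}  q = contradiction q (Fin.punchInᵢ≢i i (e a))
    e′-inj {suc a} {suc b} q = cong suc (e-inj (Fin.punchIn-injective i (e a) (e b) q))

-- The median of the sample

isMedian? : ∀ {k n} (s : Fin k → Fin n) (σ : Permutation′ n) j → Dec (IsMedian s σ j)
isMedian? {k} s σ j = sum (λ i → ind ((σ ⟨$⟩ʳ s i) Fin.<? (σ ⟨$⟩ʳ s j))) ℚ.≟ fromℕ ℕ.⌊ ℕ.pred k /2⌋

module _ {k n} (s : Fin k → Fin n) (s-inj : ∀ {i j} → s i ≡ s j → i ≡ j) (σ : Permutation′ n) where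

  private
    pattern′ = orderPattern (λ i → σ ⟨$⟩ʳ s i)
      (λ e → s-inj (⟨$⟩ʳ-injective σ e))
    ρ = proj₁ pattern′

    rank≡ : ∀ j → sum (λ i → ind ((σ ⟨$⟩ʳ s i) Fin.<? (σ ⟨$⟩ʳ s j))) ≡ fromℕ (toℕ (ρ ⟨$⟩ʳ j))
    rank≡ j = trans (sum-cong-≗ {k} (λ i → cong (λ b → if b then 1ℚ else 0ℚ) (sym (proj₂ pattern′ i j))))
      (sum-ind-rank ρ j)

  median-unique : ∀ {i j} → IsMedian s σ i → IsMedian s σ j → i ≡ j
  median-unique {i} {j} p q = ⟨$⟩ʳ-injective ρ
    (Fin.toℕ-injective (fromℕ-injective (trans (sym (rank≡ i)) (trans (trans p (sym q)) (rank≡ j)))))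

  module _ .{{_ : NonZero k}} (select : SelectionProcedure) (selects : SelectsMedian select) where

    always-median : Always (smaller? σ ⟪ s ⟫) (IsMedian s σ) (select k)
    always-median = Always-cong (proj₂ pattern′) (select k) (Always-map (smaller? ρ) (select k)
      (λ j e → trans (rank≡ j) (cong fromℕ e)) (Surely⇒Always ρ (select k) (selects k ρ)))

    -- The selected index is always a median, and the median is unique. The run of `select` can thus
    -- be replaced by a sum over candidates in which each candidate, and with it the pivot position,
    -- is fixed.
    outcome-median : ∀ φ → outcome (smaller? σ ⟪ s ⟫) (select k) φ ≡ sum (λ j → ind (isMedian? s σ j) * φ j)
    outcome-median φ = outcome-always (smaller? σ ⟪ s ⟫) (select k)
      (Always-map (smaller? σ ⟪ s ⟫) (select k) (λ j p → sym (trans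
        (sum-cong-≗ {k} (λ i → cong (_* φ i) (ind-cong (isMedian? s σ i) (i Fin.≟ j)
          (λ q → median-unique q p) (λ { refl → p }))))
        (sum-ind-≟ j φ))) always-median)

-- Sorting the two parts

-- A is run on the part enumerated by f, and its result determines the order
-- in which the part enumerated by g is handed to B.

module _ {l r n} {R S : Set} (f : Fin l → Fin n) (f-inj : ∀ {i j} → f i ≡ f j → i ≡ j)
         (g : Fin r → Fin n) (g-inj : ∀ {i j} → g i ≡ g j → i ≡ j) (disjoint : ∀ i j → g j ≢ f i)
         (A : Algorithm (Fin l) R) (B : Algorithm (Fin r) S) (π : Permutation′ l) (ρ : R → Permutation′ r) where

  private
    open IsMean (meanₚ-isMean n)

    ltA : Permutation′ n → Comparison (Fin l)
    ltA σ = smaller? σ ⟪ f ⟫ ⟪ π ⟨$⟩ʳ_ ⟫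

    costB : Comparison (Fin r) → R → ℚ
    costB c y = cost (c ⟪ ρ y ⟨$⟩ʳ_ ⟫) B

  -- `u` is the weight to condition on. The first cost is averaged over the pattern on `f`. In the
  -- second the pattern on `g` stays uniform for each result of A, because A makes no comparison in
  -- the image of `g`; so the order in which B receives its input may depend on that result.
  mean-parts : (u : Permutation′ n → ℚ) → Extensional u →
    (∀ κ σ → u (extendₚ f f-inj κ ∘ₚ σ) ≡ u σ) → (∀ κ σ → u (extendₚ g g-inj κ ∘ₚ σ) ≡ u σ) →
    meanₚ n (λ σ → u σ * (cost (ltA σ) A + outcome (ltA σ) A (costB (smaller? σ ⟪ g ⟫)))) ≡
    meanₚ n (λ σ → u σ * (averageCost A + averageCost B))
  mean-parts u u-ext u-f u-g = begin
    meanₚ n (λ σ → u σ * (cost (ltA σ) A + outcome (ltA σ) A (costB (smaller? σ ⟪ g ⟫))))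
      ≡⟨ congᴱ (λ σ → ℚ.*-distribˡ-+ (u σ) (cost (ltA σ) A) (outcome (ltA σ) A (costB (smaller? σ ⟪ g ⟫)))) ⟩
    meanₚ n (λ σ → u σ * cost (ltA σ) A + u σ * outcome (ltA σ) A (costB (smaller? σ ⟪ g ⟫)))
      ≡⟨ +-homo (λ σ → u σ * cost (ltA σ) A) (λ σ → u σ * outcome (ltA σ) A (costB (smaller? σ ⟪ g ⟫))) ⟩
    meanₚ n (λ σ → u σ * cost (ltA σ) A) + meanₚ n (λ σ → u σ * outcome (ltA σ) A (costB (smaller? σ ⟪ g ⟫)))
      ≡⟨ cong₂ _+_ first second ⟩
    meanₚ n (λ σ → u σ * averageCost A) + meanₚ n (λ σ → u σ * averageCost B)
      ≡⟨ +-homo (λ σ → u σ * averageCost A) (λ σ → u σ * averageCost B) ⟨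
    meanₚ n (λ σ → u σ * averageCost A + u σ * averageCost B)
      ≡⟨ congᴱ (λ σ → ℚ.*-distribˡ-+ (u σ) (averageCost A) (averageCost B)) ⟨
    meanₚ n (λ σ → u σ * (averageCost A + averageCost B))  ∎
    where
    open ≡-Reasoning

    first : meanₚ n (λ σ → u σ * cost (ltA σ) A) ≡ meanₚ n (λ σ → u σ * averageCost A)
    first = trans
      (meanₚ-pattern f f-inj (λ σ c → u σ * cost (c ⟪ π ⟨$⟩ʳ_ ⟫) A)
        (λ c σ σ′ e → cong (_* cost (c ⟪ π ⟨$⟩ʳ_ ⟫) A) (u-ext σ σ′ e))
        (λ σ e → cong (u σ *_) (cost-cong (λ x y → e (π ⟨$⟩ʳ x) (π ⟨$⟩ʳ y)) A))
        (λ κ σ c → cong (_* cost (c ⟪ π ⟨$⟩ʳ_ ⟫) A) (u-f κ σ)))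
      (congᴱ (λ σ → trans (IsMean.*-homo (meanₚ-isMean l) (u σ) (λ κ → cost (smaller? κ ⟪ π ⟨$⟩ʳ_ ⟫) A))
        (cong (u σ *_) (averageCost-rearranged π A))))

    -- Permuting the image of `g` fixes the image of `f`, hence every comparison that A can make.
    unaffected : ∀ κ σ → ltA (extendₚ g g-inj κ ∘ₚ σ) ≐ ltA σ
    unaffected κ σ x y = cong₂ (smaller? σ) (fixed (π ⟨$⟩ʳ x)) (fixed (π ⟨$⟩ʳ y))
      where
      fixed : ∀ i → extend g (κ ⟨$⟩ʳ_) (f i) ≡ f i
      fixed i = extend-outside g g-inj (κ ⟨$⟩ʳ_) (f i) (disjoint i)

    second : meanₚ n (λ σ → u σ * outcome (ltA σ) A (costB (smaller? σ ⟪ g ⟫))) ≡ meanₚ n (λ σ → u σ * averageCost B)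
    second = trans
      (meanₚ-pattern g g-inj (λ σ c → u σ * outcome (ltA σ) A (costB c))
        (λ c σ σ′ e → cong₂ _*_ (u-ext σ σ′ e)
          (outcome-cong (λ x y → smaller?-cong {σ = σ} {σ′} e (f (π ⟨$⟩ʳ x)) (f (π ⟨$⟩ʳ y))) A (costB c)))
        (λ σ e → cong (u σ *_) (IsMean.congᴱ (outcome-isMean (ltA σ) A)
          (λ y → cost-cong (λ a b → e (ρ y ⟨$⟩ʳ a) (ρ y ⟨$⟩ʳ b)) B)))
        (λ κ σ c → cong₂ _*_ (u-g κ σ) (outcome-cong (unaffected κ σ) A (costB c))))
      (congᴱ (λ σ → begin
        meanₚ r (λ κ → u σ * outcome (ltA σ) A (costB (smaller? κ)))
          ≡⟨ IsMean.*-homo (meanₚ-isMean r) (u σ) (λ κ → outcome (ltA σ) A (costB (smaller? κ))) ⟩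
        u σ * meanₚ r (λ κ → outcome (ltA σ) A (costB (smaller? κ)))
          ≡⟨ cong (u σ *_) (meanₚ-swap (outcome-isMean (ltA σ) A) r (λ y κ → costB (smaller? κ) y)) ⟨
        u σ * outcome (ltA σ) A (λ y → meanₚ r (λ κ → costB (smaller? κ) y))
          ≡⟨ cong (u σ *_) (IsMean.congᴱ (outcome-isMean (ltA σ) A) (λ y → averageCost-rearranged (ρ y) B)) ⟩
        u σ * outcome (ltA σ) A (λ y → averageCost B)
          ≡⟨ cong (u σ *_) (IsMean.const (outcome-isMean (ltA σ) A) (averageCost B)) ⟩
        u σ * averageCost B  ∎))

-- Conditioning on the partition

_≟ᵛ_ : ∀ {m} (S T : Vec Bool m) → Dec (S ≡ T)
_≟ᵛ_ = Vec.≡-dec _≟ᵇ_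

sumᵥ : ∀ m → (Vec Bool m → ℚ) → ℚ
sumᵥ zero    F = F []
sumᵥ (suc m) F = sumᵥ m (λ T → F (true ∷ T)) + sumᵥ m (λ T → F (false ∷ T))

sumᵥ-cong : ∀ m {F G : Vec Bool m → ℚ} → (∀ T → F T ≡ G T) → sumᵥ m F ≡ sumᵥ m G
sumᵥ-cong zero    h = h []
sumᵥ-cong (suc m) h = cong₂ _+_ (sumᵥ-cong m (λ T → h (true ∷ T))) (sumᵥ-cong m (λ T → h (false ∷ T)))

sumᵥ-homo : ∀ {Ω : Set} {𝔼 : (Ω → ℚ) → ℚ} → IsMean 𝔼 → ∀ m (F : Vec Bool m → Ω → ℚ) →
  𝔼 (λ ω → sumᵥ m (λ T → F T ω)) ≡ sumᵥ m (λ T → 𝔼 (F T))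
sumᵥ-homo E zero    F = refl
sumᵥ-homo E (suc m) F = trans
  (IsMean.+-homo E (λ ω → sumᵥ m (λ T → F (true ∷ T) ω)) (λ ω → sumᵥ m (λ T → F (false ∷ T) ω)))
  (cong₂ _+_ (sumᵥ-homo E m (λ T → F (true ∷ T))) (sumᵥ-homo E m (λ T → F (false ∷ T))))

sumᵥ-zero : ∀ m {F : Vec Bool m → ℚ} → (∀ T → F T ≡ 0ℚ) → sumᵥ m F ≡ 0ℚ
sumᵥ-zero zero    h = h []
sumᵥ-zero (suc m) h = cong₂ _+_ (sumᵥ-zero m (λ T → h (true ∷ T))) (sumᵥ-zero m (λ T → h (false ∷ T)))

sumᵥ-ind : ∀ {m} (S : Vec Bool m) (F : Vec Bool m → ℚ) → sumᵥ m (λ T → ind (S ≟ᵛ T) * F T) ≡ F S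
sumᵥ-ind []          F = ℚ.*-identityˡ (F [])
sumᵥ-ind {suc m} (true ∷ S)  F = trans (cong₂ _+_
    (trans (sumᵥ-cong m (λ T → cong (_* F (true ∷ T)) (ind-cong ((true ∷ S) ≟ᵛ (true ∷ T)) (S ≟ᵛ T) Vec.∷-injectiveʳ (cong (true ∷_)))))
           (sumᵥ-ind S (λ T → F (true ∷ T))))
    (sumᵥ-zero m (λ T → trans (cong (_* F (false ∷ T)) (ind-no ((true ∷ S) ≟ᵛ (false ∷ T)) λ ())) (ℚ.*-zeroˡ (F (false ∷ T))))))
  (ℚ.+-identityʳ (F (true ∷ S)))
sumᵥ-ind {suc m} (false ∷ S) F = trans (cong₂ _+_
    (sumᵥ-zero m (λ T → trans (cong (_* F (true ∷ T)) (ind-no ((false ∷ S) ≟ᵛ (true ∷ T)) λ ())) (ℚ.*-zeroˡ (F (true ∷ T)))))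
    (trans (sumᵥ-cong m (λ T → cong (_* F (false ∷ T)) (ind-cong ((false ∷ S) ≟ᵛ (false ∷ T)) (S ≟ᵛ T) Vec.∷-injectiveʳ (cong (false ∷_)))))
           (sumᵥ-ind S (λ T → F (false ∷ T)))))
  (ℚ.+-identityˡ (F (false ∷ S)))

-- Total expectation over the values of `S`. Once the value is fixed to `T`, the lengths and
-- enumerations of the two parts no longer vary with `ω`, so the types of the algorithms run on them
-- are fixed as well.
mean-classified : ∀ {Ω : Set} {𝔼 : (Ω → ℚ) → ℚ} → IsMean 𝔼 → ∀ {m} (S : Ω → Vec Bool m) (F G : Vec Bool m → Ω → ℚ) →
  (∀ T → 𝔼 (λ ω → ind (S ω ≟ᵛ T) * F T ω) ≡ 𝔼 (λ ω → ind (S ω ≟ᵛ T) * G T ω)) →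
  𝔼 (λ ω → F (S ω) ω) ≡ 𝔼 (λ ω → G (S ω) ω)
mean-classified {𝔼 = 𝔼} E {m} S F G h = begin
  𝔼 (λ ω → F (S ω) ω)                                  ≡⟨ congᴱ (λ ω → sumᵥ-ind (S ω) (λ T → F T ω)) ⟨
  𝔼 (λ ω → sumᵥ m (λ T → ind (S ω ≟ᵛ T) * F T ω))      ≡⟨ sumᵥ-homo E m (λ T ω → ind (S ω ≟ᵛ T) * F T ω) ⟩
  sumᵥ m (λ T → 𝔼 (λ ω → ind (S ω ≟ᵛ T) * F T ω))      ≡⟨ sumᵥ-cong m h ⟩
  sumᵥ m (λ T → 𝔼 (λ ω → ind (S ω ≟ᵛ T) * G T ω))      ≡⟨ sumᵥ-homo E m (λ T ω → ind (S ω ≟ᵛ T) * G T ω) ⟨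
  𝔼 (λ ω → sumᵥ m (λ T → ind (S ω ≟ᵛ T) * G T ω))      ≡⟨ congᴱ (λ ω → sumᵥ-ind (S ω) (λ T → G T ω)) ⟩
  𝔼 (λ ω → G (S ω) ω)                                  ∎
  where
  open ≡-Reasoning
  open IsMean E

belowPivot : ∀ {m} → Comparison (Fin (suc m)) → Fin (suc m) → Subset m
belowPivot lt p = Vec.map (λ x → lt x p) (Vec.tabulate (punchIn p))

lookup-belowPivot : ∀ {m} (lt : Comparison (Fin (suc m))) p a → Vec.lookup (belowPivot lt p) a ≡ lt (punchIn p a) p
lookup-belowPivot lt p a = trans (Vec.lookup-map a (λ x → lt x p) (Vec.tabulate (punchIn p)))
  (cong (λ x → lt x p) (Vec.lookup∘tabulate (punchIn p) a))

belowPivot-cong : ∀ {m} {lt lt′ : Comparison (Fin (suc m))} p → (∀ x → lt x p ≡ lt′ x p) → belowPivot lt p ≡ belowPivot lt′ p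
belowPivot-cong p h = Vec.map-cong h (Vec.tabulate (punchIn p))

module _ {m} (p : Fin (suc m)) (w : Permutation′ (suc m) → ℚ)
         (w-local : ∀ σ ρ → (∀ x → smaller? σ x p ≡ smaller? ρ x p) → w σ ≡ w ρ) (T : Subset m) where

  conditioned : Permutation′ (suc m) → ℚ
  conditioned σ = ind (belowPivot (smaller? σ) p ≟ᵛ T) * w σ

  conditioned-local : ∀ σ ρ → (∀ x → smaller? σ x p ≡ smaller? ρ x p) → conditioned σ ≡ conditioned ρ
  conditioned-local σ ρ h = cong₂ (λ S a → ind (S ≟ᵛ T) * a) (belowPivot-cong {lt = smaller? σ} {smaller? ρ} p h) (w-local σ ρ h)

  conditioned-extensional : Extensional conditioned
  conditioned-extensional σ ρ e = conditioned-local σ ρ (λ x → smaller?-cong {σ = σ} {ρ} e x p)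

  module _ {l} (f : Fin l → Fin (suc m)) (f-inj : ∀ {i j} → f i ≡ f j → i ≡ j) (b : Bool)
           (block : ∀ i → Σ[ a ∈ Fin m ] f i ≡ punchIn p a × Vec.lookup T a ≡ b) where

    private
      side : ∀ σ → belowPivot (smaller? σ) p ≡ T → ∀ i → smaller? σ (f i) p ≡ b
      side σ e i with a , fi≡ , Ta≡b ← block i = begin
        smaller? σ (f i) p                          ≡⟨ cong (λ x → smaller? σ x p) fi≡ ⟩
        smaller? σ (punchIn p a) p                  ≡⟨ lookup-belowPivot (smaller? σ) p a ⟨
        Vec.lookup (belowPivot (smaller? σ) p) a    ≡⟨ cong (λ S → Vec.lookup S a) e ⟩
        Vec.lookup T a                              ≡⟨ Ta≡b ⟩
        b                                           ∎
        where open ≡-Reasoning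

      pivot-fixed : ∀ h → extend f h p ≡ p
      pivot-fixed h = extend-outside f f-inj h p (λ i e → Fin.punchInᵢ≢i p (proj₁ (block i)) (trans (sym (proj₁ (proj₂ (block i)))) e))

      same-side : ∀ κ σ → belowPivot (smaller? σ) p ≡ T → ∀ x →
        smaller? (extendₚ f f-inj κ ∘ₚ σ) x p ≡ smaller? σ x p
      same-side κ σ e x = trans (cong (smaller? σ (extend f (κ ⟨$⟩ʳ_) x)) (pivot-fixed (κ ⟨$⟩ʳ_))) moved
        where
        moved : smaller? σ (extend f (κ ⟨$⟩ʳ_) x) p ≡ smaller? σ x p
        moved with Fin.any? (λ i → f i Fin.≟ x)
        ... | yes (i , refl) = trans (side σ e (κ ⟨$⟩ʳ i)) (sym (side σ e i))
        ... | no _           = refl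

    -- If `σ` has partition `T`, all of the block lies on one side of the pivot, so permuting it
    -- changes no comparison with the pivot and hence neither the indicator nor `w`.
    conditioned-block : ∀ κ σ → conditioned (extendₚ f f-inj κ ∘ₚ σ) ≡ conditioned σ
    conditioned-block κ σ = by-cases (belowPivot (smaller? σ) p ≟ᵛ T) (belowPivot (smaller? σ′) p ≟ᵛ T)
      where
      σ′ = extendₚ f f-inj κ ∘ₚ σ
      σ″ = extendₚ f f-inj (flip κ) ∘ₚ σ′
      back : ∀ x → smaller? σ″ x p ≡ smaller? σ x p
      back x = smaller?-cong {σ = σ″} {σ} (λ i → cong (σ ⟨$⟩ʳ_)
        (extend-∘ f f-inj (κ ⟨$⟩ʳ_) (κ ⟨$⟩ˡ_) (λ _ → Perm.inverseʳ κ) i)) x p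
      by-cases : Dec (belowPivot (smaller? σ) p ≡ T) → Dec (belowPivot (smaller? σ′) p ≡ T) →
        conditioned σ′ ≡ conditioned σ
      by-cases (yes e) _       = conditioned-local σ′ σ (same-side κ σ e)
      -- Only the permuted order is known to have partition `T`; permuting back by the inverse of
      -- `κ` returns an order that compares with the pivot as `σ` does.
      by-cases (no _)  (yes e) = trans (sym (conditioned-local σ″ σ′ (same-side (flip κ) σ′ e)))
        (conditioned-local σ″ σ back)
      by-cases (no ¬e) (no ¬e′) = trans (zero≡ σ′ ¬e′) (sym (zero≡ σ ¬e))
        where
        zero≡ : ∀ ρ → ¬ belowPivot (smaller? ρ) p ≡ T → conditioned ρ ≡ 0ℚ
        zero≡ ρ ¬q = trans (cong (_* w ρ) (ind-no (belowPivot (smaller? ρ) p ≟ᵛ T) ¬q)) (ℚ.*-zeroˡ (w ρ))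

lookup-injective : ∀ {A : Set} {xs : List A} → Unique xs → ∀ {i j} → List.lookup xs i ≡ List.lookup xs j → i ≡ j
lookup-injective (_ ∷ _)   {zero}  {zero}  e = refl
lookup-injective {xs = _ ∷ xs} (x∉ ∷ _)  {zero}  {suc j} e = contradiction e (All.lookup x∉ (List.∈-lookup {xs = xs} j))
lookup-injective {xs = _ ∷ xs} (x∉ ∷ _)  {suc i} {zero}  e = contradiction (sym e) (All.lookup x∉ (List.∈-lookup {xs = xs} i))
lookup-injective (_ ∷ u)   {suc i} {suc j} e = cong suc (lookup-injective u e)

length-filter-tabulate : ∀ {A : Set} {P : A → Set} (P? : ∀ x → Dec (P x)) {n} (f : Fin n → A) →
  fromℕ (length (filter P? (List.tabulate f))) ≡ sum (λ i → ind (P? (f i)))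
length-filter-tabulate P? {zero}  f = refl
length-filter-tabulate P? {suc n} f = trans (cong fromℕ (step (f zero) (List.tabulate (f ∘ suc))))
  (trans (fromℕ-+ (count (does (P? (f zero)))) (length (filter P? (List.tabulate (f ∘ suc)))))
    (cong₂ _+_ (count≡ (does (P? (f zero)))) (length-filter-tabulate P? (f ∘ suc))))
  where
  count : Bool → ℕ
  count b = if b then 1 else 0
  count≡ : ∀ b → fromℕ (count b) ≡ (if b then 1ℚ else 0ℚ)
  count≡ true  = refl
  count≡ false = refl
  step : ∀ x xs → length (filter P? (x ∷ xs)) ≡ count (does (P? x)) ℕ.+ length (filter P? xs)
  step x xs with does (P? x)
  ... | true  = refl
  ... | false = refl

module _ {m} (v : Partitioned m) where

  positions-unique : ∀ T → Unique (positions v T)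
  positions-unique T = Unique.map⁺ (λ {a} {b} → Fin.punchIn-injective (pivot v) a b)
    (Unique.filter⁺ (Subset._∈? T) (Unique.allFin⁺ m))

  positions-block : ∀ T i → Σ[ a ∈ Fin m ] List.lookup (positions v T) i ≡ punchIn (pivot v) a × a ∈ T
  positions-block T i with a , a∈ , e ← List.∈-map⁻ (punchIn (pivot v)) (List.∈-lookup {xs = positions v T} i) =
    a , e , proj₂ (List.∈-filter⁻ (Subset._∈? T) {xs = List.allFin m} a∈)

  positions-disjoint : ∀ S T → (∀ {a} → a ∈ S → a ∉ T) → ∀ i j →
    List.lookup (positions v S) i ≢ List.lookup (positions v T) j
  positions-disjoint S T S∩T i j e with a , ea , a∈S ← positions-block S i | b , eb , b∈T ← positions-block T j
    with refl ← Fin.punchIn-injective (pivot v) a b (trans (sym ea) (trans e eb)) = S∩T a∈S b∈T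

  length-positions≡ : ∀ T → fromℕ (length (positions v T)) ≡ sum (λ a → ind (a Subset.∈? T))
  length-positions≡ T = trans (cong fromℕ (List.length-map (punchIn (pivot v)) (filter (Subset._∈? T) (List.allFin m))))
    (length-filter-tabulate (Subset._∈? T) id)

  length-left+right : length (left v) ℕ.+ length (right v) ≡ m
  length-left+right = fromℕ-injective (begin
    fromℕ (length (left v) ℕ.+ length (right v))
      ≡⟨ fromℕ-+ (length (left v)) (length (right v)) ⟩
    fromℕ (length (left v)) + fromℕ (length (right v))
      ≡⟨ cong₂ _+_ (length-positions≡ (smaller v)) (length-positions≡ (∁ (smaller v))) ⟩
    sum (λ a → ind (a Subset.∈? smaller v)) + sum (λ a → ind (a Subset.∈? ∁ (smaller v)))
      ≡⟨ ∑-distrib-+ (λ a → ind (a Subset.∈? smaller v)) (λ a → ind (a Subset.∈? ∁ (smaller v))) ⟨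
    sum (λ a → ind (a Subset.∈? smaller v) + ind (a Subset.∈? ∁ (smaller v)))
      ≡⟨ sum-cong-≗ {m} (λ a → complementary (a Subset.∈? smaller v) (a Subset.∈? ∁ (smaller v)) Subset.x∈p⇒x∉∁p Subset.x∉p⇒x∈∁p) ⟩
    sum {m} (λ _ → 1ℚ)
      ≡⟨ trans (sum-const m 1ℚ) (ℚ.*-identityʳ (fromℕ m)) ⟩
    fromℕ m  ∎)
    where
    open ≡-Reasoning
    complementary : ∀ {P Q : Set} (d : Dec P) (e : Dec Q) → (P → ¬ Q) → (¬ P → Q) → ind d + ind e ≡ 1ℚ
    complementary (yes p) e f g = cong (_+_ 1ℚ) (ind-no e (f p))
    complementary (no ¬p) e f g = trans (ℚ.+-identityˡ (ind e)) (ind-yes e (g ¬p))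

  length-left : ∀ σ → smaller v ≡ belowPivot (smaller? σ) (pivot v) → length (left v) ≡ toℕ (σ ⟨$⟩ʳ pivot v)
  length-left σ e = fromℕ-injective (begin
    fromℕ (length (left v))                                        ≡⟨ length-positions≡ (smaller v) ⟩
    sum (λ a → ind (a Subset.∈? smaller v))
      ≡⟨ sum-cong-≗ {m} (λ a → ind-cong (a Subset.∈? smaller v) (rank (punchIn p a) Fin.<? rank p)
           (λ a∈ → <?⇒< _ _ (trans (sym (entry a)) (Vec.[]=⇒lookup a∈)))
           (λ lt → Vec.lookup⇒[]= a (smaller v) (trans (entry a) (<⇒<? _ _ lt)))) ⟩
    sum (λ a → ind (rank (punchIn p a) Fin.<? rank p))             ≡⟨ ℚ.+-identityˡ _ ⟨
    0ℚ + sum (λ a → ind (rank (punchIn p a) Fin.<? rank p))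
      -- The pivot is not below itself, so its zero term may be added to complete the sum to all
      -- positions.
      ≡⟨ cong (_+ sum (λ a → ind (rank (punchIn p a) Fin.<? rank p))) (ind-no (rank p Fin.<? rank p) (ℕ.<-irrefl refl)) ⟨
    ind (rank p Fin.<? rank p) + sum (λ a → ind (rank (punchIn p a) Fin.<? rank p))
      ≡⟨ sum-remove {i = p} (λ x → ind (rank x Fin.<? rank p)) ⟨
    sum (λ x → ind (rank x Fin.<? rank p))                         ≡⟨ sum-ind-rank σ p ⟩
    fromℕ (toℕ (rank p))                                           ∎)
    where
    open ≡-Reasoning
    p = pivot v
    rank : Fin (suc m) → Fin (suc m)
    rank x = σ ⟨$⟩ʳ x
    entry : ∀ a → Vec.lookup (smaller v) a ≡ smaller? σ (punchIn p a) p
    entry a = trans (cong (λ S → Vec.lookup S a) e) (lookup-belowPivot (smaller? σ) p a)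

-- Correctness

SortedAs : ∀ {n} → Permutation′ n → List (Fin n) → List (Fin n) → Set
SortedAs σ xs out = out ↭ xs × Linked (λ i j → σ ⟨$⟩ʳ i Fin.< σ ⟨$⟩ʳ j) out

Always-all : ∀ {E R : Set} (lt : Comparison E) {P : R → Set} (A : Algorithm E R) → (∀ r → P r) → Always lt P A
Always-all lt (return r)      p = p r
Always-all lt (compare x y t) p = Always-all lt (t (lt x y)) p
Always-all lt (random t)      p = λ i → Always-all lt (t i) p

sameElements⇒↭ : ∀ {A : Set} {xs ys : List A} → Unique xs → Unique ys →
  (∀ {x} → x List.∈ xs → x List.∈ ys) → (∀ {x} → x List.∈ ys → x List.∈ xs) → xs ↭ ys
sameElements⇒↭ u v f g = ∼bag⇒↭ (unique∧set⇒bag u v (mk⇔ f g))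

module _ {n} (σ : Permutation′ n) (xs : List (Fin n)) (xs! : Unique xs) (π : Permutation′ (length xs)) where

  private
    f : Fin (length xs) → Fin n
    f = List.lookup xs ∘ (π ⟨$⟩ʳ_)

    f-inj : ∀ {i j} → f i ≡ f j → i ≡ j
    f-inj e = ⟨$⟩ʳ-injective π (lookup-injective xs! e)

    map-f-↭ : List.map f (List.allFin (length xs)) ↭ xs
    map-f-↭ = sameElements⇒↭ (Unique.map⁺ f-inj (Unique.allFin⁺ (length xs))) xs! into onto
      where
      into : ∀ {x} → x List.∈ List.map f (List.allFin (length xs)) → x List.∈ xs
      into x∈ with i , _ , refl ← List.∈-map⁻ f x∈ = List.∈-lookup {xs = xs} (π ⟨$⟩ʳ i)
      onto : ∀ {x} → x List.∈ xs → x List.∈ List.map f (List.allFin (length xs))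
      onto {x} x∈ = subst (List._∈ List.map f (List.allFin (length xs)))
        (trans (cong (List.lookup xs) (Perm.inverseʳ π)) (sym (lookup-index x∈)))
        (List.∈-map⁺ f (List.∈-allFin (π ⟨$⟩ˡ index x∈)))

  -- The part, read in the order `π`, has an order pattern that is itself an input order, to which
  -- the guarantee for A applies. Sortedness is carried back because pattern and ranks compare
  -- alike.
  part-sorted : (A : Algorithm (Fin (length xs)) (List (Fin (length xs)))) →
    (∀ ρ → Always (smaller? ρ) (SortedAs ρ (List.allFin (length xs))) A) →
    Always (smaller? σ) (λ ys → SortedAs σ xs (List.map f ys)) (on f A)
  part-sorted A sorts = Always-on (smaller? σ) f A (Always-map (smaller? σ ⟪ f ⟫) A
    (λ { ys (ys↭ , linked) → ↭-trans (↭.map⁺ f ys↭) map-f-↭ , Linked.map⁺ (Linked.map order linked) })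
    (Always-cong (proj₂ pattern′) A (sorts (proj₁ pattern′))))
    where
    pattern′ = orderPattern (λ i → σ ⟨$⟩ʳ f i)
      (λ e → f-inj (⟨$⟩ʳ-injective σ e))
    order : ∀ {i j} → (proj₁ pattern′ ⟨$⟩ʳ i) Fin.< (proj₁ pattern′ ⟨$⟩ʳ j) → (σ ⟨$⟩ʳ f i) Fin.< (σ ⟨$⟩ʳ f j)
    order {i} {j} i<j = <?⇒< _ _ (trans (sym (proj₂ pattern′ i j)) (<⇒<? _ _ i<j))

module _ {m} (v : Partitioned m) (σ : Permutation′ (suc m)) (smaller≡ : smaller v ≡ belowPivot (smaller? σ) (pivot v)) where

  private
    p = pivot v
    _<σ_ : Fin (suc m) → Fin (suc m) → Set
    i <σ j = σ ⟨$⟩ʳ i Fin.< σ ⟨$⟩ʳ j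

    position : ∀ T {x} → x List.∈ positions v T → Σ[ a ∈ Fin m ] x ≡ punchIn p a × a ∈ T
    position T x∈ with a , a∈ , e ← List.∈-map⁻ (punchIn p) x∈ =
      a , e , proj₂ (List.∈-filter⁻ (Subset._∈? T) {xs = List.allFin m} a∈)

    ∈-positions : ∀ T {a} → a ∈ T → punchIn p a List.∈ positions v T
    ∈-positions T {a} a∈ = List.∈-map⁺ (punchIn p) (List.∈-filter⁺ (Subset._∈? T) (List.∈-allFin a) a∈)

    entry : ∀ a → Vec.lookup (smaller v) a ≡ smaller? σ (punchIn p a) p
    entry a = trans (cong (λ S → Vec.lookup S a) smaller≡) (lookup-belowPivot (smaller? σ) p a)

    left-< : ∀ {x} → x List.∈ left v → x <σ p
    left-< x∈ with a , refl , a∈ ← position (smaller v) x∈ =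
      <?⇒< (σ ⟨$⟩ʳ punchIn p a) (σ ⟨$⟩ʳ p) (trans (sym (entry a)) (Vec.[]=⇒lookup a∈))

    right-> : ∀ {x} → x List.∈ right v → p <σ x
    right-> x∈ with a , refl , a∈ ← position (∁ (smaller v)) x∈ = <?⇒< (σ ⟨$⟩ʳ p) (σ ⟨$⟩ʳ punchIn p a)
      (trans (<?-asym {x = σ ⟨$⟩ʳ p} {σ ⟨$⟩ʳ punchIn p a}
        (λ e → Fin.punchInᵢ≢i p a (⟨$⟩ʳ-injective σ (sym e))))
        (cong not (not-smaller (smaller? σ (punchIn p a) p) refl)))
      where
      not-smaller : ∀ b → smaller? σ (punchIn p a) p ≡ b → smaller? σ (punchIn p a) p ≡ false
      not-smaller false e = e
      not-smaller true  e = contradiction (Vec.lookup⇒[]= a (smaller v) (trans (entry a) e)) (Subset.x∈∁p⇒x∉p a∈)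

    concatenated : left v ++ p ∷ right v ↭ List.allFin (suc m)
    concatenated = sameElements⇒↭
      (AllPairs.++⁺ (positions-unique v (smaller v)) (All.tabulate (λ x∈ e → irrefl (subst (p <σ_) (sym e) (right-> x∈))) ∷ positions-unique v (∁ (smaller v)))
        (All.tabulate (λ x∈ → (λ e → irrefl (subst (_<σ p) e (left-< x∈))) ∷
          All.tabulate (λ y∈ e → ℕ.<-asym (left-< x∈) (subst (p <σ_) (sym e) (right-> y∈))))))
      (Unique.allFin⁺ (suc m)) (λ {x} _ → List.∈-allFin x) (λ {x} _ → everywhere x (p Fin.≟ x))
      where
      irrefl : ∀ {i} → ¬ i <σ i
      irrefl = ℕ.<-irrefl refl
      everywhere : ∀ x → Dec (p ≡ x) → x List.∈ left v ++ p ∷ right v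
      everywhere x (yes refl) = List.∈-++⁺ʳ (left v) (here refl)
      everywhere x (no p≢x) with punchOut p≢x Subset.∈? smaller v
      ... | yes a∈ = List.∈-++⁺ˡ (subst (List._∈ left v) (Fin.punchIn-punchOut p≢x) (∈-positions (smaller v) a∈))
      ... | no a∉  = List.∈-++⁺ʳ (left v) (there (subst (List._∈ right v) (Fin.punchIn-punchOut p≢x)
                       (∈-positions (∁ (smaller v)) (Subset.x∉p⇒x∈∁p a∉))))

  concatenation-sorted : ∀ {ls rs} → SortedAs σ (left v) ls → SortedAs σ (right v) rs →
    SortedAs σ (List.allFin (suc m)) (ls ++ p ∷ rs)
  concatenation-sorted {ls} {rs} (ls↭ , ls-sorted) (rs↭ , rs-sorted) =
    ↭-trans (↭.++⁺ ls↭ (_↭_.prep p rs↭)) concatenated ,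
    Linked.AllPairs⇒Linked (AllPairs.++⁺ (pairs ls-sorted) (p<rs ∷ pairs rs-sorted)
      (All.map (λ x<p → x<p ∷ All.map (ℕ.<-trans x<p) p<rs) ls<p))
    where
    pairs : ∀ {xs} → Linked _<σ_ xs → AllPairs _<σ_ xs
    pairs = Linked.Linked⇒AllPairs ℕ.<-trans
    ls<p : All (_<σ p) ls
    ls<p = ↭.All-resp-↭ (↭-sym ls↭) (All.tabulate left-<)
    p<rs : All (p <σ_) rs
    p<rs = ↭.All-resp-↭ (↭-sym rs↭) (All.tabulate right->)

if-elim : ∀ {A : Set} {x y : A} (P : A → Set) b → P x → P y → P (if b then x else y)
if-elim P true  p q = p
if-elim P false p q = q

-- One recursion step: cost recurrence and correctness

module _ (X : SortingProcedure) (I : Implementation) where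

  open Implementation I

  private
    partitioned : ∀ {k m} → Vec (Fin (suc m)) k → Fin (suc m) → Subset m → Partitioned m
    partitioned s p T = record { sample = Vec.toList s ; pivot = p ; smaller = T }

    RestSorters : ∀ {m} → Partitioned m → Set
    RestSorters {m} v = ∀ T → Algorithm (Fin (length (positions v T))) (List (Fin (length (positions v T))))

    partsCost : ∀ {m} → Comparison (Fin (suc m)) → (v : Partitioned m) → RestSorters v → (S T : Subset m) → ℚ
    partsCost lt v Y S T =
      cost lt′ (X l) + outcome lt′ (X l) (λ ys →
        cost (lt ⟪ List.lookup (positions v T) ⟫ ⟪ arrangeRest v ys (length (positions v T)) ⟨$⟩ʳ_ ⟫) (Y T))
      where
      l = length (positions v S)
      lt′ = lt ⟪ List.lookup (positions v S) ⟫ ⟪ arrange v l ⟨$⟩ʳ_ ⟫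

    bothPartsCost : ∀ {m} → Comparison (Fin (suc m)) → (v : Partitioned m) → RestSorters v → ℚ
    bothPartsCost lt v Y = if XSortsLeft v
      then partsCost lt v Y (smaller v) (∁ (smaller v))
      else partsCost lt v Y (∁ (smaller v)) (smaller v)

    averagePartsCost : ∀ {m} (v : Partitioned m) → RestSorters v → ℚ
    averagePartsCost v Y = if XSortsLeft v
      then averageCost (X (length (left v))) + averageCost (Y (∁ (smaller v)))
      else averageCost (X (length (right v))) + averageCost (Y (smaller v))

  module _ {m} (rs : ∀ {r} → r ℕ.< suc m → Acc ℕ._<_ r) where

    private
      E = Fin (suc m)
      k = sampleSize (suc m)
      instance
        k≢0 : NonZero k
        k≢0 = sampleSize≢0 (suc m)

      Y : (v : Partitioned m) → RestSorters v
      Y v T = quickXsort-acc X I (length (positions v T)) (rs (length-positions v T))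

      -- quickXsort-acc X I (suc m) (acc rs) unfolds to sampling >>= afterSampling.

      sampling : Algorithm E (Vec E k)
      sampling = draw (sampleSize≤n (suc m)) (Vec.allFin (suc m))

      module _ (v : Partitioned m) (S T : Subset m) where

        lS = length (positions v S)
        lT = length (positions v T)

        f : Fin lS → E
        f = List.lookup (positions v S) ∘ (arrange v lS ⟨$⟩ʳ_)

        g : List (Fin lS) → Fin lT → E
        g ys = List.lookup (positions v T) ∘ (arrangeRest v ys lT ⟨$⟩ʳ_)

        sortRest : List (Fin lS) → Algorithm E (List E × List E)
        sortRest ys = on (g ys) (Y v T) >>= λ zs → return (List.map f ys , List.map (g ys) zs)

        sortParts : Algorithm E (List E × List E)
        sortParts = on f (X lS) >>= sortRest

      leftFirst rightFirst : E → List E × List E → Algorithm E (List E)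
      leftFirst  p (ys , zs) = return (ys ++ p ∷ zs)
      rightFirst p (ys , zs) = return (zs ++ p ∷ ys)

      afterPartition : ∀ {k} → Vec E k → E → Subset m → Algorithm E (List E)
      afterPartition s p T = if XSortsLeft (partitioned s p T)
        then (sortParts (partitioned s p T) T (∁ T) >>= leftFirst p)
        else (sortParts (partitioned s p T) (∁ T) T >>= rightFirst p)

      others : E → Vec E m
      others p = Vec.tabulate (punchIn p)

      afterSampling : Vec E k → Algorithm E (List E)
      afterSampling s = on (Vec.lookup s) (select k) >>= λ j →
        compareAllWith (Vec.lookup s j) (others (Vec.lookup s j)) >>= afterPartition s (Vec.lookup s j)

      sampledCost : Comparison E → Vec E k → ℚ
      sampledCost lt s = cost (lt ⟪ Vec.lookup s ⟫) (select k) +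
        (fromℕ m + outcome (lt ⟪ Vec.lookup s ⟫) (select k) (λ j →
          bothPartsCost lt (toPartition lt s j) (Y (toPartition lt s j))))
        where
        toPartition : Comparison E → Vec E k → Fin k → Partitioned m
        toPartition lt s j = partitioned s (Vec.lookup s j) (belowPivot lt (Vec.lookup s j))

      module _ (lt : Comparison E) where

        sortParts-cost : ∀ v S T (h : List E × List E → Algorithm E (List E)) → (∀ r → cost lt (h r) ≡ 0ℚ) →
          cost lt (sortParts v S T >>= h) ≡ partsCost lt v (Y v) S T
        sortParts-cost v S T h h≡0 = begin
          cost lt (sortParts v S T >>= h)
            ≡⟨ cost->>= lt (sortParts v S T) h ⟩
          cost lt (sortParts v S T) + outcome lt (sortParts v S T) (λ r → cost lt (h r))
            ≡⟨ cong₂ _+_ (cost->>= lt (on f′ (X l)) (sortRest v S T)) (outcome-always lt (sortParts v S T) (Always-all lt (sortParts v S T) h≡0)) ⟩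
          cost lt (on f′ (X l)) + outcome lt (on f′ (X l)) (λ ys → cost lt (sortRest v S T ys)) + 0ℚ
            ≡⟨ ℚ.+-identityʳ _ ⟩
          cost lt (on f′ (X l)) + outcome lt (on f′ (X l)) (λ ys → cost lt (sortRest v S T ys))
            ≡⟨ cong₂ _+_ (cost-on lt f′ (X l)) (trans
                 (outcome-on lt f′ (X l) (λ ys → cost lt (sortRest v S T ys)))
                 (IsMean.congᴱ (outcome-isMean (lt ⟪ f′ ⟫) (X l)) rest-cost)) ⟩
          partsCost lt v (Y v) S T  ∎
          where
          open ≡-Reasoning
          l = lS v S T
          f′ = f v S T
          rest-cost : ∀ ys → cost lt (sortRest v S T ys) ≡ cost (lt ⟪ g v S T ys ⟫) (Y v T)
          rest-cost ys = begin
            cost lt (sortRest v S T ys)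
              ≡⟨ cost->>= lt (on (g v S T ys) (Y v T)) (λ zs → return (List.map f′ ys , List.map (g v S T ys) zs)) ⟩
            cost lt (on (g v S T ys) (Y v T)) + outcome lt (on (g v S T ys) (Y v T)) (λ _ → 0ℚ)
              ≡⟨ cong₂ _+_ (cost-on lt (g v S T ys) (Y v T)) (IsMean.const (outcome-isMean lt (on (g v S T ys) (Y v T))) 0ℚ) ⟩
            cost (lt ⟪ g v S T ys ⟫) (Y v T) + 0ℚ
              ≡⟨ ℚ.+-identityʳ _ ⟩
            cost (lt ⟪ g v S T ys ⟫) (Y v T)  ∎

        afterPartition-cost : ∀ s p T → let v = partitioned {k} s p T in
          cost lt (afterPartition s p T) ≡ bothPartsCost lt v (Y v)
        afterPartition-cost s p T = branch (XSortsLeft v)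
          (sortParts-cost v T (∁ T) (leftFirst p) (λ _ → refl)) (sortParts-cost v (∁ T) T (rightFirst p) (λ _ → refl))
          where
          v = partitioned s p T
          branch : ∀ b {A B : Algorithm E (List E)} {x y} → cost lt A ≡ x → cost lt B ≡ y →
            cost lt (if b then A else B) ≡ (if b then x else y)
          branch true  q r = q
          branch false q r = r

        afterSampling-cost : ∀ s → cost lt (afterSampling s) ≡ sampledCost lt s
        afterSampling-cost s = begin
          cost lt (on s′ (select k) >>= partitionBy)
            ≡⟨ cost->>= lt (on s′ (select k)) partitionBy ⟩
          cost lt (on s′ (select k)) + outcome lt (on s′ (select k)) (λ j → cost lt (partitionBy j))
            ≡⟨ cong₂ _+_ (cost-on lt s′ (select k)) (outcome-on lt s′ (select k) (λ j → cost lt (partitionBy j))) ⟩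
          cost (lt ⟪ s′ ⟫) (select k) + outcome (lt ⟪ s′ ⟫) (select k) (λ j → cost lt (partitionBy j))
            ≡⟨ cong (_+_ (cost (lt ⟪ s′ ⟫) (select k))) (begin
                 outcome (lt ⟪ s′ ⟫) (select k) (λ j → cost lt (partitionBy j))
                   ≡⟨ congᴱ partitionBy-cost ⟩
                 outcome (lt ⟪ s′ ⟫) (select k) (λ j → fromℕ m + parts j)
                   ≡⟨ +-homo (λ _ → fromℕ m) parts ⟩
                 outcome (lt ⟪ s′ ⟫) (select k) (λ _ → fromℕ m) + outcome (lt ⟪ s′ ⟫) (select k) parts
                   ≡⟨ cong (_+ outcome (lt ⟪ s′ ⟫) (select k) parts) (const (fromℕ m)) ⟩
                 fromℕ m + outcome (lt ⟪ s′ ⟫) (select k) parts  ∎) ⟩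
          sampledCost lt s  ∎
          where
          open ≡-Reasoning
          s′ = Vec.lookup s
          open IsMean (outcome-isMean (lt ⟪ s′ ⟫) (select k))
          partitionBy : Fin k → Algorithm E (List E)
          partitionBy j = compareAllWith (s′ j) (others (s′ j)) >>= afterPartition s (s′ j)
          parts : Fin k → ℚ
          parts j = bothPartsCost lt (partitioned s (s′ j) (belowPivot lt (s′ j))) (Y (partitioned s (s′ j) (belowPivot lt (s′ j))))
          partitionBy-cost : ∀ j → cost lt (partitionBy j) ≡ fromℕ m + parts j
          partitionBy-cost j = begin
            cost lt (partitionBy j)
              ≡⟨ cost->>= lt (compareAllWith (s′ j) (others (s′ j))) (afterPartition s (s′ j)) ⟩
            cost lt (compareAllWith (s′ j) (others (s′ j))) +
              outcome lt (compareAllWith (s′ j) (others (s′ j))) (λ T → cost lt (afterPartition s (s′ j) T))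
              ≡⟨ cong₂ _+_ (compareAllWith-cost lt (s′ j) (others (s′ j)))
                   (trans (compareAllWith-outcome lt (s′ j) (others (s′ j)) (λ T → cost lt (afterPartition s (s′ j) T)))
                     (afterPartition-cost s (s′ j) (belowPivot lt (s′ j)))) ⟩
            fromℕ m + parts j  ∎

        quickXsort-cost : cost lt (quickXsort-acc X I (suc m) (acc rs)) ≡ outcome lt sampling (sampledCost lt)
        quickXsort-cost = begin
          cost lt (sampling >>= afterSampling)
            ≡⟨ cost->>= lt sampling afterSampling ⟩
          cost lt sampling + outcome lt sampling (λ s → cost lt (afterSampling s))
            ≡⟨ cong₂ _+_ (draw-cost (sampleSize≤n (suc m)) (Vec.allFin (suc m)) lt)
                 (IsMean.congᴱ (outcome-isMean lt sampling) afterSampling-cost) ⟩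
          0ℚ + outcome lt sampling (sampledCost lt)
            ≡⟨ ℚ.+-identityˡ _ ⟩
          outcome lt sampling (sampledCost lt)  ∎
          where open ≡-Reasoning

      open IsMean (meanₚ-isMean (suc m))

      -- With sample, pivot and partition fixed, the choice of the part for X and its arrangement
      -- are fixed too, and the arrangement of the rest depends only on the output of X. What
      -- remains random is the order inside the parts, and `mean-parts` applies in either case of
      -- the choice.
      mean-bothParts : ∀ (s : Vec E k) p (w : Permutation′ (suc m) → ℚ) →
        (∀ σ ρ → (∀ x → smaller? σ x p ≡ smaller? ρ x p) → w σ ≡ w ρ) →
        let v = λ (σ : Permutation′ (suc m)) → partitioned s p (belowPivot (smaller? σ) p) in
        meanₚ (suc m) (λ σ → w σ * bothPartsCost (smaller? σ) (v σ) (Y (v σ))) ≡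
        meanₚ (suc m) (λ σ → w σ * averagePartsCost (v σ) (Y (v σ)))
      mean-bothParts s p w w-local = mean-classified (meanₚ-isMean (suc m)) (λ σ → belowPivot (smaller? σ) p)
        (λ T σ → w σ * bothPartsCost (smaller? σ) (v T) (Y (v T))) (λ T σ → w σ * averagePartsCost (v T) (Y (v T)))
        (λ T → trans (congᴱ (λ σ → sym (ℚ.*-assoc (ind (belowPivot (smaller? σ) p ≟ᵛ T)) (w σ) (bothPartsCost (smaller? σ) (v T) (Y (v T))))))
          (trans (either T (XSortsLeft (v T)))
            (congᴱ (λ σ → ℚ.*-assoc (ind (belowPivot (smaller? σ) p ≟ᵛ T)) (w σ) (averagePartsCost (v T) (Y (v T)))))))
        where
        v : Subset m → Partitioned m
        v T = partitioned s p T
        module _ (T : Subset m) where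
          u = conditioned p w w-local T
          parts : Permutation′ (suc m) → Subset m → Subset m → ℚ
          parts σ = partsCost (smaller? σ) (v T) (Y (v T))
          averages : Subset m → Subset m → ℚ
          averages S S′ = averageCost (X (length (positions (v T) S))) + averageCost (Y (v T) S′)
          one-order : ∀ S S′ b b′ → (∀ {a} → a ∈ S → Vec.lookup T a ≡ b) → (∀ {a} → a ∈ S′ → Vec.lookup T a ≡ b′) →
            (∀ {a} → a ∈ S′ → a ∉ S) →
            meanₚ (suc m) (λ σ → u σ * parts σ S S′) ≡ meanₚ (suc m) (λ σ → u σ * averages S S′)
          one-order S S′ b b′ inS inS′ dis = mean-parts
            (List.lookup (positions (v T) S)) (lookup-injective (positions-unique (v T) S))
            (List.lookup (positions (v T) S′)) (lookup-injective (positions-unique (v T) S′))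
            (λ i j → positions-disjoint (v T) S′ S dis j i)
            (X _) (Y (v T) S′) (arrange (v T) _) (λ ys → arrangeRest (v T) ys _)
            u (conditioned-extensional p w w-local T)
            (conditioned-block p w w-local T _ (lookup-injective (positions-unique (v T) S)) b
              (λ i → let a , e , a∈ = positions-block (v T) S i in a , e , inS a∈))
            (conditioned-block p w w-local T _ (lookup-injective (positions-unique (v T) S′)) b′
              (λ i → let a , e , a∈ = positions-block (v T) S′ i in a , e , inS′ a∈))
          in-T : ∀ {a} → a ∈ T → Vec.lookup T a ≡ true
          in-T = Vec.[]=⇒lookup
          in-∁T : ∀ {a} → a ∈ ∁ T → Vec.lookup T a ≡ false
          in-∁T {a} a∈ with Vec.lookup T a in e
          ... | false = refl
          ... | true  = contradiction (Vec.lookup⇒[]= a T e) (Subset.x∈∁p⇒x∉p a∈)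
          either : ∀ b →
            meanₚ (suc m) (λ σ → u σ * (if b then parts σ T (∁ T) else parts σ (∁ T) T)) ≡
            meanₚ (suc m) (λ σ → u σ * (if b then averages T (∁ T) else averages (∁ T) T))
          either true  = one-order T (∁ T) true false in-T in-∁T Subset.x∈∁p⇒x∉p
          either false = one-order (∁ T) T false true in-∁T in-T Subset.x∈p⇒x∉∁p

      module _ (selects : SelectsMedian select) (s : Vec E k) (s-inj : ∀ {i j} → Vec.lookup s i ≡ Vec.lookup s j → i ≡ j) where

        s′ : Fin k → E
        s′ = Vec.lookup s

        mean-select : meanₚ (suc m) (λ σ → cost (smaller? σ ⟪ s′ ⟫) (select k)) ≡ averageCost (select k)
        mean-select = trans (meanₚ-pattern s′ s-inj (λ σ c → cost c (select k)) (λ c σ ρ e → refl)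
          (λ σ e → cost-cong e (select k)) (λ κ σ c → refl)) (const (averageCost (select k)))

        v : Permutation′ (suc m) → Fin k → Partitioned m
        v σ j = partitioned s (s′ j) (belowPivot (smaller? σ) (s′ j))

        selected : (Permutation′ (suc m) → Fin k → ℚ) → ℚ
        selected φ = meanₚ (suc m) (λ σ → outcome (smaller? σ ⟪ s′ ⟫) (select k) (φ σ))

        selected≡ : ∀ φ → selected φ ≡ sum (λ j → meanₚ (suc m) (λ σ → ind (isMedian? s′ σ j) * φ σ j))
        selected≡ φ = trans (congᴱ (λ σ → outcome-median s′ s-inj σ select selects (φ σ)))
          (sum-homo (λ j σ → ind (isMedian? s′ σ j) * φ σ j))

        median-local : ∀ j σ ρ → (∀ x → smaller? σ x (s′ j) ≡ smaller? ρ x (s′ j)) →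
          ind (isMedian? s′ σ j) ≡ ind (isMedian? s′ ρ j)
        median-local j σ ρ h = cong (λ q → ind (q ℚ.≟ fromℕ ℕ.⌊ ℕ.pred k /2⌋))
          (sum-cong-≗ {k} (λ i → cong (λ b → if b then 1ℚ else 0ℚ) (h (s′ i))))

        mean-sampledCost : meanₚ (suc m) (λ σ → sampledCost (smaller? σ) s) ≡
          averageCost (select k) + (fromℕ m + selected (λ σ j → averagePartsCost (v σ j) (Y (v σ j))))
        mean-sampledCost = begin
          meanₚ (suc m) (λ σ → sampledCost (smaller? σ) s)
            ≡⟨ +-homo (λ σ → cost (smaller? σ ⟪ s′ ⟫) (select k))
                (λ σ → fromℕ m + outcome (smaller? σ ⟪ s′ ⟫) (select k) (actual σ)) ⟩
          meanₚ (suc m) (λ σ → cost (smaller? σ ⟪ s′ ⟫) (select k)) +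
            meanₚ (suc m) (λ σ → fromℕ m + outcome (smaller? σ ⟪ s′ ⟫) (select k) (actual σ))
            ≡⟨ cong₂ _+_ mean-select (trans (+-homo (λ _ → fromℕ m) (λ σ → outcome (smaller? σ ⟪ s′ ⟫) (select k) (actual σ)))
                 (cong₂ _+_ (const (fromℕ m)) same)) ⟩
          averageCost (select k) + (fromℕ m + selected (λ σ j → averagePartsCost (v σ j) (Y (v σ j))))  ∎
          where
          open ≡-Reasoning
          actual : Permutation′ (suc m) → Fin k → ℚ
          actual σ j = bothPartsCost (smaller? σ) (v σ j) (Y (v σ j))
          -- Expanding over the candidates fixes the pivot position in each term, as the
          -- conditioning on the partition requires; afterwards the terms are reassembled.
          same : selected actual ≡ selected (λ σ j → averagePartsCost (v σ j) (Y (v σ j)))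
          same = trans (selected≡ actual) (trans
            (sum-cong-≗ {k} (λ j → mean-bothParts s (s′ j) (λ σ → ind (isMedian? s′ σ j)) (median-local j)))
            (sym (selected≡ (λ σ j → averagePartsCost (v σ j) (Y (v σ j))))))

    -- τ bounds the average cost of the recursive calls and G, for a fixed
    -- sample s, the cost of sorting both parts of the input order σ.

    averageCost-quickXsort-≤ : SelectsMedian select → (τ : ℕ → ℚ) →
      (∀ {r} (r< : r ℕ.< suc m) → averageCost (quickXsort-acc X I r (rs r<)) ≤ τ r) →
      (G : (Fin k → Fin (suc m)) → Permutation′ (suc m) → ℚ) →
      (∀ s → (∀ {i j} → s i ≡ s j → i ≡ j) → ∀ σ j → IsMedian s σ j → let ρ = toℕ (σ ⟨$⟩ʳ s j) in
        averageCost (X ρ) + τ (m ℕ.∸ ρ) ≤ G s σ × averageCost (X (m ℕ.∸ ρ)) + τ ρ ≤ G s σ) →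
      ∀ {B} → (∀ s → (∀ {i j} → s i ≡ s j → i ≡ j) → meanₚ (suc m) (G s) ≤ B) →
      averageCost (quickXsort-acc X I (suc m) (acc rs)) ≤ averageCost (select k) + (fromℕ m + B)
    averageCost-quickXsort-≤ selects τ hτ G hG {B} mean-G = begin
      meanₚ (suc m) (λ σ → cost (smaller? σ) (quickXsort-acc X I (suc m) (acc rs)))
        ≡⟨ congᴱ (λ σ → quickXsort-cost (smaller? σ)) ⟩
      meanₚ (suc m) (λ σ → outcome (smaller? σ) sampling (sampledCost (smaller? σ)))
        ≤⟨ draw-mean-≤ (meanₚ-isMean (suc m)) (sampleSize≤n (suc m)) (Vec.allFin (suc m)) smaller? (λ σ → sampledCost (smaller? σ)) per-sample ⟩
      averageCost (select k) + (fromℕ m + B)  ∎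
      where
      open ℚ.≤-Reasoning
      per-sample : ∀ s → SubVector (Vec.allFin (suc m)) s →
        meanₚ (suc m) (λ σ → sampledCost (smaller? σ) s) ≤ averageCost (select k) + (fromℕ m + B)
      per-sample s (e , e-inj , s≡) = begin
        meanₚ (suc m) (λ σ → sampledCost (smaller? σ) s)
          ≡⟨ mean-sampledCost selects s s-inj ⟩
        averageCost (select k) + (fromℕ m + selected selects s s-inj averages)
          ≤⟨ ℚ.+-monoʳ-≤ (averageCost (select k)) (ℚ.+-monoʳ-≤ (fromℕ m)
               (ℚ.≤-trans (mono parts-≤) (mean-G (Vec.lookup s) s-inj))) ⟩
        averageCost (select k) + (fromℕ m + B)  ∎
        where
        s-inj : ∀ {i j} → Vec.lookup s i ≡ Vec.lookup s j → i ≡ j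
        s-inj {i} {j} q = e-inj (trans (sym (Vec.lookup-allFin (e i))) (trans (sym (s≡ i)) (trans q (trans (s≡ j) (Vec.lookup-allFin (e j))))))
        averages : Permutation′ (suc m) → Fin k → ℚ
        averages σ j = averagePartsCost (v selects s s-inj σ j) (Y (v selects s s-inj σ j))
        parts-≤ : ∀ σ → outcome (smaller? σ ⟪ Vec.lookup s ⟫) (select k) (averages σ) ≤ G (Vec.lookup s) σ
        parts-≤ σ = outcome-always-≤ (smaller? σ ⟪ Vec.lookup s ⟫) (select k)
          (Always-map (smaller? σ ⟪ Vec.lookup s ⟫) (select k) (λ j median →
            if-elim (_≤ G (Vec.lookup s) σ) (XSortsLeft (V j))
              (ℚ.≤-trans (ℚ.+-mono-≤ (ℚ.≤-reflexive (cong (averageCost ∘ X) (left≡ j))) (rest j (∁ (smaller (V j))) (right≡ j)))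
                (proj₁ (hG (Vec.lookup s) s-inj σ j median)))
              (ℚ.≤-trans (ℚ.+-mono-≤ (ℚ.≤-reflexive (cong (averageCost ∘ X) (right≡ j))) (rest j (smaller (V j)) (left≡ j)))
                (proj₂ (hG (Vec.lookup s) s-inj σ j median))))
            (always-median (Vec.lookup s) s-inj σ select selects))
          where
          V : Fin k → Partitioned m
          V j = v selects s s-inj σ j
          left≡ : ∀ j → length (left (V j)) ≡ toℕ (σ ⟨$⟩ʳ Vec.lookup s j)
          left≡ j = length-left (V j) σ refl
          right≡ : ∀ j → length (right (V j)) ≡ m ℕ.∸ toℕ (σ ⟨$⟩ʳ Vec.lookup s j)
          right≡ j = trans (sym (ℕ.m+n∸m≡n (length (left (V j))) (length (right (V j)))))
            (cong₂ ℕ._∸_ (length-left+right (V j)) (left≡ j))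
          rest : ∀ j T {r} → length (positions (V j) T) ≡ r → averageCost (Y (V j) T) ≤ τ r
          rest j T refl = hτ (length-positions (V j) T)

    quickXsort-step-sorts : IsSortingAlgorithm X →
      (∀ {r} (r< : r ℕ.< suc m) ρ → Always (smaller? ρ) (SortedAs ρ (List.allFin r)) (quickXsort-acc X I r (rs r<))) →
      ∀ σ → Always (smaller? σ) (SortedAs σ (List.allFin (suc m))) (quickXsort-acc X I (suc m) (acc rs))
    quickXsort-step-sorts X-sorts Y-sorts σ =
      Always->>= lt sampling afterSampling (Always-all lt sampling (λ _ → tt)) λ s _ →
      Always->>= lt (on (Vec.lookup s) (select k)) _ (Always-all lt (on (Vec.lookup s) (select k)) (λ _ → tt)) λ j _ →
      Always->>= lt (compareAllWith (Vec.lookup s j) (others (Vec.lookup s j))) (afterPartition s (Vec.lookup s j))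
        (compareAllWith-always lt (Vec.lookup s j) (others (Vec.lookup s j))) λ T T≡ →
      let v = partitioned s (Vec.lookup s j) T in
      if-elim (Always lt (SortedAs σ (List.allFin (suc m)))) (XSortsLeft v)
        (Always->>= lt (sortParts v T (∁ T)) (leftFirst (pivot v)) (parts-sorted v T (∁ T))
          λ { (ys , zs) (ys-sorted , zs-sorted) → concatenation-sorted v σ T≡ ys-sorted zs-sorted })
        (Always->>= lt (sortParts v (∁ T) T) (rightFirst (pivot v)) (parts-sorted v (∁ T) T)
          λ { (ys , zs) (ys-sorted , zs-sorted) → concatenation-sorted v σ T≡ zs-sorted ys-sorted })
      where
      lt = smaller? σ
      parts-sorted : ∀ v S T → Always lt (λ r → SortedAs σ (positions v S) (proj₁ r) × SortedAs σ (positions v T) (proj₂ r)) (sortParts v S T)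
      parts-sorted v S T =
        Always->>= lt (on (f v S T) (X (lS v S T))) (sortRest v S T)
          (part-sorted σ (positions v S) (positions-unique v S) (arrange v _) (X _)
            (λ ρ → Surely⇒Always ρ (X (lS v S T)) (X-sorts (lS v S T) ρ)))
          λ ys ys-sorted → Always->>= lt (on (g v S T ys) (Y v T)) _
            (part-sorted σ (positions v T) (positions-unique v T) (arrangeRest v ys _) (Y v T) (Y-sorts (length-positions v T)))
            λ zs zs-sorted → ys-sorted , zs-sorted

  quickXsort-acc-sorts : IsSortingAlgorithm X → ∀ n a σ →
    Always (smaller? σ) (SortedAs σ (List.allFin n)) (quickXsort-acc X I n a)
  quickXsort-acc-sorts X-sorts zero    a        σ = ↭-refl , []
  quickXsort-acc-sorts X-sorts (suc m) (acc rs) σ =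
    quickXsort-step-sorts rs X-sorts (λ r< → quickXsort-acc-sorts X-sorts _ (rs r<)) σ

-- ⌊ n log₂ n ⌋

2^⌊log₂n⌋≤n : ∀ n → 1 ℕ.≤ n → 2 ℕ.^ ⌊log₂ n ⌋ ℕ.≤ n
2^⌊log₂n⌋≤n = <-rec _ λ
  { 1 _ _ → ℕ.≤-refl
  ; n@(suc (suc k)) rec _ → begin
      2 ℕ.^ ⌊log₂ n ⌋                     ≡⟨ cong (2 ℕ.^_) (ℕ.m+[n∸m]≡n (⌊log₂⌋-mono-≤ {2} {n} (s≤s (s≤s z≤n)))) ⟨
      2 ℕ.* 2 ℕ.^ (⌊log₂ n ⌋ ℕ.∸ 1)       ≡⟨ cong (λ l → 2 ℕ.* 2 ℕ.^ l) (⌊log₂⌊n/2⌋⌋≡⌊log₂n⌋∸1 n) ⟨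
      2 ℕ.* 2 ℕ.^ ⌊log₂ ℕ.⌊ n /2⌋ ⌋       ≤⟨ ℕ.*-monoʳ-≤ 2 (rec (ℕ.⌊n/2⌋<n (suc k)) (s≤s z≤n)) ⟩
      2 ℕ.* ℕ.⌊ n /2⌋                     ≤⟨ double-half≤ n ⟩
      n                                   ∎ }
  where open ℕ.≤-Reasoning

n<2^[1+⌊log₂n⌋] : ∀ n → n ℕ.< 2 ℕ.^ suc ⌊log₂ n ⌋
n<2^[1+⌊log₂n⌋] n = ℕ.≰⇒> λ h → ℕ.1+n≰n
  (subst (ℕ._≤ ⌊log₂ n ⌋) (⌊log₂[2^n]⌋≡n (suc ⌊log₂ n ⌋)) (⌊log₂⌋-mono-≤ h))

-- The floor is taken only once, of log₂ (nⁿ), so the error is below 1 for every n, and statements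
-- about it become comparisons of natural powers. By 0⁰ = 1 the value at 0 is 0.
⌊nlog₂n⌋ : ℕ → ℕ
⌊nlog₂n⌋ n = ⌊log₂ (n ℕ.^ n) ⌋

0<n^n : ∀ n → 0 ℕ.< n ℕ.^ n
0<n^n zero    = s≤s z≤n
0<n^n (suc n) = ℕ.m^n>0 (suc n) (suc n)

2^⌊nlog₂n⌋≤ : ∀ l r → 2 ℕ.^ (⌊nlog₂n⌋ l ℕ.+ ⌊nlog₂n⌋ r) ℕ.≤ l ℕ.^ l ℕ.* r ℕ.^ r
2^⌊nlog₂n⌋≤ l r = begin
  2 ℕ.^ (⌊nlog₂n⌋ l ℕ.+ ⌊nlog₂n⌋ r)          ≡⟨ ℕ.^-distribˡ-+-* 2 (⌊nlog₂n⌋ l) (⌊nlog₂n⌋ r) ⟩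
  2 ℕ.^ ⌊nlog₂n⌋ l ℕ.* 2 ℕ.^ ⌊nlog₂n⌋ r      ≤⟨ ℕ.*-mono-≤ (2^⌊log₂n⌋≤n _ (0<n^n l)) (2^⌊log₂n⌋≤n _ (0<n^n r)) ⟩
  l ℕ.^ l ℕ.* r ℕ.^ r                        ∎
  where open ℕ.≤-Reasoning

^-distribʳ-* : ∀ o m n → (m ℕ.* n) ℕ.^ o ≡ m ℕ.^ o ℕ.* n ℕ.^ o
^-distribʳ-* zero    m n = refl
^-distribʳ-* (suc o) m n = trans (cong (m ℕ.* n ℕ.*_) (^-distribʳ-* o m n))
  (ℕ.[m*n]*[o*p]≡[m*o]*[n*p] m n (m ℕ.^ o) (n ℕ.^ o))

^-cancel-< : ∀ {m n} → 2 ℕ.^ m ℕ.< 2 ℕ.^ n → m ℕ.< n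
^-cancel-< h = ℕ.≰⇒> λ n≤m → ℕ.<⇒≱ h (ℕ.^-monoʳ-≤ 2 n≤m)

-- From lˡ rʳ ≤ nˡ⁺ʳ ≤ nⁿ. The strict upper bound on nⁿ by the next power of 2 absorbs the rounding,
-- so no additive error appears.
⌊nlog₂n⌋-superadditive : ∀ {l r n} .{{_ : NonZero n}} → l ℕ.+ r ℕ.≤ n → ⌊nlog₂n⌋ l ℕ.+ ⌊nlog₂n⌋ r ℕ.≤ ⌊nlog₂n⌋ n
⌊nlog₂n⌋-superadditive {l} {r} {n} l+r≤n = ℕ.s≤s⁻¹ (^-cancel-< (begin-strict
  2 ℕ.^ (⌊nlog₂n⌋ l ℕ.+ ⌊nlog₂n⌋ r)   ≤⟨ 2^⌊nlog₂n⌋≤ l r ⟩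
  l ℕ.^ l ℕ.* r ℕ.^ r
    ≤⟨ ℕ.*-mono-≤ (ℕ.^-monoˡ-≤ l (ℕ.m+n≤o⇒m≤o l l+r≤n)) (ℕ.^-monoˡ-≤ r (ℕ.m+n≤o⇒n≤o l l+r≤n)) ⟩
  n ℕ.^ l ℕ.* n ℕ.^ r                 ≡⟨ ℕ.^-distribˡ-+-* n l r ⟨
  n ℕ.^ (l ℕ.+ r)                     ≤⟨ ℕ.^-monoʳ-≤ n l+r≤n ⟩
  n ℕ.^ n                             <⟨ n<2^[1+⌊log₂n⌋] (n ℕ.^ n) ⟩
  2 ℕ.^ suc (⌊nlog₂n⌋ n)              ∎))
  where open ℕ.≤-Reasoning

-- (1 − 1/(c + 1))ᵏ ≥ 1 − k/(c + 1), cleared of denominators.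

bernoulli : ∀ c k d → d ℕ.+ k ≡ suc c → suc c ℕ.^ k ℕ.* d ℕ.≤ c ℕ.^ k ℕ.* suc c
bernoulli c zero    d e = ℕ.≤-reflexive (cong (1 ℕ.*_) (trans (sym (ℕ.+-identityʳ d)) e))
bernoulli c (suc k) d e = begin
  suc c ℕ.* A ℕ.* d        ≡⟨ solve 3 (λ c A d → (con 1 :+ c) :* A :* d := A :* (c :* d :+ d)) refl c A d ⟩
  A ℕ.* (c ℕ.* d ℕ.+ d)    ≤⟨ ℕ.*-monoʳ-≤ A (ℕ.+-monoʳ-≤ (c ℕ.* d) d≤c) ⟩
  A ℕ.* (c ℕ.* d ℕ.+ c)    ≡⟨ solve 3 (λ c A d → A :* (c :* d :+ c) := c :* (A :* (con 1 :+ d))) refl c A d ⟩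
  c ℕ.* (A ℕ.* suc d)      ≤⟨ ℕ.*-monoʳ-≤ c (bernoulli c k (suc d) e′) ⟩
  c ℕ.* (B ℕ.* suc c)      ≡⟨ ℕ.*-assoc c B (suc c) ⟨
  c ℕ.* B ℕ.* suc c        ∎
  where
  open ℕ.≤-Reasoning
  open Data.Nat.Solver.+-*-Solver
  A = suc c ℕ.^ k
  B = c ℕ.^ k
  e′ : suc d ℕ.+ k ≡ suc c
  e′ = trans (sym (ℕ.+-suc d k)) e
  d≤c : d ℕ.≤ c
  d≤c = ℕ.s≤s⁻¹ (ℕ.m+n≤o⇒m≤o (suc d) (ℕ.≤-reflexive e′))

module _ (M′ : ℕ) where

  private
    M a : ℕ
    M = suc M′
    a = suc (2 ℕ.* M′)

  -- Here a = 2M - 1. Bernoulli with exponent M gives (1 - 1/(2M))^M ≥ 1/2, that is, 2 a^M ≥ (2M)^M.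
  -- In logarithms: log (a/M) ≥ 1 - 1/M.
  2^M′*M^M≤ : 2 ℕ.^ M′ ℕ.* M ℕ.^ M ℕ.≤ a ℕ.^ M
  2^M′*M^M≤ = ℕ.*-cancelˡ-≤ (2 ℕ.* M) (begin
    2 ℕ.* M ℕ.* (2 ℕ.^ M′ ℕ.* M ℕ.^ M)
      ≡⟨ solve 3 (λ x y z → con 2 :* x :* (y :* z) := (con 2 :* y) :* z :* x) refl M (2 ℕ.^ M′) (M ℕ.^ M) ⟩
    2 ℕ.^ M ℕ.* M ℕ.^ M ℕ.* M       ≡⟨ cong (ℕ._* M) (^-distribʳ-* M 2 M) ⟨
    (2 ℕ.* M) ℕ.^ M ℕ.* M           ≡⟨ cong (λ z → z ℕ.^ M ℕ.* M) 2M≡ ⟩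
    suc a ℕ.^ M ℕ.* M               ≤⟨ bernoulli a M M (solve 1 (λ m → (con 1 :+ m) :+ (con 1 :+ m) := con 1 :+ (con 1 :+ con 2 :* m)) refl M′) ⟩
    a ℕ.^ M ℕ.* suc a               ≡⟨ ℕ.*-comm (a ℕ.^ M) (suc a) ⟩
    suc a ℕ.* a ℕ.^ M               ≡⟨ cong (ℕ._* a ℕ.^ M) 2M≡ ⟨
    2 ℕ.* M ℕ.* a ℕ.^ M             ∎)
    where
    open ℕ.≤-Reasoning
    open Data.Nat.Solver.+-*-Solver
    2M≡ : 2 ℕ.* M ≡ suc a
    2M≡ = solve 1 (λ m → con 2 :* (con 1 :+ m) := con 1 :+ (con 1 :+ con 2 :* m)) refl M′

  -- Both parts have length at most n M / (2 M − 1), which makes their total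
  -- entropy at least 1 − 1/M bits per element.

  ⌊nlog₂n⌋-balanced : ∀ {l r n} .{{_ : NonZero n}} → l ℕ.+ r ℕ.≤ n → a ℕ.* l ℕ.≤ n ℕ.* M → a ℕ.* r ℕ.≤ n ℕ.* M →
    M ℕ.* (⌊nlog₂n⌋ l ℕ.+ ⌊nlog₂n⌋ r) ℕ.+ M′ ℕ.* (l ℕ.+ r) ℕ.≤ M ℕ.* suc (⌊nlog₂n⌋ n)
  ⌊nlog₂n⌋-balanced {l} {r} {n} l+r≤n al≤ ar≤ = ℕ.<⇒≤ (^-cancel-< (begin-strict
    2 ℕ.^ (M ℕ.* K ℕ.+ M′ ℕ.* s)              ≡⟨ ℕ.^-distribˡ-+-* 2 (M ℕ.* K) (M′ ℕ.* s) ⟩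
    2 ℕ.^ (M ℕ.* K) ℕ.* 2 ℕ.^ (M′ ℕ.* s)
      ≡⟨ cong₂ ℕ._*_ (trans (cong (2 ℕ.^_) (ℕ.*-comm M K)) (sym (ℕ.^-*-assoc 2 K M))) (sym (ℕ.^-*-assoc 2 M′ s)) ⟩
    (2 ℕ.^ K) ℕ.^ M ℕ.* (2 ℕ.^ M′) ℕ.^ s      ≤⟨ ℕ.*-monoˡ-≤ ((2 ℕ.^ M′) ℕ.^ s) (ℕ.^-monoˡ-≤ M (2^⌊nlog₂n⌋≤ l r)) ⟩
    -- The factor M^(M s) is multiplied in so that 2^M′ M^M can be replaced by a^M. The balance
    -- hypotheses then bound P aˢ by (n M)ˢ, and the factor cancels.
    P ℕ.^ M ℕ.* (2 ℕ.^ M′) ℕ.^ s              ≤⟨ ℕ.*-cancelʳ-≤ _ _ (M ℕ.^ (M ℕ.* s)) {{ℕ.m^n≢0 M (M ℕ.* s)}} main ⟩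
    n ℕ.^ (s ℕ.* M)                           ≤⟨ ℕ.^-monoʳ-≤ n (ℕ.*-monoˡ-≤ M l+r≤n) ⟩
    n ℕ.^ (n ℕ.* M)                           ≡⟨ ℕ.^-*-assoc n n M ⟨
    (n ℕ.^ n) ℕ.^ M                           <⟨ ℕ.^-monoˡ-< M (n<2^[1+⌊log₂n⌋] (n ℕ.^ n)) ⟩
    (2 ℕ.^ suc (⌊nlog₂n⌋ n)) ℕ.^ M            ≡⟨ ℕ.^-*-assoc 2 (suc (⌊nlog₂n⌋ n)) M ⟩
    2 ℕ.^ (suc (⌊nlog₂n⌋ n) ℕ.* M)            ≡⟨ cong (2 ℕ.^_) (ℕ.*-comm (suc (⌊nlog₂n⌋ n)) M) ⟩
    2 ℕ.^ (M ℕ.* suc (⌊nlog₂n⌋ n))            ∎))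
    where
    open ℕ.≤-Reasoning
    open Data.Nat.Solver.+-*-Solver
    s = l ℕ.+ r
    K = ⌊nlog₂n⌋ l ℕ.+ ⌊nlog₂n⌋ r
    P = l ℕ.^ l ℕ.* r ℕ.^ r
    scaled : P ℕ.* a ℕ.^ s ℕ.≤ (n ℕ.* M) ℕ.^ s
    scaled = begin
      P ℕ.* a ℕ.^ s                                  ≡⟨ cong (P ℕ.*_) (ℕ.^-distribˡ-+-* a l r) ⟩
      P ℕ.* (a ℕ.^ l ℕ.* a ℕ.^ r)
        ≡⟨ solve 4 (λ w x y z → w :* x :* (y :* z) := y :* w :* (z :* x)) refl (l ℕ.^ l) (r ℕ.^ r) (a ℕ.^ l) (a ℕ.^ r) ⟩
      a ℕ.^ l ℕ.* l ℕ.^ l ℕ.* (a ℕ.^ r ℕ.* r ℕ.^ r)  ≡⟨ cong₂ ℕ._*_ (^-distribʳ-* l a l) (^-distribʳ-* r a r) ⟨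
      (a ℕ.* l) ℕ.^ l ℕ.* (a ℕ.* r) ℕ.^ r            ≤⟨ ℕ.*-mono-≤ (ℕ.^-monoˡ-≤ l al≤) (ℕ.^-monoˡ-≤ r ar≤) ⟩
      (n ℕ.* M) ℕ.^ l ℕ.* (n ℕ.* M) ℕ.^ r            ≡⟨ ℕ.^-distribˡ-+-* (n ℕ.* M) l r ⟨
      (n ℕ.* M) ℕ.^ s                                ∎
    main : P ℕ.^ M ℕ.* (2 ℕ.^ M′) ℕ.^ s ℕ.* M ℕ.^ (M ℕ.* s) ℕ.≤ n ℕ.^ (s ℕ.* M) ℕ.* M ℕ.^ (M ℕ.* s)
    main = begin
      P ℕ.^ M ℕ.* (2 ℕ.^ M′) ℕ.^ s ℕ.* M ℕ.^ (M ℕ.* s)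
        ≡⟨ trans (ℕ.*-assoc (P ℕ.^ M) ((2 ℕ.^ M′) ℕ.^ s) (M ℕ.^ (M ℕ.* s)))
             (cong (λ z → P ℕ.^ M ℕ.* ((2 ℕ.^ M′) ℕ.^ s ℕ.* z)) (sym (ℕ.^-*-assoc M M s))) ⟩
      P ℕ.^ M ℕ.* ((2 ℕ.^ M′) ℕ.^ s ℕ.* (M ℕ.^ M) ℕ.^ s)
        ≡⟨ cong (P ℕ.^ M ℕ.*_) (^-distribʳ-* s (2 ℕ.^ M′) (M ℕ.^ M)) ⟨
      P ℕ.^ M ℕ.* (2 ℕ.^ M′ ℕ.* M ℕ.^ M) ℕ.^ s   ≤⟨ ℕ.*-monoʳ-≤ (P ℕ.^ M) (ℕ.^-monoˡ-≤ s 2^M′*M^M≤) ⟩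
      P ℕ.^ M ℕ.* (a ℕ.^ M) ℕ.^ s
        ≡⟨ cong (P ℕ.^ M ℕ.*_) (trans (ℕ.^-*-assoc a M s) (trans (cong (a ℕ.^_) (ℕ.*-comm M s)) (sym (ℕ.^-*-assoc a s M)))) ⟩
      P ℕ.^ M ℕ.* (a ℕ.^ s) ℕ.^ M                ≡⟨ ^-distribʳ-* M P (a ℕ.^ s) ⟨
      (P ℕ.* a ℕ.^ s) ℕ.^ M                      ≤⟨ ℕ.^-monoˡ-≤ M scaled ⟩
      ((n ℕ.* M) ℕ.^ s) ℕ.^ M                    ≡⟨ ℕ.^-*-assoc (n ℕ.* M) s M ⟩
      (n ℕ.* M) ℕ.^ (s ℕ.* M)                    ≡⟨ ^-distribʳ-* (s ℕ.* M) n M ⟩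
      n ℕ.^ (s ℕ.* M) ℕ.* M ℕ.^ (s ℕ.* M)        ≡⟨ cong (λ z → n ℕ.^ (s ℕ.* M) ℕ.* M ℕ.^ z) (ℕ.*-comm s M) ⟩
      n ℕ.^ (s ℕ.* M) ℕ.* M ℕ.^ (M ℕ.* s)        ∎

-- Cost of an even and of an uneven split

-- An even split saves almost one comparison per element, which pays for
-- partitioning; an uneven one may not, but is rare.

module _ (M′ : ℕ) (18≤M : 18 ℕ.≤ suc M′) where

  private
    M a : ℕ
    M = suc M′
    a = suc (2 ℕ.* M′)
    e : ℚ
    e = 1/suc M′
    K = fromℕ M
    0≤e : 0ℚ ≤ e
    0≤e = 0≤1/suc M′
    eK≡1 : e * K ≡ 1ℚ
    eK≡1 = trans (ℚ.*-comm e K) (suc*1/suc M′)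

  e≤1∕18 : fromℕ 18 * e ≤ 1ℚ
  e≤1∕18 = subst₂ _≤_ (ℚ.*-comm e (fromℕ 18)) eK≡1 (*-mono-≤ e 0≤e (fromℕ-mono-≤ 18≤M))

  -- M / (2M - 1) ≤ 2/3, because 3M ≤ 2 (2M - 1). A factor below 1 is what lets the error term
  -- contract along the recursion.
  3r≤2n : ∀ {r n} → a ℕ.* r ℕ.≤ n ℕ.* M → 3 ℕ.* r ℕ.≤ 2 ℕ.* n
  3r≤2n {r} {n} ar≤nM = ℕ.*-cancelˡ-≤ a (begin
    a ℕ.* (3 ℕ.* r)      ≡⟨ solve 2 (λ a r → a :* (con 3 :* r) := con 3 :* (a :* r)) refl a r ⟩
    3 ℕ.* (a ℕ.* r)      ≤⟨ ℕ.*-monoʳ-≤ 3 ar≤nM ⟩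
    3 ℕ.* (n ℕ.* M)      ≡⟨ solve 2 (λ n m → con 3 :* (n :* (con 1 :+ m)) := n :* (con 3 :* m :+ con 3)) refl n M′ ⟩
    n ℕ.* (3 ℕ.* M′ ℕ.+ 3)   ≤⟨ ℕ.*-monoʳ-≤ n (ℕ.≤-trans (ℕ.+-monoʳ-≤ (3 ℕ.* M′) (s≤s (s≤s (ℕ.≤-trans (s≤s z≤n) (ℕ.s≤s⁻¹ 18≤M)))))
                              (ℕ.≤-reflexive (solve 1 (λ m → con 3 :* m :+ (con 2 :+ m) := con 2 :* (con 1 :+ con 2 :* m)) refl M′))) ⟩
    n ℕ.* (2 ℕ.* a)      ≡⟨ solve 2 (λ n a → n :* (con 2 :* a) := a :* (con 2 :* n)) refl n a ⟩
    a ℕ.* (2 ℕ.* n)      ∎)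
    where
    open ℕ.≤-Reasoning
    open Data.Nat.Solver.+-*-Solver

  module _ {l r m} (l+r≡m : l ℕ.+ r ≡ m) where

    private
      n = suc m
      x = fromℕ (⌊nlog₂n⌋ l) + fromℕ (⌊nlog₂n⌋ r)
      y = fromℕ (⌊nlog₂n⌋ n)
      m′ = fromℕ m
      n′ = fromℕ n
      r′ = fromℕ r
      l+r≤n : l ℕ.+ r ℕ.≤ n
      l+r≤n = ℕ.≤-trans (ℕ.≤-reflexive l+r≡m) (ℕ.n≤1+n m)

    -- The 13 is 12 + 1: 18 e r ≤ 12 e n for the recursive error, and e n for the 1/M bit per
    -- element by which the entropy falls short. The 1 is the rounding of ⌊n log n⌋.
    even-split : a ℕ.* l ℕ.≤ n ℕ.* M → a ℕ.* r ℕ.≤ n ℕ.* M →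
      x + m′ + fromℕ 18 * (e * r′) ≤ y + 1ℚ + fromℕ 13 * (e * n′)
    even-split al≤ ar≤ = ≤-from (ℚ.+-mono-≤ (ℚ.+-mono-≤ entropy rest) em≤en)
      (solve 6 (λ x m e r y n →
        x :+ m :+ con (fromℕ 18) :* (e :* r) :+ ((y :+ con 1ℚ) :+ (e :* con (fromℕ 6)) :* (con (fromℕ 2) :* n) :+ e :* n) :=
        y :+ con 1ℚ :+ con (fromℕ 13) :* (e :* n) :+ ((x :+ m :+ (:- (e :* m))) :+ (e :* con (fromℕ 6)) :* (con (fromℕ 3) :* r) :+ e :* m))
        refl x m′ e r′ y n′)
      where
      open +-*-Solver
      scaled : K * x + (K - 1ℚ) * m′ ≤ K * (1ℚ + y)
      scaled = subst₂ _≤_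
        (trans (fromℕ-+ (M ℕ.* (⌊nlog₂n⌋ l ℕ.+ ⌊nlog₂n⌋ r)) (M′ ℕ.* (l ℕ.+ r))) (cong₂ _+_
          (trans (fromℕ-* M (⌊nlog₂n⌋ l ℕ.+ ⌊nlog₂n⌋ r)) (cong (K *_) (fromℕ-+ (⌊nlog₂n⌋ l) (⌊nlog₂n⌋ r))))
          (trans (fromℕ-* M′ (l ℕ.+ r)) (cong₂ _*_ M′≡ (cong fromℕ l+r≡m)))))
        (trans (fromℕ-* M (suc (⌊nlog₂n⌋ n))) (cong (K *_) (fromℕ-+ 1 (⌊nlog₂n⌋ n))))
        (fromℕ-mono-≤ (⌊nlog₂n⌋-balanced M′ {l} {r} {n} l+r≤n al≤ ar≤))
        where
        M′≡ : fromℕ M′ ≡ K - 1ℚ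
        M′≡ = trans (solve 1 (λ z → z := con 1ℚ :+ z :+ (:- con 1ℚ)) refl (fromℕ M′)) (cong (_- 1ℚ) (sym (fromℕ-+ 1 M′)))
      entropy : x + m′ - e * m′ ≤ y + 1ℚ
      entropy = subst₂ _≤_
        (trans (solve 4 (λ e K x m → e :* (K :* x :+ (K :+ (:- con 1ℚ)) :* m) := (e :* K) :* (x :+ m) :+ (:- (e :* m))) refl e K x m′)
          (trans (cong (λ z → z * (x + m′) - e * m′) eK≡1) (cong (_- e * m′) (ℚ.*-identityˡ (x + m′)))))
        (trans (solve 3 (λ e K y → e :* (K :* (con 1ℚ :+ y)) := (e :* K) :* (y :+ con 1ℚ)) refl e K y)
          (trans (cong (_* (y + 1ℚ)) eK≡1) (ℚ.*-identityˡ (y + 1ℚ))))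
        (*-mono-≤ e 0≤e scaled)
      rest : (e * fromℕ 6) * (fromℕ 3 * r′) ≤ (e * fromℕ 6) * (fromℕ 2 * n′)
      rest = *-mono-≤ (e * fromℕ 6) (*-nonNeg 0≤e (0≤fromℕ 6))
        (subst₂ _≤_ (fromℕ-* 3 r) (fromℕ-* 2 n) (fromℕ-mono-≤ (3r≤2n {r} {n} ar≤)))
      em≤en : e * m′ ≤ e * n′
      em≤en = *-mono-≤ e 0≤e (fromℕ-mono-≤ (ℕ.n≤1+n m))

    -- Without any entropy gain, one n covers the m comparisons of partitioning, and the other the
    -- recursive error 18 e r, since 18 e ≤ 1.
    uneven-split : x + m′ + fromℕ 18 * (e * r′) ≤ y + n′ + n′
    uneven-split = ℚ.+-mono-≤ (ℚ.+-mono-≤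
      (subst (_≤ y) (fromℕ-+ (⌊nlog₂n⌋ l) (⌊nlog₂n⌋ r)) (fromℕ-mono-≤ (⌊nlog₂n⌋-superadditive {l} {r} {n} l+r≤n)))
      (fromℕ-mono-≤ (ℕ.n≤1+n m)))
      (subst (_≤ n′) (ℚ.*-assoc (fromℕ 18) e r′) (ℚ.≤-trans
        (subst₂ _≤_ (ℚ.*-comm r′ (fromℕ 18 * e)) (ℚ.*-identityʳ r′) (*-mono-≤ r′ (0≤fromℕ r) e≤1∕18))
        (fromℕ-mono-≤ (ℕ.m+n≤o⇒n≤o l l+r≤n))))

  -- One more than ⌊n M / a⌋, so that the ranks below it are exactly those ρ with a ρ ≤ n M.
  threshold : ℕ → ℕ
  threshold n = suc (n ℕ.* M / a)

  threshold-≤ : ∀ m → threshold (suc m) ℕ.≤ suc m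
  threshold-≤ m = m<n*o⇒m/o<n {n = n} (ℕ.*-monoʳ-< n {M} {a} (s≤s (begin
    suc M′             ≡⟨ ℕ.+-comm 1 M′ ⟩
    M′ ℕ.+ 1           ≤⟨ ℕ.+-monoʳ-≤ M′ (ℕ.≤-trans (s≤s z≤n) (ℕ.s≤s⁻¹ 18≤M)) ⟩
    M′ ℕ.+ M′          ≡⟨ cong (M′ ℕ.+_) (ℕ.+-identityʳ M′) ⟨
    2 ℕ.* M′           ∎)))
    where
    open ℕ.≤-Reasoning
    n = suc m

  -- Since 2M = a + 1, the left side is 2 n M, and a times the threshold exceeds n M.
  threshold-gap : ∀ n → n ℕ.+ a ℕ.* n ℕ.≤ a ℕ.* (2 ℕ.* threshold n)
  threshold-gap n = begin
    n ℕ.+ a ℕ.* n                   ≡⟨ solve 2 (λ n m → n :+ (con 1 :+ con 2 :* m) :* n := con 2 :* (n :* (con 1 :+ m))) refl n M′ ⟩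
    2 ℕ.* (n ℕ.* M)                 ≤⟨ ℕ.*-monoʳ-≤ 2 below ⟩
    2 ℕ.* (threshold n ℕ.* a)       ≡⟨ solve 2 (λ t a → con 2 :* (t :* a) := a :* (con 2 :* t)) refl (threshold n) a ⟩
    a ℕ.* (2 ℕ.* threshold n)       ∎
    where
    below : n ℕ.* M ℕ.≤ threshold n ℕ.* a
    below = ℕ.≤-trans (ℕ.≤-reflexive (m≡m%n+[m/n]*n (n ℕ.* M) a))
      (ℕ.+-monoˡ-≤ (n ℕ.* M / a ℕ.* a) (ℕ.<⇒≤ (m%n<n (n ℕ.* M) a)))
    open ℕ.≤-Reasoning
    open Data.Nat.Solver.+-*-Solver

  below-threshold : ∀ {n ρ} → ρ ℕ.< threshold n → a ℕ.* ρ ℕ.≤ n ℕ.* M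
  below-threshold {n} {ρ} (s≤s ρ≤) = ℕ.≤-trans (ℕ.≤-reflexive (ℕ.*-comm a ρ))
    (ℕ.≤-trans (ℕ.*-monoˡ-≤ a ρ≤) (m/n*n≤m (n ℕ.* M) a))

  -- With n = m + 1, a rank ρ ≥ n ∸ t leaves fewer than t elements above the pivot. The cutoffs t
  -- and n ∸ t therefore control the two parts symmetrically.
  balanced? : ∀ {m ρ} → ρ ℕ.≤ m → let n = suc m in
    (a ℕ.* ρ ℕ.≤ n ℕ.* M × a ℕ.* (m ℕ.∸ ρ) ℕ.≤ n ℕ.* M) ⊎ (threshold n ℕ.≤ ρ ⊎ ρ ℕ.< n ℕ.∸ threshold n)
  balanced? {m} {ρ} ρ≤m with threshold (suc m) ℕ.≤? ρ
  ... | yes t≤ρ = inj₂ (inj₁ t≤ρ)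
  ... | no t≰ρ with ρ ℕ.<? suc m ℕ.∸ threshold (suc m)
  ...   | yes ρ<u = inj₂ (inj₂ ρ<u)
  ...   | no ρ≮u  = inj₁ (below-threshold {suc m} (ℕ.≰⇒> t≰ρ) , below-threshold {suc m} (begin
    suc (m ℕ.∸ ρ)      ≡⟨ ℕ.+-∸-assoc 1 ρ≤m ⟨
    suc m ℕ.∸ ρ        ≤⟨ ℕ.∸-monoʳ-≤ (suc m) (ℕ.≮⇒≥ ρ≮u) ⟩
    suc m ℕ.∸ (suc m ℕ.∸ t) ≤⟨ ℕ.m≤n+o⇒m∸n≤o (suc m) (suc m ℕ.∸ t) (ℕ.≤-reflexive (sym (ℕ.m∸n+n≡m (threshold-≤ m)))) ⟩
    t                  ∎))
    where
    open ℕ.≤-Reasoning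
    t = threshold (suc m)

  -- The coefficient makes unevenness at least 1 at every uneven split.

  unevenness : ∀ {k n} → (Fin (suc k) → Fin (suc n)) → Permutation′ (suc n) → ℚ
  unevenness {k} {n} s σ =
    square (1/suc k * 1/suc n) * (square (fromℕ a) * fromℕ 4) * deviation s (threshold (suc n)) σ

  module _ {k n} (s : Fin (suc k) → Fin (suc n)) where

    private
      κ = square (1/suc k * 1/suc n)
      A = square (fromℕ a) * fromℕ 4
      0≤A : 0ℚ ≤ A
      0≤A = *-nonNeg (square-nonNeg (fromℕ a)) (0≤fromℕ 4)
      0≤κ : 0ℚ ≤ κ
      0≤κ = square-nonNeg (1/suc k * 1/suc n)
      κ-inverse : κ * square (fromℕ (suc k) * fromℕ (suc n)) ≡ 1ℚ
      κ-inverse = trans (solve 4 (λ x u y v → (x :* u) :* (x :* u) :* ((y :* v) :* (y :* v)) := (y :* x) :* (v :* u) :* ((y :* x) :* (v :* u)))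
          refl (1/suc k) (1/suc n) (fromℕ (suc k)) (fromℕ (suc n)))
        (cong square (cong₂ _*_ (suc*1/suc k) (suc*1/suc n)))
        where open +-*-Solver

    0≤unevenness : ∀ σ → 0ℚ ≤ unevenness s σ
    0≤unevenness σ = *-nonNeg (*-nonNeg 0≤κ 0≤A) (0≤deviation s (threshold (suc n)) σ)

    1≤unevenness : ∀ σ j → IsMedian s σ j → let ρ = toℕ (σ ⟨$⟩ʳ s j) in
      threshold (suc n) ℕ.≤ ρ ⊎ ρ ℕ.< suc n ℕ.∸ threshold (suc n) → 1ℚ ≤ unevenness s σ
    1≤unevenness σ j median uneven = subst₂ _≤_ κ-inverse (sym (ℚ.*-assoc κ A (deviation s (threshold (suc n)) σ)))
      (*-mono-≤ κ 0≤κ (deviation-unbalanced s σ j median a (threshold (suc n)) (threshold-≤ n) (threshold-gap (suc n)) uneven))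

    -- Chebyshev: for a sample of size K each sample sum has second moment at most K n², while the
    -- coefficient divides by K² n². For fixed M this leaves a multiple of 1/K.
    mean-unevenness : (∀ {i j} → s i ≡ s j → i ≡ j) → meanₚ (suc n) (unevenness s) ≤ fromℕ 2 * A * 1/suc k
    mean-unevenness s-inj = begin
      meanₚ (suc n) (unevenness s)
        ≡⟨ IsMean.*-homo (meanₚ-isMean (suc n)) (κ * A) (deviation s (threshold (suc n))) ⟩
      κ * A * meanₚ (suc n) (deviation s (threshold (suc n)))
        ≤⟨ *-mono-≤ (κ * A) (*-nonNeg 0≤κ 0≤A) (mean-deviation s s-inj (threshold-≤ n)) ⟩
      κ * A * (k′ * (n′ * n′) + k′ * (n′ * n′))
        ≡⟨ solve 5 (λ x u A k n → (x :* u) :* (x :* u) :* A :* (k :* (n :* n) :+ k :* (n :* n)) :=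
             con (fromℕ 2) :* A :* x :* ((k :* x) :* ((n :* u) :* (n :* u)))) refl (1/suc k) (1/suc n) A k′ n′ ⟩
      fromℕ 2 * A * 1/suc k * ((k′ * 1/suc k) * square (n′ * 1/suc n))
        ≡⟨ cong (fromℕ 2 * A * 1/suc k *_) (cong₂ (λ p q → p * square q) (suc*1/suc k) (suc*1/suc n)) ⟩
      fromℕ 2 * A * 1/suc k * 1ℚ
        ≡⟨ ℚ.*-identityʳ (fromℕ 2 * A * 1/suc k) ⟩
      fromℕ 2 * A * 1/suc k  ∎
      where
      open ℚ.≤-Reasoning
      open +-*-Solver
      k′ = fromℕ (suc k)
      n′ = fromℕ (suc n)

-- Absorbing finitely many values into a constant

p≤∣p∣ : ∀ p → p ≤ ∣ p ∣
p≤∣p∣ p with ℚ.≤-total 0ℚ p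
... | inj₁ 0≤p = ℚ.≤-reflexive (sym (ℚ.0≤p⇒∣p∣≡p 0≤p))
... | inj₂ p≤0 = ℚ.≤-trans p≤0 (ℚ.0≤∣p∣ p)

-- Each exceptional argument adds the absolute difference there to `D`. Bounds for large n thus
-- become bounds for all n, which the parts of arbitrary length require.
eventually-≤ : ∀ {f g : ℕ → ℚ} N → (∀ n → N ℕ.≤ n → f n ≤ g n) → ∃[ D ] 0ℚ ≤ D × (∀ n → f n ≤ g n + D)
eventually-≤ {f} {g} zero    h = 0ℚ , ℚ.≤-refl , λ n → ℚ.≤-trans (h n z≤n) (ℚ.≤-reflexive (sym (ℚ.+-identityʳ (g n))))
eventually-≤ {f} {g} (suc N) h = D + d , +-nonNeg 0≤D 0≤d , bound
  where
  rest = eventually-≤ {f ∘ suc} {g ∘ suc} N (λ n N≤n → h (suc n) (s≤s N≤n))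
  D = proj₁ rest
  0≤D = proj₁ (proj₂ rest)
  d = ∣ f 0 - g 0 ∣
  0≤d = ℚ.0≤∣p∣ (f 0 - g 0)
  open +-*-Solver
  bound : ∀ n → f n ≤ g n + (D + d)
  bound zero    = ≤-from (ℚ.+-mono-≤ (p≤∣p∣ (f 0 - g 0)) 0≤D)
    (solve 4 (λ f g D d → f :+ (d :+ D) := (g :+ (D :+ d)) :+ ((f :+ (:- g)) :+ con 0ℚ)) refl (f 0) (g 0) D d)
  bound (suc n) = ≤-from (ℚ.+-mono-≤ (proj₂ (proj₂ rest) n) 0≤d)
    (solve 4 (λ f g D d → f :+ ((g :+ D) :+ d) := (g :+ (D :+ d)) :+ (f :+ con 0ℚ)) refl (f (suc n)) (g (suc n)) D d)

finitely-bounded : ∀ (f : ℕ → ℚ) N → ∃[ B ] 0ℚ ≤ B × (∀ n → n ℕ.< N → f n ≤ B)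
finitely-bounded f zero    = 0ℚ , ℚ.≤-refl , λ n ()
finitely-bounded f (suc N) = B + ∣ f N ∣ , +-nonNeg 0≤B (ℚ.0≤∣p∣ (f N)) , λ n n<1+N → below n (ℕ.m≤n⇒m<n∨m≡n (ℕ.s≤s⁻¹ n<1+N))
  where
  rest = finitely-bounded f N
  B = proj₁ rest
  0≤B = proj₁ (proj₂ rest)
  open +-*-Solver
  below : ∀ n → n ℕ.< N ⊎ n ≡ N → f n ≤ B + ∣ f N ∣
  below n (inj₁ n<N) = ≤-from (ℚ.+-mono-≤ (proj₂ (proj₂ rest) n n<N) (ℚ.0≤∣p∣ (f N)))
    (solve 3 (λ f B c → f :+ (B :+ c) := (B :+ c) :+ (f :+ con 0ℚ)) refl (f n) B ∣ f N ∣)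
  below n (inj₂ refl) = ≤-from (ℚ.+-mono-≤ (p≤∣p∣ (f N)) 0≤B)
    (solve 3 (λ f B c → f :+ (c :+ B) := (B :+ c) :+ (f :+ con 0ℚ)) refl (f N) B ∣ f N ∣)

-- The inductive step of the cost bound

module _ (M′ : ℕ) (18≤M : 18 ℕ.≤ suc M′) where

  private
    e : ℚ
    e = 1/suc M′
    0≤e : 0ℚ ≤ e
    0≤e = 0≤1/suc M′
    A : ℚ
    A = square (fromℕ (suc (2 ℕ.* M′))) * fromℕ 4

    Uneven : ∀ m → ℕ → Set
    Uneven m ρ = threshold M′ 18≤M (suc m) ℕ.≤ ρ ⊎ ρ ℕ.< suc m ℕ.∸ threshold M′ 18≤M (suc m)

    -- Sample sizes are given as nonzero numbers, while `unevenness` is indexed by a predecessor.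
    -- The match on `k` is made once and its consequences are packaged.
    uneven : ∀ k .{{_ : NonZero k}} m → Σ[ U ∈ ((Fin k → Fin (suc m)) → Permutation′ (suc m) → ℚ) ]
      (∀ s σ → 0ℚ ≤ U s σ) ×
      (∀ s σ j → IsMedian s σ j → Uneven m (toℕ (σ ⟨$⟩ʳ s j)) → 1ℚ ≤ U s σ) ×
      (∀ s → (∀ {i j} → s i ≡ s j → i ≡ j) → meanₚ (suc m) (U s) ≤ fromℕ 2 * A * 1/suc (ℕ.pred k))
    uneven (suc k) m = unevenness M′ 18≤M , 0≤unevenness M′ 18≤M , 1≤unevenness M′ 18≤M , mean-unevenness M′ 18≤M

  module _ (X : SortingProcedure) (I : Implementation) (selects : SelectsMedian (Implementation.select I))
           (q D₀ : ℚ) where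

    open Implementation I

    -- Here `c` is the coefficient of the error e n; the linear constant of X is represented by its
    -- rational approximation `q`.
    bound : ℚ → ℚ → ℕ → ℚ
    bound c D n = fromℕ (⌊nlog₂n⌋ n) + q * fromℕ n + c * (e * fromℕ n) + D

    module _ (X≤ : ∀ l → averageCost (X l) ≤ bound (fromℕ 2) D₀ l) where

      private
        -- The bookkeeping from 15 to 18: one e n each for rare uneven splits, for selecting the
        -- pivot, and for the constants 1 + `D₀` - `q`, where - `q` stems from `q` m = `q` n - `q`.
        -- The m of partitioning cancels against the entropy gain.
        step-identity : ∀ T S m n e q D₀ D y → n ≡ 1ℚ + m →
          T + (S + (m + (y + 1ℚ + fromℕ 15 * (e * n) + q * m + D₀ + D - m + e * n)) + e * n + e * n) ≡
          y + q * n + fromℕ 18 * (e * n) + D + (T + S + (1ℚ + D₀ - q))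
        step-identity T S m _ e q D₀ D y refl = solve 8 (λ T S m e q D₀ D y → let n = con 1ℚ :+ m in
          T :+ (S :+ (m :+ (y :+ con 1ℚ :+ con (fromℕ 15) :* (e :* n) :+ q :* m :+ D₀ :+ D :+ (:- m) :+ e :* n)) :+ e :* n :+ e :* n) :=
          y :+ q :* n :+ con (fromℕ 18) :* (e :* n) :+ D :+ (T :+ S :+ (con 1ℚ :+ D₀ :+ (:- q)))) refl T S m e q D₀ D y
          where open +-*-Solver

        parts-identity : ∀ x x₁ x₂ ql qr qm el er m en D₀ D y w → qm ≡ ql + qr →
          x + (x₂ + qr + er + D) + (x₁ + ql + el + D₀ + (y + 1ℚ + fromℕ 13 * en + w) + fromℕ 2 * en) ≡
          y + 1ℚ + fromℕ 15 * en + qm + D₀ + D - m + w + (x + (x₁ + x₂ + m + er) + el)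
        parts-identity x x₁ x₂ ql qr _ el er m en D₀ D y w refl = solve 13 (λ x x₁ x₂ ql qr el er m en D₀ D y w →
          x :+ (x₂ :+ qr :+ er :+ D) :+
            (x₁ :+ ql :+ el :+ D₀ :+ (y :+ con 1ℚ :+ con (fromℕ 13) :* en :+ w) :+ con (fromℕ 2) :* en) :=
          y :+ con 1ℚ :+ con (fromℕ 15) :* en :+ (ql :+ qr) :+ D₀ :+ D :+ (:- m) :+ w :+
            (x :+ (x₁ :+ x₂ :+ m :+ er) :+ el)) refl x x₁ x₂ ql qr el er m en D₀ D y w
          where open +-*-Solver

      -- The same `D` appears before and after because just one part is handled recursively; the
      -- constant `D₀` of the other part goes into the slack e n. Hence the depth of the recursion
      -- never accumulates constants.
      quickXsort-induction : ∀ {m} (rs : ∀ {r} → r ℕ.< suc m → Acc ℕ._<_ r) → let n = suc m ; k = sampleSize n in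
        averageCost (select k {{sampleSize≢0 n}}) ≤ e * fromℕ n →
        fromℕ 2 * (fromℕ 2 * A * 1/suc (ℕ.pred k)) ≤ e →
        1ℚ + D₀ - q ≤ e * fromℕ n →
        ∀ {D} → (∀ {r} (r< : r ℕ.< n) → averageCost (quickXsort-acc X I r (rs r<)) ≤ bound (fromℕ 18) D r) →
        averageCost (quickXsort-acc X I n (acc rs)) ≤ bound (fromℕ 18) D n
      quickXsort-induction {m} rs sel≤ U≤ const≤ {D} T≤ = ≤-from
        (ℚ.+-mono-≤ (ℚ.+-mono-≤ (averageCost-quickXsort-≤ X I rs selects (bound (fromℕ 18) D) T≤ G hG {B} mean-G) sel≤) const≤)
        (step-identity T S m′ n′ e q D₀ D y (fromℕ-+ 1 m))
        where
        n = suc m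
        k = sampleSize n
        instance
          k≢0 : NonZero k
          k≢0 = sampleSize≢0 n
        m′ = fromℕ m
        n′ = fromℕ n
        y = fromℕ (⌊nlog₂n⌋ n)
        S = averageCost (select k)
        T = averageCost (quickXsort-acc X I n (acc rs))
        base = y + 1ℚ + fromℕ 15 * (e * n′) + q * m′ + D₀ + D - m′
        B = base + e * n′
        U = proj₁ (uneven k m)
        0≤U = proj₁ (proj₂ (uneven k m))
        1≤U = proj₁ (proj₂ (proj₂ (uneven k m)))
        mean-U = proj₂ (proj₂ (proj₂ (uneven k m)))
        0≤2n : 0ℚ ≤ n′ + n′
        0≤2n = +-nonNeg (0≤fromℕ n) (0≤fromℕ n)
        G : (Fin k → Fin n) → Permutation′ n → ℚ
        -- An uneven split exceeds the even bound by at most 2n, and there `U` is at least 1;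
        -- elsewhere `U` is nonnegative. One function thus bounds both cases and has a small mean.
        G s σ = base + (n′ + n′) * U s σ

        parts-≤ : ∀ l r → l ℕ.+ r ≡ m → ∀ w →
          fromℕ (⌊nlog₂n⌋ l) + fromℕ (⌊nlog₂n⌋ r) + m′ + fromℕ 18 * (e * fromℕ r) ≤ y + 1ℚ + fromℕ 13 * (e * n′) + w →
          averageCost (X l) + bound (fromℕ 18) D r ≤ base + w
        parts-≤ l r l+r≡m w split = ≤-from (ℚ.+-mono-≤ (ℚ.+-mono-≤ (X≤ l) split)
            (*-mono-≤ (fromℕ 2) (0≤fromℕ 2) (*-mono-≤ e 0≤e (fromℕ-mono-≤
              (ℕ.≤-trans (ℕ.m+n≤o⇒m≤o l (ℕ.≤-reflexive l+r≡m)) (ℕ.n≤1+n m))))))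
          (parts-identity (averageCost (X l)) (fromℕ (⌊nlog₂n⌋ l)) (fromℕ (⌊nlog₂n⌋ r)) (q * fromℕ l) (q * fromℕ r) (q * m′)
            (fromℕ 2 * (e * fromℕ l)) (fromℕ 18 * (e * fromℕ r)) m′ (e * n′) D₀ D y w
            (trans (cong (q *_) (trans (cong fromℕ (sym l+r≡m)) (fromℕ-+ l r))) (ℚ.*-distribˡ-+ q (fromℕ l) (fromℕ r))))

        even-≤ : ∀ l r {u} → 0ℚ ≤ u → (l+r≡m : l ℕ.+ r ≡ m) →
          suc (2 ℕ.* M′) ℕ.* l ℕ.≤ n ℕ.* suc M′ → suc (2 ℕ.* M′) ℕ.* r ℕ.≤ n ℕ.* suc M′ →
          averageCost (X l) + bound (fromℕ 18) D r ≤ base + (n′ + n′) * u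
        even-≤ l r {u} 0≤u l+r≡m al≤ ar≤ = parts-≤ l r l+r≡m ((n′ + n′) * u)
          (ℚ.≤-trans (ℚ.≤-reflexive (sym (ℚ.+-identityʳ _)))
            (ℚ.+-mono-≤ (even-split M′ 18≤M {l} {r} l+r≡m al≤ ar≤) (*-nonNeg 0≤2n 0≤u)))

        uneven-≤ : ∀ l r {u} → 1ℚ ≤ u → (l+r≡m : l ℕ.+ r ≡ m) →
          averageCost (X l) + bound (fromℕ 18) D r ≤ base + (n′ + n′) * u
        uneven-≤ l r {u} 1≤u l+r≡m = parts-≤ l r l+r≡m ((n′ + n′) * u)
          (≤-from (ℚ.+-mono-≤ (ℚ.+-mono-≤ (uneven-split M′ 18≤M {l} {r} l+r≡m) (*-mono-≤ (n′ + n′) 0≤2n 1≤u))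
              (+-nonNeg 0≤1 (*-nonNeg (0≤fromℕ 13) (*-nonNeg 0≤e (0≤fromℕ n)))))
            (solve 5 (λ x y n w d → x :+ (y :+ n :+ n :+ w :+ (con 1ℚ :+ d)) := (y :+ con 1ℚ :+ d :+ w) :+ (x :+ (n :+ n) :* con 1ℚ :+ con 0ℚ))
              refl (fromℕ (⌊nlog₂n⌋ l) + fromℕ (⌊nlog₂n⌋ r) + m′ + fromℕ 18 * (e * fromℕ r)) y n′ ((n′ + n′) * u) (fromℕ 13 * (e * n′))))
          where open +-*-Solver

        hG : ∀ s → (∀ {i j} → s i ≡ s j → i ≡ j) → ∀ σ j → IsMedian s σ j → let ρ = toℕ (σ ⟨$⟩ʳ s j) in
          averageCost (X ρ) + bound (fromℕ 18) D (m ℕ.∸ ρ) ≤ G s σ ×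
          averageCost (X (m ℕ.∸ ρ)) + bound (fromℕ 18) D ρ ≤ G s σ
        hG s s-inj σ j median = by-balance (balanced? M′ 18≤M ρ≤m)
          where
          ρ = toℕ (σ ⟨$⟩ʳ s j)
          ρ≤m : ρ ℕ.≤ m
          ρ≤m = ℕ.s≤s⁻¹ (Fin.toℕ<n (σ ⟨$⟩ʳ s j))
          by-balance :
            (suc (2 ℕ.* M′) ℕ.* ρ ℕ.≤ n ℕ.* suc M′ × suc (2 ℕ.* M′) ℕ.* (m ℕ.∸ ρ) ℕ.≤ n ℕ.* suc M′) ⊎ Uneven m ρ →
            averageCost (X ρ) + bound (fromℕ 18) D (m ℕ.∸ ρ) ≤ G s σ ×
            averageCost (X (m ℕ.∸ ρ)) + bound (fromℕ 18) D ρ ≤ G s σ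
          by-balance (inj₁ (aρ≤ , am∸ρ≤)) =
            even-≤ ρ (m ℕ.∸ ρ) (0≤U s σ) (ℕ.m+[n∸m]≡n ρ≤m) aρ≤ am∸ρ≤ , even-≤ (m ℕ.∸ ρ) ρ (0≤U s σ) (ℕ.m∸n+n≡m ρ≤m) am∸ρ≤ aρ≤
          by-balance (inj₂ out) =
            uneven-≤ ρ (m ℕ.∸ ρ) (1≤U s σ j median out) (ℕ.m+[n∸m]≡n ρ≤m) , uneven-≤ (m ℕ.∸ ρ) ρ (1≤U s σ j median out) (ℕ.m∸n+n≡m ρ≤m)

        mean-G : ∀ s → (∀ {i j} → s i ≡ s j → i ≡ j) → meanₚ n (G s) ≤ B
        mean-G s s-inj = begin
          meanₚ n (G s)
            ≡⟨ +-homo (λ _ → base) (λ σ → (n′ + n′) * U s σ) ⟩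
          meanₚ n (λ _ → base) + meanₚ n (λ σ → (n′ + n′) * U s σ)
            ≡⟨ cong₂ _+_ (const base) (*-homo (n′ + n′) (U s)) ⟩
          base + (n′ + n′) * meanₚ n (U s)
            ≤⟨ ℚ.+-monoʳ-≤ base (*-mono-≤ (n′ + n′) 0≤2n (mean-U s s-inj)) ⟩
          base + (n′ + n′) * V
            ≡⟨ cong (_+_ base) (solve 2 (λ n V → (n :+ n) :* V := n :* (con (fromℕ 2) :* V)) refl n′ V) ⟩
          base + n′ * (fromℕ 2 * V)
            ≤⟨ ℚ.+-monoʳ-≤ base (*-mono-≤ n′ (0≤fromℕ n) U≤) ⟩
          base + n′ * e
            ≡⟨ cong (_+_ base) (ℚ.*-comm n′ e) ⟩
          base + e * n′  ∎
          where
          open ℚ.≤-Reasoning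
          open +-*-Solver
          open IsMean (meanₚ-isMean n)
          V = fromℕ 2 * A * 1/suc (ℕ.pred k)

-- Rational bounds for the asymptotic statements

n*1/suc≤1 : ∀ {n j} → n ℕ.≤ suc j → fromℕ n * 1/suc j ≤ 1ℚ
n*1/suc≤1 {n} {j} n≤ = subst₂ _≤_ (ℚ.*-comm (1/suc j) (fromℕ n)) (trans (ℚ.*-comm (1/suc j) (fromℕ (suc j))) (suc*1/suc j))
  (*-mono-≤ (1/suc j) (0≤1/suc j) (fromℕ-mono-≤ n≤))

seq-approx : ∀ (x : ℝ) n i j → fromℕ n * seq x i ≤ fromℕ n * seq x j + (fromℕ n * 1/suc i + fromℕ n * 1/suc j)
seq-approx x n i j = ℚ.≤-trans (*-mono-≤ (fromℕ n) (0≤fromℕ n) (regular x i j))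
  (ℚ.≤-reflexive (solve 4 (λ n x u v → n :* (x :+ (u :+ v)) := n :* x :+ (n :* u :+ n :* v))
    refl (fromℕ n) (seq x j) (1/suc i) (1/suc j)))
  where open +-*-Solver

-- At an index i with n ≤ i + 1 the regularity error 1/(i+1), multiplied by n, is at most 1. There
-- are two such indices.
seq-close : ∀ (x : ℝ) {n i j} → n ℕ.≤ suc i → n ℕ.≤ suc j → fromℕ n * seq x i ≤ fromℕ n * seq x j + fromℕ 2
seq-close x {n} {i} {j} n≤i n≤j = ℚ.≤-trans (seq-approx x n i j)
  (ℚ.+-monoʳ-≤ (fromℕ n * seq x j) (ℚ.+-mono-≤ (n*1/suc≤1 n≤i) (n*1/suc≤1 n≤j)))

-- The approximation of log₂ n at index n - 1 has denominator n and numerator ⌊log₂ (nⁿ)⌋, which is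
-- where the integer version of n log n comes from.
nlog₂n-seq : ∀ m → fromℕ (suc m) * seq (log₂ (suc m)) m ≡ fromℕ (⌊nlog₂n⌋ (suc m))
nlog₂n-seq m = /-*-cancel (ℤ.+ ⌊nlog₂n⌋ (suc m)) (suc m)

nlog₂n-upper : ∀ m {j} → suc m ℕ.≤ suc j → fromℕ (suc m) * seq (log₂ (suc m)) j ≤ fromℕ (⌊nlog₂n⌋ (suc m)) + fromℕ 2
nlog₂n-upper m {j} n≤j = subst (λ z → fromℕ (suc m) * seq (log₂ (suc m)) j ≤ z + fromℕ 2) (nlog₂n-seq m)
  (seq-close (log₂ (suc m)) {suc m} {j} {m} n≤j ℕ.≤-refl)

nlog₂n-lower : ∀ m {j} → suc m ℕ.≤ suc j → fromℕ (⌊nlog₂n⌋ (suc m)) ≤ fromℕ (suc m) * seq (log₂ (suc m)) j + fromℕ 2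
nlog₂n-lower m {j} n≤j = subst (_≤ fromℕ (suc m) * seq (log₂ (suc m)) j + fromℕ 2) (nlog₂n-seq m)
  (seq-close (log₂ (suc m)) {suc m} {m} {j} ℕ.≤-refl n≤j)

boundAt : ℝ → ℕ → ℚ → ℚ → ℕ → ℚ
boundAt c M′ a D n = fromℕ (⌊nlog₂n⌋ n) + seq c M′ * fromℕ n + a * (1/suc M′ * fromℕ n) + D

module _ (c : ℝ) (f : ℕ → ℚ) where

  -- The coefficient 2 counts e n for replacing `c` by its approximation at `M′` and e n for the
  -- remainder o(n). The 5 is 2 for the comparison of reals at index 0, 2 for the logarithm, and 1
  -- for the approximation of `c` at index j.
  AtMost⇒boundAt : AtMost-nlog[n]+ c n+o[n] f → ∀ M′ → ∃[ D ] 0ℚ ≤ D × (∀ n → f n ≤ boundAt c M′ (fromℕ 2) D n)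
  AtMost⇒boundAt (r , r-small , f≤) M′ = D , 0≤D , bounded
    where
    e = 1/suc M′
    small = r-small e (0<1/suc M′)
    large : ∀ n → suc (proj₁ small) ℕ.≤ n → f n ≤ boundAt c M′ (fromℕ 2) (fromℕ 5) n
    large (suc m) N<n = ≤-from
      (ℚ.+-mono-≤ (ℚ.+-mono-≤ (ℚ.+-mono-≤ (ℚ.+-mono-≤ (f≤ n 0) (nlog₂n-upper m {j} n≤j))
        (seq-approx c n j M′)) (n*1/suc≤1 n≤j)) (ℚ.≤-trans (p≤∣p∣ (r n)) (proj₂ small n (ℕ.<⇒≤ N<n))))
      (solve 9 (λ f l d q e n ν L ρ →
        f :+ (l :+ d :+ ρ :+ con (fromℕ 2) :+ (L :+ con (fromℕ 2)) :+ (n :* q :+ (ν :+ n :* e)) :+ con 1ℚ :+ e :* n) :=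
        L :+ q :* n :+ con (fromℕ 2) :* (e :* n) :+ con (fromℕ 5) :+ (f :+ l :+ d :+ ν :+ ρ))
        refl (f n) (fromℕ n * seq (log₂ n) j) (fromℕ n * seq c j) (seq c M′) e (fromℕ n) (fromℕ n * 1/suc j) (fromℕ (⌊nlog₂n⌋ n)) (r n))
      where
      open +-*-Solver
      n = suc m
      -- The index reached from 0: the two additions of reals send 0 to 1 and 1 to 3, and the
      -- multiple by n sends 3 to 4n.
      j = n ℕ.* 4
      n≤j : n ℕ.≤ suc j
      n≤j = ℕ.m≤n⇒m≤1+n (ℕ.m≤m*n n 4)
    finite = eventually-≤ {f} {boundAt c M′ (fromℕ 2) (fromℕ 5)} (suc (proj₁ small)) large
    D = fromℕ 5 + proj₁ finite
    0≤D = +-nonNeg (0≤fromℕ 5) (proj₁ (proj₂ finite))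
    bounded : ∀ n → f n ≤ boundAt c M′ (fromℕ 2) D n
    bounded n = ℚ.≤-trans (proj₂ (proj₂ finite) n)
      (ℚ.≤-reflexive (ℚ.+-assoc (fromℕ (⌊nlog₂n⌋ n) + seq c M′ * fromℕ n + fromℕ 2 * (1/suc M′ * fromℕ n)) (fromℕ 5) (proj₁ finite)))

  -- One remainder has to serve every ε, whereas `D` varies with `M′`. So `r` is defined from `f`
  -- alone, and the bound at a suitable `M′` enters only in showing that `r` is small.
  boundAt⇒AtMost : (∀ M′ → 18 ℕ.≤ suc M′ → ∃[ D ] ∀ n → f n ≤ boundAt c M′ (fromℕ 18) D n) → AtMost-nlog[n]+ c n+o[n] f
  boundAt⇒AtMost f≤ = r , r-small , below
    where
    excess : ℕ → ℚ
    excess n = f n - (fromℕ (⌊nlog₂n⌋ n) + fromℕ n * seq c n)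
    r : ℕ → ℚ
    -- The maximum with 0 dispenses with a lower bound on `f`. The 4 pays for two real
    -- approximations, of n log n and of c n, at 2 each.
    r n = excess n ℚ.⊔ 0ℚ + fromℕ 4
    0≤r : ∀ n → 0ℚ ≤ r n
    0≤r n = +-nonNeg (ℚ.p≤q⊔p (excess n) 0ℚ) (0≤fromℕ 4)

    r-small : IsLittleO[n] r
    r-small ε 0<ε = proj₁ absorb , λ n N≤n → begin
      ∣ r n ∣                                         ≡⟨ ℚ.0≤p⇒∣p∣≡p (0≤r n) ⟩
      excess n ℚ.⊔ 0ℚ + fromℕ 4                       ≤⟨ ℚ.+-monoˡ-≤ (fromℕ 4) (ℚ.⊔-lub (excess-≤ n)
                                                          (+-nonNeg (*-nonNeg (0≤fromℕ 19) (*-nonNeg 0≤e (0≤fromℕ n))) (+-nonNeg (ℚ.0≤∣p∣ D) 0≤1))) ⟩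
      fromℕ 19 * (e * fromℕ n) + (∣ D ∣ + 1ℚ) + fromℕ 4
        ≡⟨ solve 2 (λ en d → con (fromℕ 19) :* en :+ (d :+ con 1ℚ) :+ con (fromℕ 4) := con (fromℕ 19) :* en :+ (d :+ con (fromℕ 5)))
             refl (e * fromℕ n) ∣ D ∣ ⟩
      fromℕ 19 * (e * fromℕ n) + (∣ D ∣ + fromℕ 5)    ≤⟨ ℚ.+-monoʳ-≤ (fromℕ 19 * (e * fromℕ n)) (proj₂ absorb n N≤n) ⟩
      fromℕ 19 * (e * fromℕ n) + e * fromℕ n
        ≡⟨ solve 2 (λ e n → con (fromℕ 19) :* (e :* n) :+ e :* n := n :* (con (fromℕ 20) :* e)) refl e (fromℕ n) ⟩
      fromℕ n * (fromℕ 20 * e)                        ≤⟨ *-mono-≤ (fromℕ n) (0≤fromℕ n) 20e≤ε′ ⟩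
      fromℕ n * ε                                     ≡⟨ ℚ.*-comm (fromℕ n) ε ⟩
      ε * fromℕ n                                     ∎
      where
      open ℚ.≤-Reasoning
      open +-*-Solver
      ε/20 = ε * 1/suc 19
      0<ε/20 : 0ℚ < ε/20
      0<ε/20 = ℚ.positive⁻¹ ε/20 {{ℚ.pos*pos⇒pos ε {{ℚ.positive 0<ε}} (1/suc 19)}}
      tiny = eventually-small ε/20 0<ε/20
      -- The 17 ensures 18 ≤ `suc M′`. The 20 is 18 from the bound, 1 for exchanging approximations
      -- of `c`, and 1 to absorb the constants.
      M′ = proj₁ tiny ℕ.+ 17
      e = 1/suc M′
      0≤e : 0ℚ ≤ e
      0≤e = 0≤1/suc M′
      20e≤ε′ : fromℕ 20 * e ≤ ε
      20e≤ε′ = ℚ.≤-trans (*-mono-≤ (fromℕ 20) (0≤fromℕ 20) (proj₂ tiny M′ (ℕ.m≤m+n (proj₁ tiny) 17)))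
        (ℚ.≤-reflexive (solve 1 (λ ε → con (fromℕ 20) :* (ε :* con (1/suc 19)) := ε) refl ε))
      D = proj₁ (f≤ M′ (s≤s (ℕ.m≤n+m 17 (proj₁ tiny))))
      absorb = archimedean-ε e (0<1/suc M′) (∣ D ∣ + fromℕ 5)
      excess-≤ : ∀ n → excess n ≤ fromℕ 19 * (e * fromℕ n) + (∣ D ∣ + 1ℚ)
      excess-≤ n = ≤-from
        (ℚ.+-mono-≤ (ℚ.+-mono-≤ (ℚ.+-mono-≤ (proj₂ (f≤ M′ (s≤s (ℕ.m≤n+m 17 (proj₁ tiny)))) n) (seq-approx c n M′ n)) (p≤∣p∣ D)) (n*1/suc≤1 {n} {n} (ℕ.n≤1+n n)))
        (solve 9 (λ f L q n e D a ν d →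
          f :+ (:- (L :+ a)) :+ (L :+ q :* n :+ con (fromℕ 18) :* (e :* n) :+ D :+ (a :+ (n :* e :+ ν)) :+ d :+ con 1ℚ) :=
          con (fromℕ 19) :* (e :* n) :+ (d :+ con 1ℚ) :+ (f :+ n :* q :+ D :+ ν))
          refl (f n) (fromℕ (⌊nlog₂n⌋ n)) (seq c M′) (fromℕ n) e D (fromℕ n * seq c n) (fromℕ n * 1/suc n) ∣ D ∣)

    below : ∀ n .{{_ : NonZero n}} → toℝ (f n) ≤ᵣ n · log₂ n +ᵣ n · c +ᵣ toℝ (r n)
    below n@(suc m) k = ≤-from
      (ℚ.+-mono-≤ (ℚ.+-mono-≤ (ℚ.+-mono-≤ (ℚ.p≤p⊔q (excess n) 0ℚ) (nlog₂n-lower m {j} n≤j))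
        (seq-close c {n} {n} {j} (ℕ.n≤1+n n) n≤j)) (+-nonNeg (0≤1/suc k) (0≤1/suc k)))
      (solve 7 (λ f L a l d x z →
        f :+ (x :+ (l :+ con (fromℕ 2)) :+ (d :+ con (fromℕ 2)) :+ z) :=
        l :+ d :+ (x :+ con (fromℕ 4)) :+ z :+ (f :+ (:- (L :+ a)) :+ L :+ a :+ con 0ℚ))
        refl (f n) (fromℕ (⌊nlog₂n⌋ n)) (fromℕ n * seq c n) (fromℕ n * seq (log₂ n) j) (fromℕ n * seq c j) (excess n ℚ.⊔ 0ℚ) (1/suc k + 1/suc k))
      where
      open +-*-Solver
      K = k ℕ.+ suc k
      j = n ℕ.* suc (K ℕ.+ suc K)
      n≤j : n ℕ.≤ suc j
      n≤j = ℕ.m≤n⇒m≤1+n (ℕ.m≤m*n n (suc (K ℕ.+ suc K)))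

-- Sample sizes

sample-large : ∀ {k} → IsΘ[√n] k → ∀ K → ∃[ N ] ∀ n → N ℕ.≤ n → K ℕ.≤ k n
sample-large {k} (a , b , N , Θ) K = N ℕ.+ suc ((a ℕ.* K) ℕ.^ 2) , λ n N≤n → ℕ.≮⇒≥ λ kn<K → ℕ.1+n≰n (begin
  suc ((a ℕ.* K) ℕ.^ 2)              ≤⟨ ℕ.m≤n+m _ N ⟩
  N ℕ.+ suc ((a ℕ.* K) ℕ.^ 2)        ≤⟨ N≤n ⟩
  n                                  ≤⟨ proj₁ (Θ n (ℕ.m+n≤o⇒m≤o N N≤n)) ⟩
  (a ℕ.* k n) ℕ.^ 2                  ≤⟨ ℕ.^-monoˡ-≤ 2 (ℕ.*-monoʳ-≤ a (ℕ.<⇒≤ kn<K)) ⟩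
  (a ℕ.* K) ℕ.^ 2                    ∎)
  where open ℕ.≤-Reasoning

selection-cheap : ∀ {select k} → IsSubquadratic select → IsΘ[√n] k → ∀ ε → 0ℚ < ε →
  ∃[ N ] ∀ n .{{_ : NonZero (k n)}} → N ℕ.≤ n → averageCost (select (k n)) ≤ ε * fromℕ n
selection-cheap {select} {k} subquadratic Θ@(a , b , N , bounds) ε 0<ε =
  N ℕ.+ proj₁ large , λ n N≤n → begin
    averageCost (select (k n))           ≡⟨ averageComparisons≡averageCost (select (k n)) ⟨
    averageComparisons (select (k n))    ≤⟨ proj₂ cheap (k n) (proj₂ large n (ℕ.m+n≤o⇒n≤o N N≤n)) ⟩
    ε′ * fromℕ (k n ℕ.^ 2)               ≤⟨ *-mono-≤ ε′ (ℚ.<⇒≤ 0<ε′) (fromℕ-mono-≤ (proj₂ (bounds n (ℕ.m+n≤o⇒m≤o N N≤n)))) ⟩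
    ε′ * fromℕ (B ℕ.* n)                 ≡⟨ cong (ε′ *_) (fromℕ-* B n) ⟩
    ε′ * (fromℕ B * fromℕ n)
      ≡⟨ solve 4 (λ ε u B n → ε :* u :* (B :* n) := ε :* n :* (B :* u)) refl ε (1/suc B) (fromℕ B) (fromℕ n) ⟩
    ε * fromℕ n * (fromℕ B * 1/suc B)    ≤⟨ *-mono-≤ (ε * fromℕ n) (*-nonNeg (ℚ.<⇒≤ 0<ε) (0≤fromℕ n)) (n*1/suc≤1 (ℕ.n≤1+n B)) ⟩
    ε * fromℕ n * 1ℚ                     ≡⟨ ℚ.*-identityʳ (ε * fromℕ n) ⟩
    ε * fromℕ n                          ∎
  where
  open ℚ.≤-Reasoning
  open +-*-Solver
  B = b ℕ.^ 2
  -- Division is by `B` + 1 because `b` may be 0; the sample size squared is at most `B` n.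
  ε′ = ε * 1/suc B
  0<ε′ : 0ℚ < ε′
  0<ε′ = ℚ.positive⁻¹ ε′ {{ℚ.pos*pos⇒pos ε {{ℚ.positive 0<ε}} (1/suc B) {{ℚ.normalize-pos 1 (suc B)}}}}
  cheap = subquadratic ε′ 0<ε′
  large = sample-large Θ (proj₁ cheap)

-- Initial lengths and the induction on the length

module _ (X : SortingProcedure) (I : Implementation) (selects : SelectsMedian (Implementation.select I)) where

  open Implementation I

  private
    Bounded : ℕ → Set
    Bounded N = ∃[ U ] 0ℚ ≤ U × (∀ n → n ℕ.< N → ∀ a → averageCost (quickXsort-acc X I n a) ≤ U)

  -- The asymptotic hypotheses say nothing about small lengths, so the recurrence is used there with
  -- constant bounds for X and for the recursive calls. `Bounded` ranges over all accessibility
  -- proofs because the recursive calls carry their own.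
  quickXsort-finite-step : ∀ m → Bounded (suc m) → Bounded (suc (suc m))
  quickXsort-finite-step m smaller-n = U + V , +-nonNeg 0≤U 0≤V , λ n n<2+m a → below n (ℕ.m≤n⇒m<n∨m≡n (ℕ.s≤s⁻¹ n<2+m)) a
    where
    U = proj₁ smaller-n
    0≤U = proj₁ (proj₂ smaller-n)
    costsX = finitely-bounded (λ l → averageCost (X l)) (suc m)
    B = proj₁ costsX
    0≤B = proj₁ (proj₂ costsX)
    k = sampleSize (suc m)
    S = averageCost (select k {{sampleSize≢0 (suc m)}})
    V = ∣ S ∣ + (fromℕ m + (B + U))
    0≤V : 0ℚ ≤ V
    0≤V = +-nonNeg (ℚ.0≤∣p∣ S) (+-nonNeg (0≤fromℕ m) (+-nonNeg 0≤B 0≤U))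
    open +-*-Solver
    below : ∀ n → n ℕ.< suc m ⊎ n ≡ suc m → ∀ a → averageCost (quickXsort-acc X I n a) ≤ U + V
    below n (inj₁ n<1+m) a = ℚ.≤-trans (ℚ.≤-reflexive (sym (ℚ.+-identityʳ _)))
      (ℚ.+-mono-≤ (proj₂ (proj₂ smaller-n) n n<1+m a) 0≤V)
    below _ (inj₂ refl) (acc rs) = ≤-from
      (ℚ.+-mono-≤ (ℚ.+-mono-≤ (averageCost-quickXsort-≤ X I rs selects (λ _ → U)
          (λ r< → proj₂ (proj₂ smaller-n) _ r< (rs r<)) (λ _ _ → B + U)
          (λ s _ σ j _ → ℚ.+-monoˡ-≤ U (proj₂ (proj₂ costsX) _ (Fin.toℕ<n (σ ⟨$⟩ʳ s j))) ,
            ℚ.+-monoˡ-≤ U (proj₂ (proj₂ costsX) _ (s≤s (ℕ.m∸n≤m m (toℕ (σ ⟨$⟩ʳ s j))))))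
          {B + U} (λ _ _ → ℚ.≤-reflexive (IsMean.const (meanₚ-isMean (suc m)) (B + U))))
        (p≤∣p∣ S)) 0≤U)
      (solve 5 (λ t S a W U → t :+ (S :+ W :+ a :+ U) := U :+ (a :+ W) :+ (t :+ S :+ con 0ℚ))
        refl (averageCost (quickXsort-acc X I (suc m) (acc rs))) S ∣ S ∣ (fromℕ m + (B + U)) U)

  quickXsort-finite : ∀ N → Bounded N
  quickXsort-finite zero          = 0ℚ , ℚ.≤-refl , λ n ()
  quickXsort-finite (suc zero)    = 0ℚ , ℚ.≤-refl , λ { zero _ _ → ℚ.≤-refl ; (suc n) (s≤s ()) _ }
  quickXsort-finite (suc (suc m)) = quickXsort-finite-step m (quickXsort-finite (suc m))

  module _ (c : ℝ) (X-fast : AtMost-nlog[n]+ c n+o[n] (λ n → averageComparisons (X n)))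
           (Θ : IsΘ[√n] sampleSize) (subquadratic : IsSubquadratic select) (M′ : ℕ) (18≤M : 18 ℕ.≤ suc M′) where

    private
      e q : ℚ
      e = 1/suc M′
      q = seq c M′

      X-bound = AtMost⇒boundAt c (λ n → averageComparisons (X n)) X-fast M′
      D₀ = proj₁ X-bound

      X≤ : ∀ l → averageCost (X l) ≤ boundAt c M′ (fromℕ 2) D₀ l
      X≤ l = subst (_≤ boundAt c M′ (fromℕ 2) D₀ l) (averageComparisons≡averageCost (X l)) (proj₂ (proj₂ X-bound) l)

      -- The penalty 2n times a mean unevenness of at most 2A/k gives 4A n / k, with A = 4 a² and k
      -- the sample size. Large samples push this below e n.
      C = fromℕ 4 * (square (fromℕ (suc (2 ℕ.* M′))) * fromℕ 4)
      rare = archimedean-ε e (0<1/suc M′) C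
      big-sample = sample-large Θ (suc (proj₁ rare))
      cheap = selection-cheap {select} subquadratic Θ e (0<1/suc M′)
      absorbed = archimedean-ε e (0<1/suc M′) (1ℚ + D₀ - q)
      N : ℕ
      N = suc (proj₁ big-sample ℕ.+ proj₁ cheap ℕ.+ proj₁ absorbed)

      rare-≤ : ∀ k .{{_ : NonZero k}} → suc (proj₁ rare) ℕ.≤ k →
        fromℕ 2 * (fromℕ 2 * (square (fromℕ (suc (2 ℕ.* M′))) * fromℕ 4) * 1/suc (ℕ.pred k)) ≤ e
      rare-≤ (suc p) (s≤s K≤p) = begin
        fromℕ 2 * (fromℕ 2 * A * u)     ≡⟨ solve 2 (λ A u → con (fromℕ 2) :* (con (fromℕ 2) :* A :* u) := u :* (con (fromℕ 4) :* A)) refl A u ⟩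
        u * C                           ≤⟨ *-mono-≤ u (0≤1/suc p) (proj₂ rare (suc p) (ℕ.m≤n⇒m≤1+n K≤p)) ⟩
        u * (e * fromℕ (suc p))         ≡⟨ solve 3 (λ u e p → u :* (e :* p) := e :* (p :* u)) refl u e (fromℕ (suc p)) ⟩
        e * (fromℕ (suc p) * u)         ≡⟨ cong (e *_) (suc*1/suc p) ⟩
        e * 1ℚ                          ≡⟨ ℚ.*-identityʳ e ⟩
        e                               ∎
        where
        open ℚ.≤-Reasoning
        open +-*-Solver
        A = square (fromℕ (suc (2 ℕ.* M′))) * fromℕ 4
        u = 1/suc p

      small = quickXsort-finite N
      U = proj₁ small
      0≤U = proj₁ (proj₂ small)
      -- `q` may be negative, so `D` also has to cover - `q` n for n < `N`.
      linear = finitely-bounded (λ n → - (q * fromℕ n)) N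
      D = U + proj₁ linear

      small-≤ : ∀ n → n ℕ.< N → ∀ a → averageCost (quickXsort-acc X I n a) ≤ boundAt c M′ (fromℕ 18) D n
      small-≤ n n<N a = ≤-from
        (ℚ.+-mono-≤ (ℚ.+-mono-≤ (proj₂ (proj₂ small) n n<N a) (proj₂ (proj₂ linear) n n<N))
          (+-nonNeg (0≤fromℕ (⌊nlog₂n⌋ n)) (*-nonNeg (0≤fromℕ 18) (*-nonNeg (0≤1/suc M′) (0≤fromℕ n)))))
        (solve 6 (λ t U B L a z → t :+ (U :+ B :+ (L :+ z)) := L :+ a :+ z :+ (U :+ B) :+ (t :+ (:- a) :+ con 0ℚ))
          refl (averageCost (quickXsort-acc X I n a)) U (proj₁ linear) (fromℕ (⌊nlog₂n⌋ n)) (q * fromℕ n) (fromℕ 18 * (e * fromℕ n)))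
        where open +-*-Solver

      all-≤ : ∀ n a → averageCost (quickXsort-acc X I n a) ≤ boundAt c M′ (fromℕ 18) D n
      -- The test against `N` is passed as an argument, and `acc rs` is matched only where the
      -- recursion continues; it is structural in the accessibility proof.
      all-≤′ : ∀ n a → Dec (n ℕ.< N) → averageCost (quickXsort-acc X I n a) ≤ boundAt c M′ (fromℕ 18) D n
      all-≤ n a = all-≤′ n a (n ℕ.<? N)
      all-≤′ n       a        (yes n<N) = small-≤ n n<N a
      all-≤′ zero    a        (no 0≮N)  = contradiction (s≤s z≤n) 0≮N
      all-≤′ (suc m) (acc rs) (no n≮N)  = quickXsort-induction M′ 18≤M X I selects q D₀ X≤ rs
        (proj₂ cheap n {{sampleSize≢0 n}} (ℕ.≤-trans (ℕ.m≤n+m _ (proj₁ big-sample)) first-two))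
        (rare-≤ (sampleSize n) {{sampleSize≢0 n}} (proj₂ big-sample n (ℕ.≤-trans (ℕ.m≤m+n _ (proj₁ cheap)) first-two)))
        (proj₂ absorbed n (ℕ.≤-trans (ℕ.m≤n+m _ (proj₁ big-sample ℕ.+ proj₁ cheap)) all-three))
        {D} (λ r< → all-≤ _ (rs r<))
        where
        n = suc m
        all-three : proj₁ big-sample ℕ.+ proj₁ cheap ℕ.+ proj₁ absorbed ℕ.≤ n
        all-three = ℕ.≤-trans (ℕ.n≤1+n _) (ℕ.≮⇒≥ n≮N)
        first-two : proj₁ big-sample ℕ.+ proj₁ cheap ℕ.≤ n
        first-two = ℕ.m+n≤o⇒m≤o (proj₁ big-sample ℕ.+ proj₁ cheap) all-three

    quickXsort-boundAt : ∃[ D ] ∀ n → averageComparisons (quickXsort X I n) ≤ boundAt c M′ (fromℕ 18) D n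
    quickXsort-boundAt = D , λ n → subst (_≤ boundAt c M′ (fromℕ 18) D n)
      (sym (averageComparisons≡averageCost (quickXsort X I n))) (all-≤ n (<-wellFounded n))

theorem1 : (X : SortingProcedure) → IsSortingAlgorithm X →
    (c : ℝ) →
    AtMost-nlog[n]+ c n+o[n] (λ n → averageComparisons (X n)) →
    (I : Implementation) →
    IsΘ[√n] (Implementation.sampleSize I) →
    SelectsMedian (Implementation.select I) →
    IsSubquadratic (Implementation.select I) →
    IsSortingAlgorithm (quickXsort X I) ×
    AtMost-nlog[n]+ c n+o[n] (λ n → averageComparisons (quickXsort X I n))
theorem1 X X-sorts c X-fast I Θ selects subquadratic =
  (λ n σ → Always⇒Surely σ (quickXsort X I n) (quickXsort-acc-sorts X I X-sorts n (<-wellFounded n) σ)) ,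
  boundAt⇒AtMost c (λ n → averageComparisons (quickXsort X I n))
    (quickXsort-boundAt X I selects c X-fast Θ subquadratic)
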